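{- For every $k \geq 0$, there exist non-isomorphic graphs $G$ and $H$ that are homomorphism indistinguishable over all graphs of vortex-free Hadwiger number $\leq k$.
   Context: All graphs are finite, simple and loopless. Two graphs $G$ and $H$ are homomorphism indistinguishable over a graph class $\mathcal{F}$ if $\hom(F,G)=\hom(F,H)$ for every $F\in\mathcal{F}$, where $\hom(F,G)$ is the number of homomorphisms $F\to G$. For $g,d\geq 0$, let $\mathcal{C}_{g,d}$ be the class of graphs $G$ having a set $S\subseteq V(G)$ with $|S|\leq d$ such that $G-S$ has Euler genus $\leq g$. For a graph $G$ and $X\subseteq V(G)$, the torso of $G$ on $X$ is the graph with vertex set $X$ whose edges are the edges of $G$ with both endpoints in $X$ together with all pairs $xy$ with $x,y\in N_G(C)$ for some connected component $C$ of $G-X$. For a graph class $\mathcal{C}$ and $s\geq 0$, $\mathcal{C}^{\oplus s}$ is the class of graphs $G$ admitting a tree decomposition $(T,\beta)$ such that $|\beta(t)\cap\beta(t')|\leq s$ for every edge $tt'\in E(T)$ and the torso of $G$ on $\beta(t)$ lies in $\mathcal{C}$ for every $t\in V(T)$. The vortex-free Hadwiger number of a graph $G$ is the minimum $k\geq 0$ such that $G\in\mathcal{C}_{k,k}^{\oplus k}$. -}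

module Defs where

open import Data.Nat using (ℕ; zero; suc; _+_; _*_; _∸_; _≤_; _<ᵇ_; _≡ᵇ_)
open import Data.Bool using (Bool; true; false; _∧_; _∨_; not; if_then_else_; _xor_)
open import Data.Bool.Properties using (∨-comm)
open import Data.Fin using (Fin; toℕ)
open import Data.List using (List; []; _∷_; map; concatMap; allFin; length; filterᵇ)
import Data.Vec.Functional as VF
open import Data.Product using (Σ; ∃; ∃-syntax; _×_; _,_; proj₁)
open import Data.Sum using (_⊎_)
open import Relation.Binary.PropositionalEquality using (_≡_; refl)

record Graph : Set where
  field
    size       : ℕ
    adj        : Fin size → Fin size → Bool
    adj-sym    : ∀ i j → adj i j ≡ adj j i
    adj-irrefl : ∀ i → adj i i ≡ false
open Graph public

anyF : ∀ n → (Fin n → Bool) → Bool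
anyF zero    f = false
anyF (suc n) f = f Fin.zero ∨ anyF n (λ i → f (Fin.suc i))

sumF : ∀ n → (Fin n → ℕ) → ℕ
sumF zero    f = 0
sumF (suc n) f = f Fin.zero + sumF n (λ i → f (Fin.suc i))

countF : ∀ n → (Fin n → Bool) → ℕ
countF n f = sumF n (λ i → if f i then 1 else 0)

anyN : ℕ → (ℕ → Bool) → Bool
anyN zero    f = false
anyN (suc k) f = f k ∨ anyN k f

eqN : ℕ → ℕ → Bool
eqN = _≡ᵇ_

eqFin : ∀ {n} → Fin n → Fin n → Bool
eqFin i j = toℕ i ≡ᵇ toℕ j

eqBool : Bool → Bool → Bool
eqBool a b = not (a xor b)

iter : ∀ {A : Set} → (A → A) → ℕ → A → A
iter f zero    x = x
iter f (suc k) x = f (iter f k x)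

Sub : ℕ → Set
Sub n = Fin n → Bool

∣_∣ₛ : ∀ {n} → Sub n → ℕ
∣_∣ₛ {n} X = countF n X

reachK : (G : Graph) → Sub (size G) → ℕ → Fin (size G) → Sub (size G)
reachK G Y zero    u v = Y u ∧ eqFin u v
reachK G Y (suc k) u v =
  reachK G Y k u v ∨ (Y v ∧ anyF (size G) (λ w → reachK G Y k u w ∧ adj G w v))

conn : (G : Graph) → Sub (size G) → Fin (size G) → Fin (size G) → Bool
conn G Y u v = reachK G Y (size G) u v

components : (G : Graph) → Sub (size G) → ℕ
components G Y = countF (size G) λ u →
  Y u ∧ not (anyF (size G) (λ w → (toℕ w <ᵇ toℕ u) ∧ conn G Y w u))

edges : (G : Graph) → Sub (size G) → ℕ
edges G Y = sumF (size G) λ i → countF (size G) λ j →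
  Y i ∧ Y j ∧ (toℕ i <ᵇ toℕ j) ∧ adj G i j

isolated : (G : Graph) → Sub (size G) → ℕ
isolated G Y = countF (size G) λ v →
  Y v ∧ not (anyF (size G) (λ w → Y w ∧ adj G v w))

-- Euler genus, via combinatorial maps (graph-encoded maps / flags)
--
-- A flag (v , w , s) of G[Y] is a vertex v, an edge vw of G[Y] and a
-- side s.  r0 swaps the end of the edge, r2 swaps the side.  A
-- (cellular, possibly non-orientable) embedding of G[Y] is given by a
-- fixed-point-free involution r1 on the flags fixing the vertex such
-- that <r1,r2> acts transitively on the flags at each vertex (the
-- local rotation).  Faces are the <r0,r1>-orbits (plus one face per
-- isolated vertex).

Flag : ℕ → Set
Flag n = Fin n × Fin n × Bool

validFlag : (G : Graph) → Sub (size G) → Flag (size G) → Bool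
validFlag G Y (v , w , s) = Y v ∧ Y w ∧ adj G v w

r0 : ∀ {n} → Flag n → Flag n
r0 (v , w , s) = (w , v , s)

r2 : ∀ {n} → Flag n → Flag n
r2 (v , w , s) = (v , w , not s)

eqFlag : ∀ {n} → Flag n → Flag n → Bool
eqFlag (v , w , s) (v' , w' , s') = eqFin v v' ∧ eqFin w w' ∧ eqBool s s'

record Embedding (G : Graph) (Y : Sub (size G)) : Set where
  field
    r1         : Flag (size G) → Flag (size G)
    r1-valid   : ∀ x → validFlag G Y x ≡ true → validFlag G Y (r1 x) ≡ true
    r1-invol   : ∀ x → validFlag G Y x ≡ true → r1 (r1 x) ≡ x
    r1-nofix   : ∀ x → validFlag G Y x ≡ true → eqFlag (r1 x) x ≡ false
    r1-vertex  : ∀ x → validFlag G Y x ≡ true → proj₁ (r1 x) ≡ proj₁ x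
    r1-transitive : ∀ x y → validFlag G Y x ≡ true → validFlag G Y y ≡ true →
      proj₁ x ≡ proj₁ y →
      ∃[ i ] (y ≡ iter (λ z → r1 (r2 z)) i x ⊎ y ≡ iter (λ z → r1 (r2 z)) i (r1 x))
open Embedding public

anyFlag : ∀ n → (Flag n → Bool) → Bool
anyFlag n f = anyF n λ v → anyF n λ w → f (v , w , false) ∨ f (v , w , true)

countFlag : ∀ n → (Flag n → Bool) → ℕ
countFlag n f = sumF n λ v → sumF n λ w →
  (if f (v , w , false) then 1 else 0) + (if f (v , w , true) then 1 else 0)

flagCode : ∀ {n} → Flag n → ℕ
flagCode {n} (v , w , s) = (toℕ v * n + toℕ w) * 2 + (if s then 1 else 0)

-- y lies in the <r0,r1>-orbit of x.  The group generated by the two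
-- involutions r0, r1 consists of the maps (r0 r1)^i and (r0 r1)^i r0,
-- and i ranging below 2 n n + 1 (more than the number of flags)
-- covers every cycle of the permutation r0 r1.
sameFace : (G : Graph) (Y : Sub (size G)) → Embedding G Y →
           Flag (size G) → Flag (size G) → Bool
sameFace G Y E x y = anyN (2 * size G * size G + 1) λ i →
  eqFlag y (iter (λ z → r0 (r1 E z)) i x) ∨
  eqFlag y (iter (λ z → r0 (r1 E z)) i (r0 x))

faces : (G : Graph) (Y : Sub (size G)) → Embedding G Y → ℕ
faces G Y E =
  countFlag (size G) (λ x → validFlag G Y x ∧
    not (anyFlag (size G) (λ y → validFlag G Y y ∧ (flagCode y <ᵇ flagCode x)
                                  ∧ sameFace G Y E x y)))
  + isolated G Y

-- G[Y] has Euler genus ≤ g: some embedding has Euler genus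
-- 2c - V + E - F ≤ g (sum of Euler genera of the components' surfaces)
EulerGenus≤ : (G : Graph) → Sub (size G) → ℕ → Set
EulerGenus≤ G Y g = Σ (Embedding G Y) λ E →
  2 * components G Y + edges G Y ≤ g + ∣ Y ∣ₛ + faces G Y E

_⊆ₛ_ : ∀ {n} → Sub n → Sub n → Set
_⊆ₛ_ {n} S Y = ∀ v → S v ≡ true → Y v ≡ true

InC : ℕ → ℕ → (G : Graph) → Sub (size G) → Set
InC g d G Y = Σ (Sub (size G)) λ S →
  S ⊆ₛ Y × ∣ S ∣ₛ ≤ d × EulerGenus≤ G (λ v → Y v ∧ not (S v)) g

-- Torso of G on X (as a graph on the same vertex set; only G'[X] matters)

torsoRel : (G : Graph) → Sub (size G) → Fin (size G) → Fin (size G) → Bool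
torsoRel G X x y = X x ∧ X y ∧
  (adj G x y ∨
   anyF (size G) (λ u → anyF (size G) (λ v →
     adj G u x ∧ adj G v y ∧ conn G (λ z → not (X z)) u v)))

eqFin-refl : ∀ {n} (i : Fin n) → eqFin i i ≡ true
eqFin-refl i = go (toℕ i)
  where
  go : ∀ m → (m ≡ᵇ m) ≡ true
  go zero    = refl
  go (suc m) = go m

eqFin-sym : ∀ {n} (a b : Fin n) → eqFin a b ≡ eqFin b a
eqFin-sym a b = go (toℕ a) (toℕ b)
  where
  go : ∀ m k → (m ≡ᵇ k) ≡ (k ≡ᵇ m)
  go zero zero = refl
  go zero (suc k) = refl
  go (suc m) zero = refl
  go (suc m) (suc k) = go m k

torso : (G : Graph) → Sub (size G) → Graph
torso G X = record
  { size = size G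
  ; adj = λ x y → not (eqFin x y) ∧ (torsoRel G X x y ∨ torsoRel G X y x)
  ; adj-sym = sym'
  ; adj-irrefl = irr
  }
  where
  sym' : ∀ x y → (not (eqFin x y) ∧ (torsoRel G X x y ∨ torsoRel G X y x))
               ≡ (not (eqFin y x) ∧ (torsoRel G X y x ∨ torsoRel G X x y))
  sym' x y rewrite eqFin-sym x y | ∨-comm (torsoRel G X x y) (torsoRel G X y x) = refl
  irr : ∀ x → (not (eqFin x x) ∧ (torsoRel G X x x ∨ torsoRel G X x x)) ≡ false
  irr x rewrite eqFin-refl x = refl

allV : ∀ {n} → Sub n
allV _ = true

IsTree : Graph → Set
IsTree T = (1 ≤ size T) ×
           (∀ a b → conn T allV a b ≡ true) ×
           (edges T allV ≡ size T ∸ 1)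

record TreeDecomposition (G : Graph) : Set where
  field
    tree     : Graph
    is-tree  : IsTree tree
    bag      : Fin (size tree) → Sub (size G)
    cover-v  : ∀ v → ∃[ t ] bag t v ≡ true
    cover-e  : ∀ u v → adj G u v ≡ true → ∃[ t ] (bag t u ≡ true × bag t v ≡ true)
    coherent : ∀ v t t' → bag t v ≡ true → bag t' v ≡ true →
               conn tree (λ s → bag s v) t t' ≡ true
open TreeDecomposition public

InSum : ℕ → ℕ → ℕ → Graph → Set
InSum g d s G = Σ (TreeDecomposition G) λ D →
  (∀ t t' → adj (tree D) t t' ≡ true → ∣ (λ v → bag D t v ∧ bag D t' v) ∣ₛ ≤ s) ×
  (∀ t → InC g d (torso G (bag D t)) (bag D t))

-- vortex-free Hadwiger number ≤ k  (the minimum k' with G ∈ C_{k',k'}^{⊕k'} is ≤ k)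
VFHadwiger≤ : Graph → ℕ → Set
VFHadwiger≤ G k = ∃[ k' ] (k' ≤ k × InSum k' k' k' G)

allFuns : ∀ p n → List (Fin p → Fin n)
allFuns zero    n = (λ ()) ∷ []
allFuns (suc p) n = concatMap (λ a → map (λ f → a VF.∷ f) (allFuns p n)) (allFin n)

isHom : (F G : Graph) → (Fin (size F) → Fin (size G)) → Bool
isHom F G f = not (anyF (size F) λ i → anyF (size F) λ j →
  adj F i j ∧ not (adj G (f i) (f j)))

hom : Graph → Graph → ℕ
hom F G = length (filterᵇ (isHom F G) (allFuns (size F) (size G)))

record _≅_ (G H : Graph) : Set where
  field
    to      : Fin (size G) → Fin (size H)
    from    : Fin (size H) → Fin (size G)
    from-to : ∀ i → from (to i) ≡ i
    to-from : ∀ j → to (from j) ≡ j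
    adj-pres : ∀ i j → adj H (to i) (to j) ≡ adj G i j

{-# OPTIONS --safe #-}
module Submission where

-- G and H are the untwisted and the twisted CFI graph of a large complete graph K_N.  If they were distinguished by F, linear
-- algebra over 𝔽₂ would yield a map φ : V(F) → V(K_N) and a subgraph Z of F that is an oddomorphism to K_N (Roberson).
-- Walking along the tree decomposition of F towards the odd side of each adhesion leads to a bag whose outer components are all
-- even; such a component only acts on its attachment set, which is a clique of the torso, so it can be replaced by torso edges.
-- K_N contains many disjoint copies of K₃,₃.  Over each copy that avoids the ≤ k apices and the ≤ k attachment vertices, the
-- Mermin–Peres magic square gives two 𝔽₂-cycles of the torso with odd intersection number, and these pairs are orthogonal for
-- different copies.  But the intersection form of an embedded graph vanishes on face boundaries, so its rank is at most the
-- Euler genus.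

open import Defs
open import Data.Bool using (Bool; true; false; _∧_; _∨_; not; if_then_else_; _xor_)
open import Data.Bool.Properties using (T?; T-≡; ¬-not; xor-assoc; xor-comm; xor-same; xor-identityʳ; ∧-comm; ∧-assoc; ∧-zeroʳ; ∧-identityʳ; ∧-distribˡ-xor; ∧-distribʳ-xor)
import Data.Bool.Properties as Bool
open import Data.Bool.Solver using (module xor-∧-Solver)
open import Data.Empty using (⊥; ⊥-elim)
open import Data.Fin using (Fin; toℕ; zero; suc)
open import Data.Fin.Patterns using (0F; 1F; 2F; 3F; 4F; 5F)
import Data.Fin as Fin
import Data.Fin.Properties as Fin
open import Data.List using (List; []; _∷_; _++_; map; concatMap; allFin; length; filterᵇ; cartesianProduct; cartesianProductWith)
open import Data.List.Membership.Propositional using (_∈_)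
open import Data.List.Membership.Propositional.Properties using (∈-map⁺; ∈-map⁻; ∈-++⁺ˡ; ∈-++⁺ʳ; ∈-++⁻; ∈-∃++; ∈-lookup; ∈-allFin; ∈-cartesianProduct⁺; ∈-cartesianProductWith⁺; ∈-filter⁺; ∈-filter⁻)
import Data.List.Properties as List
open import Data.List.Relation.Binary.Disjoint.Propositional using (Disjoint)
open import Data.List.Relation.Unary.All using ([]; _∷_)
import Data.List.Relation.Unary.All as All
open import Data.List.Relation.Unary.Any using (here; there)
open import Data.List.Relation.Unary.AllPairs using ([]; _∷_)
open import Data.List.Relation.Unary.Unique.Propositional using (Unique)
import Data.List.Relation.Unary.Unique.Propositional.Properties as Unique
open import Data.Nat using (ℕ; zero; suc; _+_; _*_; _∸_; _≤_; _<_; _<ᵇ_; z≤n; s≤s; _^_)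
import Data.Nat.Properties as ℕ
open import Data.Nat.Solver using (module +-*-Solver)
import Data.Nat.DivMod as ℕ
open import Data.Product using (Σ; ∃; _×_; _,_; proj₁; proj₂)
import Data.Product.Properties as Product
open import Data.Sum using (_⊎_; inj₁; inj₂)
import Data.Sum.Properties as Sum
open import Data.Vec using (Vec; []; _∷_)
import Data.Vec as Vec
import Data.Vec.Functional as VF
import Data.Vec.Properties as Vec
open import Function using (_∘_; Equivalence)
open import Relation.Binary using (DecidableEquality; tri<; tri≈; tri>)
open import Relation.Binary.PropositionalEquality using (_≡_; _≢_; _≗_; refl; sym; trans; cong; cong₂; subst; module ≡-Reasoning)
open import Relation.Nullary using (¬_; yes; no; does; contradiction)
open import Relation.Nullary.Decidable using (dec-true; dec-false)

-- An oddomorphism is far from a minor model: the fibres of φ may be disconnected and Z controls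
-- nothing but parities. So non-embeddability of K_N cannot be invoked, and the obstruction has to
-- be linear over 𝔽₂. Intersection numbers qualify. A 4-cycle of K₃,₃ lifts along Z to a subgraph
-- with all degrees even. Two 4-cycles overlapping in a single edge have lifts that share, between
-- the two fibres of that edge, as many edges mod 2 as there are odd vertices over one end: an odd
-- number. The magic square arranges the remaining local contributions so that they cancel. The
-- passage to an all-even bag is forced by the torso: the edges replacing a component must end in
-- its attachment vertices, yet an odd component would get `θ` = 1 towards every fibre that its
-- attachment vertices miss. The surface is given by flags only, without curves to put in general
-- position. A cycle is therefore encoded by a colouring of the corners around each vertex
-- (`Potential`), and it bounds when the colours can be chosen constant on faces.

private variable
  𝒜 ℬ 𝒞 : Set

-- Boolean identities

∧-trueˡ : ∀ {a b} → a ∧ b ≡ true → a ≡ true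
∧-trueˡ {true} _ = refl

∧-trueʳ : ∀ {a b} → a ∧ b ≡ true → b ≡ true
∧-trueʳ {true} e = e

∧-true : ∀ {a b} → a ≡ true → b ≡ true → a ∧ b ≡ true
∧-true refl refl = refl

∨-trueʳ : ∀ {a b} → b ≡ true → a ∨ b ≡ true
∨-trueʳ {true}  _ = refl
∨-trueʳ {false} e = e

∨-trueˡ : ∀ {a b} → a ≡ true → a ∨ b ≡ true
∨-trueˡ refl = refl

∨-true⁻ : ∀ {a b} → a ∨ b ≡ true → a ≡ true ⊎ b ≡ true
∨-true⁻ {true}  _ = inj₁ refl
∨-true⁻ {false} e = inj₂ e

not-true : ∀ {a} → a ≡ false → not a ≡ true
not-true refl = refl

not-true⁻ : ∀ {a} → not a ≡ true → a ≡ false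
not-true⁻ {false} _ = refl

true≢false : ∀ {a} → a ≡ true → a ≡ false → ⊥
true≢false refl ()

bool-split : ∀ a → a ≡ true ⊎ a ≡ false
bool-split true  = inj₁ refl
bool-split false = inj₂ refl

xor-false⇒≡ : ∀ {a b} → a xor b ≡ false → a ≡ b
xor-false⇒≡ {true}  {true}  _ = refl
xor-false⇒≡ {false} {false} _ = refl

≡⇒xor-false : ∀ {a b} → a ≡ b → a xor b ≡ false
≡⇒xor-false {a} refl = xor-same a

∧-cong-true : ∀ {a b c} → (a ≡ true → b ≡ c) → a ∧ b ≡ a ∧ c
∧-cong-true {true}  e = e refl
∧-cong-true {false} e = refl

infix 4.5 _==_
_==_ : ∀ {n} → Fin n → Fin n → Bool
i == j = does (i Fin.≟ j)

==⇒≡ : ∀ {n} {i j : Fin n} → (i == j) ≡ true → i ≡ j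
==⇒≡ {i = i} {j} e with i Fin.≟ j
... | yes p = p

==-refl : ∀ {n} (i : Fin n) → (i == i) ≡ true
==-refl i = dec-true (i Fin.≟ i) refl

≡⇒== : ∀ {n} {i j : Fin n} → i ≡ j → (i == j) ≡ true
≡⇒== {i = i} refl = ==-refl i

≢⇒== : ∀ {n} {i j : Fin n} → i ≢ j → (i == j) ≡ false
≢⇒== {i = i} {j} = dec-false (i Fin.≟ j)

==⇒≢ : ∀ {n} {i j : Fin n} → (i == j) ≡ false → i ≢ j
==⇒≢ e p = true≢false (≡⇒== p) e

==-sym : ∀ {n} (i j : Fin n) → (i == j) ≡ (j == i)
==-sym i j with i Fin.≟ j
... | yes refl = sym (==-refl i)
... | no i≢j = sym (≢⇒== (i≢j ∘ sym))

module _ (_≟_ : DecidableEquality 𝒜) where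
  does⇒≡ : ∀ {x y} → does (x ≟ y) ≡ true → x ≡ y
  does⇒≡ {x} {y} e with x ≟ y
  ... | yes p = p

-- Sums over 𝔽₂

⨁ : List 𝒜 → (𝒜 → Bool) → Bool
⨁ []       f = false
⨁ (x ∷ xs) f = f x xor ⨁ xs f

∑ : ∀ {n} → (Fin n → Bool) → Bool
∑ = ⨁ (allFin _)

xor-interchange : ∀ a b c d → (a xor b) xor (c xor d) ≡ (a xor c) xor (b xor d)
xor-interchange = solve 4 (λ a b c d → (a :+ b) :+ (c :+ d) := (a :+ c) :+ (b :+ d)) refl
  where open xor-∧-Solver

⨁-cong∈ : ∀ (xs : List 𝒜) {f g} → (∀ {x} → x ∈ xs → f x ≡ g x) → ⨁ xs f ≡ ⨁ xs g
⨁-cong∈ []       e = refl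
⨁-cong∈ (x ∷ xs) e = cong₂ _xor_ (e (here refl)) (⨁-cong∈ xs (e ∘ there))

⨁-cong : ∀ (xs : List 𝒜) {f g} → (∀ x → f x ≡ g x) → ⨁ xs f ≡ ⨁ xs g
⨁-cong xs e = ⨁-cong∈ xs (λ {x} _ → e x)

⨁-false : ∀ (xs : List 𝒜) → ⨁ xs (λ _ → false) ≡ false
⨁-false []       = refl
⨁-false (x ∷ xs) = ⨁-false xs

⨁-zero∈ : ∀ (xs : List 𝒜) {f} → (∀ {x} → x ∈ xs → f x ≡ false) → ⨁ xs f ≡ false
⨁-zero∈ xs e = trans (⨁-cong∈ xs e) (⨁-false xs)

⨁-zero : ∀ (xs : List 𝒜) {f} → (∀ x → f x ≡ false) → ⨁ xs f ≡ false
⨁-zero xs e = ⨁-zero∈ xs (λ {x} _ → e x)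

⨁-xor : ∀ (xs : List 𝒜) (f g : 𝒜 → Bool) → ⨁ xs (λ x → f x xor g x) ≡ ⨁ xs f xor ⨁ xs g
⨁-xor []       f g = refl
⨁-xor (x ∷ xs) f g rewrite ⨁-xor xs f g = xor-interchange (f x) (g x) (⨁ xs f) (⨁ xs g)

⨁-∧ˡ : ∀ (xs : List 𝒜) c (f : 𝒜 → Bool) → ⨁ xs (λ x → c ∧ f x) ≡ c ∧ ⨁ xs f
⨁-∧ˡ xs true  f = refl
⨁-∧ˡ xs false f = ⨁-false xs

⨁-∧ʳ : ∀ (xs : List 𝒜) c (f : 𝒜 → Bool) → ⨁ xs (λ x → f x ∧ c) ≡ ⨁ xs f ∧ c
⨁-∧ʳ xs c f = trans (⨁-cong xs (λ x → ∧-comm (f x) c)) (trans (⨁-∧ˡ xs c f) (∧-comm c _))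

⨁-swap : ∀ (xs : List 𝒜) (ys : List ℬ) (f : 𝒜 → ℬ → Bool) → ⨁ xs (λ x → ⨁ ys (f x)) ≡ ⨁ ys (λ y → ⨁ xs (λ x → f x y))
⨁-swap []       ys f = sym (⨁-false ys)
⨁-swap (x ∷ xs) ys f rewrite ⨁-swap xs ys f = sym (⨁-xor ys (f x) (λ y → ⨁ xs (λ x → f x y)))

⨁-++ : ∀ (xs ys : List 𝒜) f → ⨁ (xs ++ ys) f ≡ ⨁ xs f xor ⨁ ys f
⨁-++ []       ys f = refl
⨁-++ (x ∷ xs) ys f rewrite ⨁-++ xs ys f = sym (xor-assoc (f x) (⨁ xs f) (⨁ ys f))

⨁-map : ∀ (h : 𝒜 → ℬ) xs f → ⨁ (map h xs) f ≡ ⨁ xs (f ∘ h)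
⨁-map h []       f = refl
⨁-map h (x ∷ xs) f = cong (f (h x) xor_) (⨁-map h xs f)

⨁-product : ∀ (xs : List 𝒜) (ys : List ℬ) f →
  ⨁ (cartesianProduct xs ys) f ≡ ⨁ xs (λ x → ⨁ ys (λ y → f (x , y)))
⨁-product []       ys f = refl
⨁-product (x ∷ xs) ys f = trans (⨁-++ (map (x ,_) ys) (cartesianProduct xs ys) f)
  (cong₂ _xor_ (⨁-map (x ,_) ys f) (⨁-product xs ys f))

⨁-filter : ∀ p (xs : List 𝒜) f → ⨁ (filterᵇ p xs) f ≡ ⨁ xs (λ x → p x ∧ f x)
⨁-filter p []       f = refl
⨁-filter p (x ∷ xs) f with p x
... | true  = cong (f x xor_) (⨁-filter p xs f)
... | false = ⨁-filter p xs f

⨁-true⁻ : ∀ (xs : List 𝒜) {f} → ⨁ xs f ≡ true → ∃ λ x → x ∈ xs × f x ≡ true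
⨁-true⁻ (x ∷ xs) {f} e with f x in eq
... | true = x , here refl , eq
... | false with y , y∈ , fy ← ⨁-true⁻ xs e = y , there y∈ , fy

module _ (_≟_ : DecidableEquality 𝒜) where

  ⨁-pick : ∀ {xs : List 𝒜} → Unique xs → ∀ {y} → y ∈ xs → ∀ (f : 𝒜 → Bool) →
    ⨁ xs (λ x → does (x ≟ y) ∧ f x) ≡ f y
  ⨁-pick {xs = x ∷ xs} (x∉ ∷ u) {y} (here refl) f = begin
      (does (x ≟ x) ∧ f x) xor ⨁ xs (λ z → does (z ≟ x) ∧ f z)
    ≡⟨ cong₂ _xor_ (cong (_∧ f x) (dec-true (x ≟ x) refl))
         (⨁-zero∈ xs (λ {z} z∈ → cong (_∧ f z) (dec-false (z ≟ x) (λ z≡x → All.lookup x∉ z∈ (sym z≡x))))) ⟩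
      f x xor false
    ≡⟨ xor-identityʳ _ ⟩
      f x ∎
    where open ≡-Reasoning
  ⨁-pick {xs = x ∷ xs} (x∉ ∷ u) {y} (there y∈) f = begin
      (does (x ≟ y) ∧ f x) xor ⨁ xs (λ z → does (z ≟ y) ∧ f z)
    ≡⟨ cong₂ _xor_ (cong (_∧ f x) (dec-false (x ≟ y) (All.lookup x∉ y∈))) (⨁-pick u y∈ f) ⟩
      f y ∎
    where open ≡-Reasoning

∑-cong : ∀ n {f g : Fin n → Bool} → (∀ i → f i ≡ g i) → ⨁ (allFin n) f ≡ ⨁ (allFin n) g
∑-cong n = ⨁-cong (allFin n)

∑-zero : ∀ n {f : Fin n → Bool} → (∀ i → f i ≡ false) → ⨁ (allFin n) f ≡ false
∑-zero n = ⨁-zero (allFin n)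

∑-xor : ∀ n (f g : Fin n → Bool) → ⨁ (allFin n) (λ i → f i xor g i) ≡ ⨁ (allFin n) f xor ⨁ (allFin n) g
∑-xor n = ⨁-xor (allFin n)

∑-∧ˡ : ∀ n c (f : Fin n → Bool) → ⨁ (allFin n) (λ i → c ∧ f i) ≡ c ∧ ⨁ (allFin n) f
∑-∧ˡ n = ⨁-∧ˡ (allFin n)

∑-∧ʳ : ∀ n c (f : Fin n → Bool) → ⨁ (allFin n) (λ i → f i ∧ c) ≡ ⨁ (allFin n) f ∧ c
∑-∧ʳ n = ⨁-∧ʳ (allFin n)

∑-swap : ∀ m n (f : Fin m → Fin n → Bool) →
  ⨁ (allFin m) (λ i → ⨁ (allFin n) (f i)) ≡ ⨁ (allFin n) (λ j → ⨁ (allFin m) (λ i → f i j))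
∑-swap m n = ⨁-swap (allFin m) (allFin n)

∑-pick : ∀ {n} (j : Fin n) (f : Fin n → Bool) → ∑ (λ i → (i == j) ∧ f i) ≡ f j
∑-pick j f = ⨁-pick Fin._≟_ (Unique.allFin⁺ _) (∈-allFin j) f

∑-pick′ : ∀ {n} (j : Fin n) (f : Fin n → Bool) → ∑ (λ i → (j == i) ∧ f i) ≡ f j
∑-pick′ j f = trans (⨁-cong (allFin _) (λ i → cong (_∧ f i) (==-sym j i))) (∑-pick j f)

-- The handshake lemma: the terms at (x, y) and (y, x) cancel. It is behind the cancellations in
-- `⨁-involution`, `¬twist×odd`, `ω-r0-invariant` and `∑-shared`.
⨁-symmetric : ∀ (xs : List 𝒜) (s : 𝒜 → 𝒜 → Bool) → (∀ x y → s x y ≡ s y x) → (∀ x → s x x ≡ false) →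
  ⨁ xs (λ x → ⨁ xs (s x)) ≡ false
⨁-symmetric []       s s-sym s-diag = refl
⨁-symmetric (x ∷ xs) s s-sym s-diag = begin
    (s x x xor ⨁ xs (s x)) xor ⨁ xs (λ y → s y x xor ⨁ xs (s y))
  ≡⟨ cong₂ _xor_ (cong (_xor ⨁ xs (s x)) (s-diag x)) (⨁-xor xs (λ y → s y x) (λ y → ⨁ xs (s y))) ⟩
    ⨁ xs (s x) xor (⨁ xs (λ y → s y x) xor ⨁ xs (λ y → ⨁ xs (s y)))
  ≡⟨ cong (⨁ xs (s x) xor_) (cong₂ _xor_ (⨁-cong xs (λ y → s-sym y x)) (⨁-symmetric xs s s-sym s-diag)) ⟩
    ⨁ xs (s x) xor (⨁ xs (s x) xor false)
  ≡⟨ cong (⨁ xs (s x) xor_) (xor-identityʳ _) ⟩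
    ⨁ xs (s x) xor ⨁ xs (s x)
  ≡⟨ xor-same (⨁ xs (s x)) ⟩
    false ∎
  where open ≡-Reasoning

-- The involution pairs the summands, i.e. [y ≡ σ x] f x is symmetric with zero diagonal.
⨁-involution : (_≟_ : DecidableEquality 𝒜) {xs : List 𝒜} → Unique xs → (p : 𝒜 → Bool) (σ : 𝒜 → 𝒜) (f : 𝒜 → Bool) →
  (∀ {x} → p x ≡ true → p (σ x) ≡ true) → (∀ {x} → p x ≡ true → σ x ∈ xs) →
  (∀ {x} → p x ≡ true → σ (σ x) ≡ x) → (∀ {x} → p x ≡ true → σ x ≢ x) →
  (∀ {x} → p x ≡ true → f (σ x) ≡ f x) → ⨁ xs (λ x → p x ∧ f x) ≡ false
⨁-involution {𝒜 = 𝒜} _≟_ {xs} u p σ f σ-p σ-∈ σ-σ σ-≢ f-σ = begin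
    ⨁ xs (λ x → p x ∧ f x)
  ≡⟨ ⨁-cong xs (λ x → ∧-cong-true (λ px → sym (⨁-pick _≟_ u (σ-∈ px) (λ _ → f x)))) ⟩
    ⨁ xs (λ x → p x ∧ ⨁ xs (λ y → does (y ≟ σ x) ∧ f x))
  ≡⟨ ⨁-cong xs (λ x → sym (⨁-∧ˡ xs (p x) _)) ⟩
    ⨁ xs (λ x → ⨁ xs (s x))
  ≡⟨ ⨁-symmetric xs s s-sym s-diag ⟩
    false ∎
  where
  open ≡-Reasoning
  s : 𝒜 → 𝒜 → Bool
  s x y = p x ∧ (does (y ≟ σ x) ∧ f x)
  s-true : ∀ x y → s x y ≡ true → s y x ≡ true
  s-true x y e with px ← ∧-trueˡ e
                  with refl ← does⇒≡ _≟_ (∧-trueˡ {does (y ≟ σ x)} (∧-trueʳ {p x} e)) =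
    ∧-true (σ-p px) (∧-true (dec-true (x ≟ σ (σ x)) (sym (σ-σ px)))
      (trans (f-σ px) (∧-trueʳ {does (σ x ≟ σ x)} (∧-trueʳ {p x} e))))
  s-sym : ∀ x y → s x y ≡ s y x
  s-sym x y with bool-split (s x y) | bool-split (s y x)
  ... | inj₁ e | _      = trans e (sym (s-true x y e))
  ... | inj₂ e | inj₁ e′ = ⊥-elim (true≢false (s-true y x e′) e)
  ... | inj₂ e | inj₂ e′ = trans e (sym e′)
  s-diag : ∀ x → s x x ≡ false
  s-diag x = ¬-not (λ e → σ-≢ (∧-trueˡ e) (sym (does⇒≡ _≟_ (∧-trueˡ {does (x ≟ σ x)} (∧-trueʳ {p x} e)))))

-- Linear algebra over 𝔽₂

search : (p : 𝒜 → Bool) (xs : List 𝒜) →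
  (∃ λ x → x ∈ xs × p x ≡ true) ⊎ (∀ {x} → x ∈ xs → p x ≡ false)
search p [] = inj₂ λ ()
search p (x ∷ xs) with p x in px | search p xs
... | true  | _ = inj₁ (x , here refl , px)
... | false | inj₁ (y , y∈ , py) = inj₁ (y , there y∈ , py)
... | false | inj₂ none = inj₂ λ { (here refl) → px ; (there z∈) → none z∈ }

module _ (_≟_ : DecidableEquality 𝒜) where

  update : 𝒜 → Bool → (𝒜 → Bool) → 𝒜 → Bool
  update x b s z = if does (z ≟ x) then b else s z

  update-same : ∀ x b s → update x b s x ≡ b
  update-same x b s = cong (if_then b else s x) (dec-true (x ≟ x) refl)

  update-other : ∀ x b s {z} → z ≢ x → update x b s z ≡ s z
  update-other x b s {z} z≢x = cong (if_then b else s z) (dec-false (z ≟ x) z≢x)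

  ⨁-update : ∀ {x xs} → Unique (x ∷ xs) → ∀ b s (f : 𝒜 → Bool → Bool) →
    ⨁ (x ∷ xs) (λ z → f z (update x b s z)) ≡ f x b xor ⨁ xs (λ z → f z (s z))
  ⨁-update {x} {xs} (x∉ ∷ u) b s f = cong₂ _xor_ (cong (f x) (update-same x b s))
    (⨁-cong∈ xs (λ {z} z∈ → cong (f z) (update-other x b s (λ z≡x → All.lookup x∉ z∈ (sym z≡x)))))

module _ (_≟x_ : DecidableEquality 𝒜) (_≟e_ : DecidableEquality ℬ) {es : List ℬ} (ues : Unique es) where

  -- Gaussian elimination, one unknown at a time: a pivot equation e₀ containing x is added to all
  -- equations containing x (itself included, where it leaves 0 = 0). If no unknowns remain, a
  -- nonzero right-hand side is the contradiction 0 = 1. The alternative supplies both the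
  -- oddomorphisms and the potentials below.
  solvable⊎certificate : ∀ {xs : List 𝒜} → Unique xs → (M : ℬ → 𝒜 → Bool) (b : ℬ → Bool) →
    (Σ (𝒜 → Bool) λ s → ∀ {e} → e ∈ es → ⨁ xs (λ x → M e x ∧ s x) ≡ b e) ⊎
    (Σ (ℬ → Bool) λ y → (∀ {x} → x ∈ xs → ⨁ es (λ e → y e ∧ M e x) ≡ false) × ⨁ es (λ e → y e ∧ b e) ≡ true)
  solvable⊎certificate {[]} [] M b with search b es
  ... | inj₂ none = inj₁ ((λ _ → false) , λ e∈ → sym (none e∈))
  ... | inj₁ (e , e∈ , be) = inj₂ ((λ e′ → does (e′ ≟e e)) , (λ ()) , trans (⨁-pick _≟e_ ues e∈ b) be)
  solvable⊎certificate {x ∷ xs} u@(x∉ ∷ uxs) M b with search (λ e → M e x) es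
  ... | inj₂ none with solvable⊎certificate uxs M b
  ...   | inj₁ (s , sol) = inj₁ (s , λ {e} e∈ → trans (cong (λ m → (m ∧ s x) xor ⨁ xs (λ z → M e z ∧ s z)) (none e∈)) (sol e∈))
  ...   | inj₂ (y , zer , one) = inj₂ (y , (λ { (here refl) → ⨁-zero∈ es (λ {e} e∈ → trans (cong (y e ∧_) (none e∈)) (∧-zeroʳ (y e)))
                                            ; (there z∈) → zer z∈ }) , one)
  solvable⊎certificate {x ∷ xs} u@(x∉ ∷ uxs) M b | inj₁ (e₀ , e₀∈ , Me₀)
    with solvable⊎certificate uxs (λ e z → M e z xor (M e x ∧ M e₀ z)) (λ e → b e xor (M e x ∧ b e₀))
  ... | inj₁ (s , sol) = inj₁ (s′ , sol′)
    where
    open ≡-Reasoning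
    -- The value that the pivot equation forces on x.
    t = b e₀ xor ⨁ xs (λ z → M e₀ z ∧ s z)
    s′ = update _≟x_ x t s
    sol′ : ∀ {e} → e ∈ es → ⨁ (x ∷ xs) (λ z → M e z ∧ s′ z) ≡ b e
    sol′ {e} e∈ = begin
        ⨁ (x ∷ xs) (λ z → M e z ∧ s′ z)
      ≡⟨ ⨁-update _≟x_ u t s (λ z q → M e z ∧ q) ⟩
        (M e x ∧ t) xor ⨁ xs (λ z → M e z ∧ s z)
      ≡⟨ lemma (M e x) (b e₀) (⨁ xs (λ z → M e₀ z ∧ s z)) (⨁ xs (λ z → M e z ∧ s z)) ⟩
        (M e x ∧ b e₀) xor (⨁ xs (λ z → M e z ∧ s z) xor (M e x ∧ ⨁ xs (λ z → M e₀ z ∧ s z)))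
      ≡⟨ cong ((M e x ∧ b e₀) xor_) (sym (trans
           (⨁-cong xs (λ z → lemma₂ (M e z) (M e x) (M e₀ z) (s z)))
           (trans (⨁-xor xs (λ z → M e z ∧ s z) (λ z → M e x ∧ (M e₀ z ∧ s z)))
             (cong (⨁ xs (λ z → M e z ∧ s z) xor_) (⨁-∧ˡ xs (M e x) (λ z → M e₀ z ∧ s z)))))) ⟩
        (M e x ∧ b e₀) xor ⨁ xs (λ z → (M e z xor (M e x ∧ M e₀ z)) ∧ s z)
      ≡⟨ cong ((M e x ∧ b e₀) xor_) (sol e∈) ⟩
        (M e x ∧ b e₀) xor (b e xor (M e x ∧ b e₀))
      ≡⟨ lemma₃ (M e x ∧ b e₀) (b e) ⟩
        b e ∎
      where
      open xor-∧-Solver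
      lemma : ∀ m b₀ p q → (m ∧ (b₀ xor p)) xor q ≡ (m ∧ b₀) xor (q xor (m ∧ p))
      lemma = solve 4 (λ m b₀ p q → (m :* (b₀ :+ p)) :+ q := (m :* b₀) :+ (q :+ (m :* p))) refl
      lemma₂ : ∀ p q r s → (p xor (q ∧ r)) ∧ s ≡ (p ∧ s) xor (q ∧ (r ∧ s))
      lemma₂ = solve 4 (λ p q r s → (p :+ (q :* r)) :* s := (p :* s) :+ (q :* (r :* s))) refl
      lemma₃ : ∀ p q → p xor (q xor p) ≡ q
      lemma₃ = solve 2 (λ p q → p :+ (q :+ p) := q) refl
  ... | inj₂ (y , zer , one) = inj₂ (y′ , zer′ , one′)
    where
    open ≡-Reasoning
    -- The number of times, mod 2, that e₀ was added to the equations used by y; `y′` books it on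
    -- e₀.
    t = ⨁ es (λ e → y e ∧ M e x)
    y′ : ℬ → Bool
    y′ e = y e xor (does (e ≟e e₀) ∧ t)
    expand : ∀ f → ⨁ es (λ e → y′ e ∧ f e) ≡ ⨁ es (λ e → y e ∧ (f e xor (M e x ∧ f e₀)))
    expand f = begin
        ⨁ es (λ e → y′ e ∧ f e)
      ≡⟨ ⨁-cong es (λ e → lemma (y e) (does (e ≟e e₀)) t (f e)) ⟩
        ⨁ es (λ e → (y e ∧ f e) xor (does (e ≟e e₀) ∧ (t ∧ f e)))
      ≡⟨ trans (⨁-xor es _ _) (cong (⨁ es (λ e → y e ∧ f e) xor_) (⨁-pick _≟e_ ues e₀∈ (λ e → t ∧ f e))) ⟩
        ⨁ es (λ e → y e ∧ f e) xor (t ∧ f e₀)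
      ≡⟨ cong (⨁ es (λ e → y e ∧ f e) xor_) (sym (⨁-∧ʳ es (f e₀) (λ e → y e ∧ M e x))) ⟩
        ⨁ es (λ e → y e ∧ f e) xor ⨁ es (λ e → (y e ∧ M e x) ∧ f e₀)
      ≡⟨ sym (⨁-xor es _ _) ⟩
        ⨁ es (λ e → (y e ∧ f e) xor ((y e ∧ M e x) ∧ f e₀))
      ≡⟨ ⨁-cong es (λ e → lemma₂ (y e) (f e) (M e x) (f e₀)) ⟩
        ⨁ es (λ e → y e ∧ (f e xor (M e x ∧ f e₀))) ∎
      where
      open xor-∧-Solver
      lemma : ∀ y d t f → (y xor (d ∧ t)) ∧ f ≡ (y ∧ f) xor (d ∧ (t ∧ f))
      lemma = solve 4 (λ y d t f → (y :+ (d :* t)) :* f := (y :* f) :+ (d :* (t :* f))) refl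
      lemma₂ : ∀ y f m g → (y ∧ f) xor ((y ∧ m) ∧ g) ≡ y ∧ (f xor (m ∧ g))
      lemma₂ = solve 4 (λ y f m g → (y :* f) :+ ((y :* m) :* g) := y :* (f :+ (m :* g))) refl
    zer′ : ∀ {z} → z ∈ x ∷ xs → ⨁ es (λ e → y′ e ∧ M e z) ≡ false
    zer′ (here refl) = trans (expand (λ e → M e x)) (⨁-zero es (λ e →
      trans (cong (y e ∧_) (trans (cong (λ q → M e x xor (M e x ∧ q)) Me₀)
        (trans (cong (M e x xor_) (∧-identityʳ _)) (xor-same (M e x))))) (∧-zeroʳ (y e))))
    zer′ {z} (there z∈) = trans (expand (λ e → M e z)) (zer z∈)
    one′ : ⨁ es (λ e → y′ e ∧ b e) ≡ true
    one′ = trans (expand b) one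

length-remove : ∀ (es₁ : List ℬ) (e : ℬ) es₂ → length (es₁ ++ e ∷ es₂) ≡ suc (length (es₁ ++ es₂))
length-remove es₁ e es₂ rewrite List.length-++ es₁ {e ∷ es₂} | List.length-++ es₁ {es₂} = ℕ.+-suc _ _

∈-restore : ∀ (es₁ : List ℬ) {e es₂ e′} → e′ ∈ es₁ ++ e ∷ es₂ → e′ ≡ e ⊎ e′ ∈ es₁ ++ es₂
∈-restore es₁ e′∈ with ∈-++⁻ es₁ e′∈
... | inj₁ p = inj₂ (∈-++⁺ˡ p)
... | inj₂ (here refl) = inj₁ refl
... | inj₂ (there p) = inj₂ (∈-++⁺ʳ es₁ p)

⨁-remove : ∀ (es₁ : List ℬ) e es₂ f → ⨁ (es₁ ++ e ∷ es₂) f ≡ f e xor ⨁ (es₁ ++ es₂) f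
⨁-remove es₁ e es₂ f rewrite ⨁-++ es₁ (e ∷ es₂) f | ⨁-++ es₁ es₂ f =
  solve 3 (λ p q r → p :+ (q :+ r) := q :+ (p :+ r)) refl (⨁ es₁ f) (f e) (⨁ es₂ f)
  where open xor-∧-Solver

⨁-eliminate : ∀ (xs : List 𝒜) (c : 𝒜 → Bool) (z : 𝒜 → ℬ → Bool) (y : ℬ → Bool) e e′ →
  ⨁ xs (λ x → c x ∧ (z x e′ xor (z x e ∧ y e′))) ≡
  ⨁ xs (λ x → c x ∧ z x e′) xor (⨁ xs (λ x → c x ∧ z x e) ∧ y e′)
⨁-eliminate xs c z y e e′ = trans
  (⨁-cong xs (λ x → solve 4 (λ c p q r → c :* (p :+ (q :* r)) := (c :* p) :+ ((c :* q) :* r)) refl (c x) (z x e′) (z x e) (y e′)))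
  (trans (⨁-xor xs _ _) (cong (⨁ xs (λ x → c x ∧ z x e′) xor_) (⨁-∧ʳ xs (y e′) _)))
  where open xor-∧-Solver

Dependent : List 𝒜 → List ℬ → (𝒜 → ℬ → Bool) → Set
Dependent {𝒜} xs es z = Σ (𝒜 → Bool) λ c → (∃ λ x → x ∈ xs × c x ≡ true) × (∀ {e} → e ∈ es → ⨁ xs (λ x → c x ∧ z x e) ≡ false)

Independent : List 𝒞 → List ℬ → (𝒞 → ℬ → Bool) → Set
Independent {𝒞} ws es w = ∀ (c : 𝒞 → Bool) → (∀ {e} → e ∈ es → ⨁ ws (λ v → c v ∧ w v e) ≡ false) → ∀ {v} → v ∈ ws → c v ≡ false

module _ (_≟x_ : DecidableEquality 𝒜) where

  -- A zero vector is a dependency by itself. Otherwise x has an entry 1 at some e, which clears e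
  -- in all later vectors, and the coordinate e is dropped.
  dependent : ∀ {xs : List 𝒜} → Unique xs → ∀ (es : List ℬ) z → length es < length xs → Dependent xs es z
  dependent {xs = x ∷ xs} u@(x∉ ∷ uxs) es z lt with search (z x) es
  ... | inj₂ none = update _≟x_ x true (λ _ → false) , (x , here refl , update-same _≟x_ x true _) ,
        λ {e} e∈ → trans (⨁-update _≟x_ u true (λ _ → false) (λ v q → q ∧ z v e))
                         (cong₂ _xor_ (none e∈) (⨁-false xs))
  ... | inj₁ (e , e∈ , zxe) with es₁ , es₂ , refl ← ∈-∃++ e∈
    with c , (v , v∈ , cv) , zer ← dependent uxs (es₁ ++ es₂) (λ v e′ → z v e′ xor (z v e ∧ z x e′))
           (ℕ.≤-pred (subst (_< suc (length xs)) (length-remove es₁ e es₂) lt)) =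
    c′ , (v , there v∈ , trans (update-other _≟x_ x t c (λ v≡x → All.lookup x∉ v∈ (sym v≡x))) cv) , zer′
    where
    t = ⨁ xs (λ v → c v ∧ z v e)
    c′ = update _≟x_ x t c
    zer″ : ∀ {e′} → e′ ≡ e ⊎ e′ ∈ es₁ ++ es₂ → (t ∧ z x e′) xor ⨁ xs (λ v → c v ∧ z v e′) ≡ false
    zer″ (inj₁ refl) = trans (cong (_xor t) (trans (cong (t ∧_) zxe) (∧-identityʳ t))) (xor-same t)
    zer″ {e′} (inj₂ e′∈) = trans (xor-comm (t ∧ z x e′) _) (trans (sym (⨁-eliminate xs c z (z x) e e′)) (zer e′∈))
    zer′ : ∀ {e′} → e′ ∈ es₁ ++ e ∷ es₂ → ⨁ (x ∷ xs) (λ v → c′ v ∧ z v e′) ≡ false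
    zer′ {e′} e′∈ = trans (⨁-update _≟x_ u t c (λ v q → q ∧ z v e′)) (zer″ (∈-restore es₁ e′∈))

  -- Orthogonality to independent vectors saves one dimension for each. In turn every v₀ removes a
  -- coordinate e with `w v₀ e` = 1: the other w are cleared at e, so that dropping e keeps their
  -- pairings with z.
  dependent-⊥ : DecidableEquality 𝒞 → ∀ {xs : List 𝒜} → Unique xs → ∀ (es : List ℬ) z {ws : List 𝒞} → Unique ws → ∀ w →
    Independent ws es w → (∀ {x v} → x ∈ xs → v ∈ ws → ⨁ es (λ e → z x e ∧ w v e) ≡ false) →
    length es < length xs + length ws → Dependent xs es z
  dependent-⊥ _≟w_ {xs} u es z {[]} _ w ind orth lt =
    dependent u es z (subst (length es <_) (ℕ.+-identityʳ (length xs)) lt)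
  dependent-⊥ _≟w_ {xs} u es z {v₀ ∷ ws} uws@(v₀∉ ∷ uws′) w ind orth lt with search (w v₀) es
  ... | inj₂ none = ⊥-elim (true≢false (update-same _≟w_ v₀ true _)
          (ind (update _≟w_ v₀ true (λ _ → false)) (λ {e} e∈ →
            trans (⨁-update _≟w_ uws true (λ _ → false) (λ v q → q ∧ w v e)) (cong₂ _xor_ (none e∈) (⨁-false ws))) (here refl)))
  ... | inj₁ (e , e∈ , wve) with es₁ , es₂ , refl ← ∈-∃++ e∈ =
    let c , nz , zer = dependent-⊥ _≟w_ u (es₁ ++ es₂) z uws′ w′ ind′ orth′
          (ℕ.≤-pred (subst (suc (length (es₁ ++ es₂)) <_) (ℕ.+-suc (length xs) (length ws))
            (subst (_< length xs + suc (length ws)) (length-remove es₁ e es₂) lt)))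
    in c , nz , λ e′∈ → zer′ c zer (∈-restore es₁ e′∈)
    where
    w′ : _ → _ → Bool
    w′ v e′ = w v e′ xor (w v e ∧ w v₀ e′)
    w′-e : ∀ v → w′ v e ≡ false
    w′-e v = trans (cong (λ q → w v e xor (w v e ∧ q)) wve) (trans (cong (w v e xor_) (∧-identityʳ _)) (xor-same (w v e)))
    ind′ : Independent ws (es₁ ++ es₂) w′
    ind′ c zer {v} v∈ = trans (sym (update-other _≟w_ v₀ t c (λ v≡ → All.lookup v₀∉ v∈ (sym v≡))))
        (ind (update _≟w_ v₀ t c) (λ {e′} e′∈ → trans (⨁-update _≟w_ uws t c (λ v q → q ∧ w v e′)) (zer″ (∈-restore es₁ e′∈))) (there v∈))
      where
      t = ⨁ ws (λ v → c v ∧ w v e)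
      zer″ : ∀ {e′} → e′ ≡ e ⊎ e′ ∈ es₁ ++ es₂ → (t ∧ w v₀ e′) xor ⨁ ws (λ v → c v ∧ w v e′) ≡ false
      zer″ (inj₁ refl) = trans (cong (_xor t) (trans (cong (t ∧_) wve) (∧-identityʳ t))) (xor-same t)
      zer″ {e′} (inj₂ e′∈) = trans (xor-comm (t ∧ w v₀ e′) _) (trans (sym (⨁-eliminate ws c w (w v₀) e e′)) (zer e′∈))
    orth′ : ∀ {x v} → x ∈ xs → v ∈ ws → ⨁ (es₁ ++ es₂) (λ e′ → z x e′ ∧ w′ v e′) ≡ false
    orth′ {x} {v} x∈ v∈ = begin
        ⨁ (es₁ ++ es₂) g
      ≡⟨ cong (_xor ⨁ (es₁ ++ es₂) g) (sym (trans (cong (z x e ∧_) (w′-e v)) (∧-zeroʳ (z x e)))) ⟩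
        g e xor ⨁ (es₁ ++ es₂) g
      ≡⟨ sym (⨁-remove es₁ e es₂ g) ⟩
        ⨁ es g
      ≡⟨ ⨁-cong es (λ e′ → solve 4 (λ z p q r → z :* (p :+ (q :* r)) := (z :* p) :+ (q :* (z :* r))) refl (z x e′) (w v e′) (w v e) (w v₀ e′)) ⟩
        ⨁ es (λ e′ → (z x e′ ∧ w v e′) xor (w v e ∧ (z x e′ ∧ w v₀ e′)))
      ≡⟨ trans (⨁-xor es _ _) (cong₂ _xor_ (orth x∈ (there v∈)) (trans (⨁-∧ˡ es (w v e) _)
           (trans (cong (w v e ∧_) (orth x∈ (here refl))) (∧-zeroʳ (w v e))))) ⟩
        false ∎
      where
      open ≡-Reasoning
      open xor-∧-Solver
      g : _ → Bool
      g e′ = z x e′ ∧ w′ v e′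
    zer′ : ∀ (c : _ → Bool) → (∀ {e′} → e′ ∈ es₁ ++ es₂ → ⨁ xs (λ x → c x ∧ z x e′) ≡ false) →
      ∀ {e′} → e′ ≡ e ⊎ e′ ∈ es₁ ++ es₂ → ⨁ xs (λ x → c x ∧ z x e′) ≡ false
    zer′ c zer (inj₂ e′∈) = zer e′∈
    -- The entry at the dropped coordinate is recovered from orthogonality to `w v₀`, all other
    -- entries being 0.
    zer′ c zer (inj₁ refl) = begin
        comb e
      ≡⟨ sym (trans (cong (comb e ∧_) wve) (∧-identityʳ _)) ⟩
        comb e ∧ w v₀ e
      ≡⟨ sym (trans (cong ((comb e ∧ w v₀ e) xor_) (⨁-zero∈ (es₁ ++ es₂) (λ {e′} e′∈ → cong (_∧ w v₀ e′) (zer e′∈)))) (xor-identityʳ _)) ⟩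
        (comb e ∧ w v₀ e) xor ⨁ (es₁ ++ es₂) (λ e′ → comb e′ ∧ w v₀ e′)
      ≡⟨ sym (⨁-remove es₁ e es₂ (λ e′ → comb e′ ∧ w v₀ e′)) ⟩
        ⨁ es (λ e′ → comb e′ ∧ w v₀ e′)
      ≡⟨ ⨁-cong es (λ e′ → trans (sym (⨁-∧ʳ xs (w v₀ e′) _)) (⨁-cong xs (λ x → ∧-assoc (c x) (z x e′) (w v₀ e′)))) ⟩
        ⨁ es (λ e′ → ⨁ xs (λ x → c x ∧ (z x e′ ∧ w v₀ e′)))
      ≡⟨ ⨁-swap es xs _ ⟩
        ⨁ xs (λ x → ⨁ es (λ e′ → c x ∧ (z x e′ ∧ w v₀ e′)))
      ≡⟨ ⨁-zero∈ xs (λ {x} x∈ → trans (⨁-∧ˡ es (c x) _) (trans (cong (c x ∧_) (orth x∈ (here refl))) (∧-zeroʳ (c x)))) ⟩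
        false ∎
      where
      open ≡-Reasoning
      comb : _ → Bool
      comb e′ = ⨁ xs (λ x → c x ∧ z x e′)

-- Counting

anyF-true⁻ : ∀ n {f : Fin n → Bool} → anyF n f ≡ true → ∃ λ i → f i ≡ true
anyF-true⁻ (suc n) e with ∨-true⁻ e
... | inj₁ p = zero , p
... | inj₂ p with i , q ← anyF-true⁻ n p = suc i , q

anyF-true : ∀ {n} {f : Fin n → Bool} i → f i ≡ true → anyF n f ≡ true
anyF-true zero    e = ∨-trueˡ e
anyF-true (suc i) e = ∨-trueʳ (anyF-true i e)

anyF-false⁻ : ∀ {n} {f : Fin n → Bool} → anyF n f ≡ false → ∀ i → f i ≡ false
anyF-false⁻ e i = ¬-not (λ fi → true≢false (anyF-true i fi) e)

countF-≤ : ∀ n (p : Fin n → Bool) → countF n p ≤ n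
countF-≤ zero    p = z≤n
countF-≤ (suc n) p with p zero
... | true  = s≤s (countF-≤ n (p ∘ suc))
... | false = ℕ.m≤n⇒m≤1+n (countF-≤ n (p ∘ suc))

countF-mono : ∀ n {p q : Fin n → Bool} → (∀ i → p i ≡ true → q i ≡ true) → countF n p ≤ countF n q
countF-mono zero    p⊆q = z≤n
countF-mono (suc n) {p} {q} p⊆q with p zero in p0 | q zero in q0
... | true  | true  = s≤s (countF-mono n (p⊆q ∘ suc))
... | true  | false = ⊥-elim (true≢false (p⊆q zero p0) q0)
... | false | true  = ℕ.m≤n⇒m≤1+n (countF-mono n (p⊆q ∘ suc))
... | false | false = countF-mono n (p⊆q ∘ suc)

countF-strict : ∀ n {p q : Fin n → Bool} → (∀ i → p i ≡ true → q i ≡ true) →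
  ∀ i → q i ≡ true → p i ≡ false → countF n p < countF n q
countF-strict (suc n) p⊆q zero q0 p0 rewrite p0 | q0 = s≤s (countF-mono n (p⊆q ∘ suc))
countF-strict (suc n) {p} {q} p⊆q (suc i) qi pi with p zero in p0 | q zero in q0
... | true  | true  = s≤s (countF-strict n (p⊆q ∘ suc) i qi pi)
... | true  | false = ⊥-elim (true≢false (p⊆q zero p0) q0)
... | false | true  = ℕ.m≤n⇒m≤1+n (countF-strict n (p⊆q ∘ suc) i qi pi)
... | false | false = countF-strict n (p⊆q ∘ suc) i qi pi

countF-split : ∀ n (p q : Fin n → Bool) →
  countF n (λ i → p i ∧ q i) + countF n (λ i → p i ∧ not (q i)) ≡ countF n p
countF-split zero p q = refl
countF-split (suc n) p q with p zero | q zero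
... | true  | true  = cong suc (countF-split n (p ∘ suc) (q ∘ suc))
... | true  | false = trans (ℕ.+-suc _ _) (cong suc (countF-split n (p ∘ suc) (q ∘ suc)))
... | false | _     = countF-split n (p ∘ suc) (q ∘ suc)

sumF-cong : ∀ n {f g : Fin n → ℕ} → (∀ i → f i ≡ g i) → sumF n f ≡ sumF n g
sumF-cong zero    e = refl
sumF-cong (suc n) e = cong₂ _+_ (e zero) (sumF-cong n (e ∘ suc))

length-filterᵇ-++ : ∀ (f : 𝒜 → Bool) xs ys → length (filterᵇ f (xs ++ ys)) ≡ length (filterᵇ f xs) + length (filterᵇ f ys)
length-filterᵇ-++ f xs ys = trans (cong length (List.filter-++ (T? ∘ f) xs ys)) (List.length-++ (filterᵇ f xs))

length-filterᵇ-map : ∀ (f : ℬ → Bool) (h : 𝒜 → ℬ) xs → length (filterᵇ f (map h xs)) ≡ length (filterᵇ (f ∘ h) xs)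
length-filterᵇ-map f h [] = refl
length-filterᵇ-map f h (x ∷ xs) with f (h x)
... | true  = cong suc (length-filterᵇ-map f h xs)
... | false = length-filterᵇ-map f h xs

countF≡length-tabulate : ∀ n (f : 𝒜 → Bool) (g : Fin n → 𝒜) →
  countF n (f ∘ g) ≡ length (filterᵇ f (Data.List.tabulate g))
countF≡length-tabulate zero    f g = refl
countF≡length-tabulate (suc n) f g with f (g zero)
... | true  = cong suc (countF≡length-tabulate n f (g ∘ suc))
... | false = countF≡length-tabulate n f (g ∘ suc)

countF≡length : ∀ n (f : Fin n → Bool) → countF n f ≡ length (filterᵇ f (allFin n))
countF≡length n f = countF≡length-tabulate n f (λ i → i)

sumF≡length-tabulate : ∀ n (f : 𝒜 × ℬ → Bool) (g : Fin n → 𝒜) ys →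
  sumF n (λ i → length (filterᵇ (λ y → f (g i , y)) ys)) ≡ length (filterᵇ f (cartesianProduct (Data.List.tabulate g) ys))
sumF≡length-tabulate zero f g ys = refl
sumF≡length-tabulate (suc n) f g ys = sym (trans
  (length-filterᵇ-++ f (map (g zero ,_) ys) (cartesianProduct (Data.List.tabulate (g ∘ suc)) ys))
  (cong₂ _+_ (length-filterᵇ-map f (g zero ,_) ys) (sym (sumF≡length-tabulate n f (g ∘ suc) ys))))

sumF≡length : ∀ n (f : Fin n × 𝒜 → Bool) ys →
  sumF n (λ i → length (filterᵇ (λ y → f (i , y)) ys)) ≡ length (filterᵇ f (cartesianProduct (allFin n) ys))
sumF≡length n f ys = sumF≡length-tabulate n f (λ i → i) ys

∈-filterᵇ⁺ : ∀ (p : 𝒜 → Bool) {xs x} → x ∈ xs → p x ≡ true → x ∈ filterᵇ p xs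
∈-filterᵇ⁺ p x∈ px = ∈-filter⁺ (T? ∘ p) x∈ (Equivalence.from T-≡ px)

∈-filterᵇ⁻ : ∀ (p : 𝒜 → Bool) {xs x} → x ∈ filterᵇ p xs → x ∈ xs × p x ≡ true
∈-filterᵇ⁻ p x∈ with x∈′ , px ← ∈-filter⁻ (T? ∘ p) x∈ = x∈′ , Equivalence.to T-≡ px

unique-filterᵇ : ∀ (p : 𝒜 → Bool) {xs} → Unique xs → Unique (filterᵇ p xs)
unique-filterᵇ p = Unique.filter⁺ (T? ∘ p)

unique-⊆-length : ∀ {xs ys : List 𝒜} → Unique xs → (∀ {x} → x ∈ xs → x ∈ ys) → length xs ≤ length ys
unique-⊆-length [] ⊆ = z≤n
unique-⊆-length {xs = x ∷ xs} {ys} (x∉ ∷ u) ⊆ with ys₁ , ys₂ , refl ← ∈-∃++ (⊆ (here refl)) =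
  subst (suc (length xs) ≤_) (sym (length-remove ys₁ x ys₂)) (s≤s (unique-⊆-length u λ z∈ → split z∈ (∈-restore ys₁ (⊆ (there z∈)))))
  where
  split : ∀ {z} → z ∈ xs → z ≡ x ⊎ z ∈ ys₁ ++ ys₂ → z ∈ ys₁ ++ ys₂
  split z∈ (inj₁ refl) = ⊥-elim (All.lookup x∉ z∈ refl)
  split z∈ (inj₂ p) = p

least : ∀ n (p : Fin n → Bool) i → p i ≡ true → ∃ λ j → p j ≡ true × (∀ k → toℕ k < toℕ j → p k ≡ false)
least (suc n) p i pi with bool-split (p zero)
... | inj₁ p0 = zero , p0 , λ k ()
least (suc n) p zero    pi | inj₂ p0 = ⊥-elim (true≢false pi p0)
least (suc n) p (suc i) pi | inj₂ p0 with j , pj , min ← least n (p ∘ suc) i pi =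
  suc j , pj , λ { zero _ → p0 ; (suc k) (s≤s lt) → min k lt }

<ᵇ⇒< : ∀ m n → (m <ᵇ n) ≡ true → m < n
<ᵇ⇒< m n e = ℕ.<ᵇ⇒< m n (Equivalence.from T-≡ e)

<⇒<ᵇ : ∀ {m n} → m < n → (m <ᵇ n) ≡ true
<⇒<ᵇ lt = Equivalence.to T-≡ (ℕ.<⇒<ᵇ lt)

eqFin⇒≡ : ∀ {n} {i j : Fin n} → eqFin i j ≡ true → i ≡ j
eqFin⇒≡ {i = i} {j} e = Fin.toℕ-injective (ℕ.≡ᵇ⇒≡ (toℕ i) (toℕ j) (Equivalence.from T-≡ e))

eqFin-false : ∀ {n} {i j : Fin n} → i ≢ j → eqFin i j ≡ false
eqFin-false i≢j = ¬-not (i≢j ∘ eqFin⇒≡)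

-- Connectivity

data Walk (G : Graph) (Y : Sub (size G)) (u : Fin (size G)) : Fin (size G) → Set where
  start : Y u ≡ true → Walk G Y u u
  step  : ∀ {w v} → Walk G Y u w → adj G w v ≡ true → Y v ≡ true → Walk G Y u v

module _ {G : Graph} {Y : Sub (size G)} where

  walk-source : ∀ {u v} → Walk G Y u v → Y u ≡ true
  walk-source (start y)    = y
  walk-source (step w _ _) = walk-source w

  walk-target : ∀ {u v} → Walk G Y u v → Y v ≡ true
  walk-target (start y)    = y
  walk-target (step _ _ y) = y

  walk-trans : ∀ {u v w} → Walk G Y u v → Walk G Y v w → Walk G Y u w
  walk-trans p (start _)    = p
  walk-trans p (step q a y) = step (walk-trans p q) a y

  walk-sym : ∀ {u v} → Walk G Y u v → Walk G Y v u
  walk-sym (start y) = start y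
  walk-sym (step {w} {v} p a y) = walk-trans (step (start y) (trans (adj-sym G v w) a) (walk-target p)) (walk-sym p)

  reach⇒walk : ∀ k {u v} → reachK G Y k u v ≡ true → Walk G Y u v
  reach⇒walk zero {u} e with refl ← eqFin⇒≡ {i = u} (∧-trueʳ {Y u} e) = start (∧-trueˡ e)
  reach⇒walk (suc k) {u} {v} e with ∨-true⁻ {reachK G Y k u v} e
  ... | inj₁ p = reach⇒walk k p
  ... | inj₂ p with w , q ← anyF-true⁻ (size G) (∧-trueʳ {Y v} p) =
    step (reach⇒walk k (∧-trueˡ q)) (∧-trueʳ {reachK G Y k u w} q) (∧-trueˡ p)

  private
    reach-mono : ∀ {j k u v} → j ≤ k → reachK G Y j u v ≡ true → reachK G Y k u v ≡ true
    reach-mono {j} {k} j≤k e with ℕ.m≤n⇒∃[o]m+o≡n j≤k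
    ... | o , refl = go o
      where
      go : ∀ o → reachK G Y (j + o) _ _ ≡ true
      go zero rewrite ℕ.+-identityʳ j = e
      go (suc o) rewrite ℕ.+-suc j o = ∨-trueˡ (go o)

    Stable : ℕ → Fin (size G) → Set
    Stable k u = ∀ v → reachK G Y (suc k) u v ≡ true → reachK G Y k u v ≡ true

    -- As long as no round is idle, each one adds a vertex. More than `size G` vertices cannot be
    -- reached, so for k = `size G` some round was idle and every walk has been found.
    stable⊎growing : ∀ k u → Y u ≡ true →
      (∃ λ j → j ≤ k × Stable j u) ⊎ k < countF (size G) (reachK G Y k u)
    stable⊎growing zero u y = inj₂ (ℕ.≤-<-trans z≤n
      (countF-strict (size G) {λ _ → false} (λ _ ()) u (∧-true y (eqFin-refl u)) refl))
    stable⊎growing (suc k) u y with stable⊎growing k u y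
    ... | inj₁ (j , j≤k , st) = inj₁ (j , ℕ.m≤n⇒m≤1+n j≤k , st)
    ... | inj₂ lt with search (λ v → reachK G Y (suc k) u v ∧ not (reachK G Y k u v)) (allFin (size G))
    ...   | inj₁ (v , _ , e) = inj₂ (ℕ.≤-<-trans lt (countF-strict (size G) (λ _ → ∨-trueˡ) v
              (∧-trueˡ e) (not-true⁻ (∧-trueʳ {reachK G Y (suc k) u v} e))))
    ...   | inj₂ none = inj₁ (k , ℕ.n≤1+n k , λ v e → ¬-not (λ f → true≢false (∧-true e (not-true f)) (none (∈-allFin v))))

    stable-walk : ∀ {k u v} → Stable k u → Walk G Y u v → reachK G Y k u v ≡ true
    stable-walk {k} {u} st (start y) = reach-mono {0} {k} z≤n (∧-true y (eqFin-refl u))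
    stable-walk {k} {u} st (step {w} {v} p a y) =
      st v (∨-trueʳ {reachK G Y k u v} (∧-true y (anyF-true w (∧-true (stable-walk {k} st p) a))))

  walk⇒conn : ∀ {u v} → Walk G Y u v → conn G Y u v ≡ true
  walk⇒conn {u} p with stable⊎growing (size G) u (walk-source p)
  ... | inj₁ (j , j≤n , st) = reach-mono {j} {size G} j≤n (stable-walk {j} st p)
  ... | inj₂ lt = ⊥-elim (ℕ.<⇒≱ lt (countF-≤ (size G) _))

module _ (G : Graph) (Y : Sub (size G)) where

  conn⇒walk : ∀ {u v} → conn G Y u v ≡ true → Walk G Y u v
  conn⇒walk = reach⇒walk (size G)

  conn-adj : ∀ {u v w} → conn G Y u v ≡ true → adj G v w ≡ true → Y w ≡ true → conn G Y u w ≡ true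
  conn-adj c a y = walk⇒conn (step (conn⇒walk c) a y)

  conn-refl : ∀ {u} → Y u ≡ true → conn G Y u u ≡ true
  conn-refl y = walk⇒conn {G} {Y} (start y)

  conn-sym : ∀ {u v} → conn G Y u v ≡ true → conn G Y v u ≡ true
  conn-sym c = walk⇒conn (walk-sym (conn⇒walk c))

  conn-trans : ∀ {u v w} → conn G Y u v ≡ true → conn G Y v w ≡ true → conn G Y u w ≡ true
  conn-trans c d = walk⇒conn (walk-trans (conn⇒walk c) (conn⇒walk d))

  conn-source : ∀ {u v} → conn G Y u v ≡ true → Y u ≡ true
  conn-source c = walk-source (conn⇒walk c)

  conn-target : ∀ {u v} → conn G Y u v ≡ true → Y v ≡ true
  conn-target c = walk-target (conn⇒walk c)

  -- The least vertex of its component, spelled as in `components`, so that counting roots gives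
  -- that number by definition.
  root : Sub (size G)
  root u = Y u ∧ not (anyF (size G) (λ w → (toℕ w <ᵇ toℕ u) ∧ conn G Y w u))

  root-exists : ∀ {v} → Y v ≡ true → ∃ λ r → root r ≡ true × conn G Y r v ≡ true
  root-exists {v} y with r , c , min ← least (size G) (λ w → conn G Y w v) v (conn-refl y) =
    r , ∧-true (conn-source c) (not-true (¬-not none)) , c
    where
    none : ¬ anyF (size G) (λ w → (toℕ w <ᵇ toℕ r) ∧ conn G Y w r) ≡ true
    none e with w , e′ ← anyF-true⁻ (size G) e = true≢false
      (conn-trans (∧-trueʳ {toℕ w <ᵇ toℕ r} e′) c)
      (min w (<ᵇ⇒< (toℕ w) (toℕ r) (∧-trueˡ e′)))

  root-≮ : ∀ {r r′} → root r′ ≡ true → conn G Y r r′ ≡ true → ¬ toℕ r < toℕ r′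
  root-≮ {r} {r′} ρ′ c lt = true≢false (∧-true (<⇒<ᵇ lt) c) (anyF-false⁻ (not-true⁻ (∧-trueʳ {Y r′} ρ′)) r)

  root-unique : ∀ {r r′ v} → root r ≡ true → root r′ ≡ true →
    conn G Y r v ≡ true → conn G Y r′ v ≡ true → r ≡ r′
  root-unique ρ ρ′ c c′ = Fin.toℕ-injective (ℕ.≤-antisym
    (ℕ.≮⇒≥ (root-≮ ρ (conn-trans c′ (conn-sym c))))
    (ℕ.≮⇒≥ (root-≮ ρ′ (conn-trans c (conn-sym c′)))))

  ∑-root : ∀ {v} → Y v ≡ true → ∑ (λ r → root r ∧ conn G Y r v) ≡ true
  ∑-root {v} y with r , ρ , c ← root-exists y = trans
    (⨁-cong (allFin (size G)) same) (∑-pick r (λ _ → true))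
    where
    same : ∀ r′ → root r′ ∧ conn G Y r′ v ≡ (r′ == r) ∧ true
    same r′ with r′ Fin.≟ r
    ... | yes refl = ∧-true ρ c
    ... | no r′≢r = ¬-not (λ e → r′≢r (root-unique (∧-trueˡ e) ρ (∧-trueʳ {root r′} e) c))

-- Homomorphism counts

IsHom : (F G : Graph) → (Fin (size F) → Fin (size G)) → Set
IsHom F G f = ∀ i j → adj F i j ≡ true → adj G (f i) (f j) ≡ true

isHom⇒IsHom : ∀ F G {f} → isHom F G f ≡ true → IsHom F G f
isHom⇒IsHom F G {f} e i j a with adj G (f i) (f j) in eq
... | true  = refl
... | false = ⊥-elim (true≢false (∧-true a (not-true eq)) (anyF-false⁻ (anyF-false⁻ (not-true⁻ e) i) j))

IsHom⇒isHom : ∀ F G {f} → IsHom F G f → isHom F G f ≡ true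
IsHom⇒isHom F G {f} h = not-true (¬-not bad)
  where
  bad : ¬ anyF (size F) (λ i → anyF (size F) λ j → adj F i j ∧ not (adj G (f i) (f j))) ≡ true
  bad e with i , e′ ← anyF-true⁻ (size F) e with j , e″ ← anyF-true⁻ (size F) e′ =
    true≢false (h i j (∧-trueˡ e″)) (not-true⁻ (∧-trueʳ {adj F i j} e″))

IsHom-cong : ∀ F G {f g} → f ≗ g → IsHom F G f → IsHom F G g
IsHom-cong F G f≗g h i j a rewrite sym (f≗g i) | sym (f≗g j) = h i j a

-- Functions are compared only pointwise, so duplicate-free lists of maps are kept as vectors.
allVecs : ∀ p n → List (Vec (Fin n) p)
allVecs zero    n = [] ∷ []
allVecs (suc p) n = cartesianProductWith _∷_ (allFin n) (allVecs p n)

∈-allVecs : ∀ {n p} (v : Vec (Fin n) p) → v ∈ allVecs p n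
∈-allVecs []      = here refl
∈-allVecs (x ∷ v) = ∈-cartesianProductWith⁺ _∷_ (∈-allFin x) (∈-allVecs v)

unique-allVecs : ∀ p n → Unique (allVecs p n)
unique-allVecs zero    n = [] ∷ []
unique-allVecs (suc p) n = Unique.cartesianProductWith⁺ _∷_ Vec.∷-injective (Unique.allFin⁺ n) (unique-allVecs p n)

map-tabulate-allFuns : ∀ p n → map Vec.tabulate (allFuns p n) ≡ allVecs p n
map-tabulate-allFuns zero    n = refl
map-tabulate-allFuns (suc p) n = go (allFin n)
  where
  open ≡-Reasoning
  go : ∀ as → map Vec.tabulate (concatMap (λ a → map (λ f → a VF.∷ f) (allFuns p n)) as) ≡
              cartesianProductWith _∷_ as (allVecs p n)
  go [] = refl
  go (a ∷ as) = begin
      map Vec.tabulate (map (a VF.∷_) (allFuns p n) ++ concatMap (λ a → map (λ f → a VF.∷ f) (allFuns p n)) as)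
    ≡⟨ List.map-++ Vec.tabulate (map (a VF.∷_) (allFuns p n)) _ ⟩
      map Vec.tabulate (map (a VF.∷_) (allFuns p n)) ++ map Vec.tabulate (concatMap (λ a → map (λ f → a VF.∷ f) (allFuns p n)) as)
    ≡⟨ cong₂ _++_ (trans (sym (List.map-∘ (allFuns p n))) (List.map-∘ (allFuns p n))) (go as) ⟩
      map (a ∷_) (map Vec.tabulate (allFuns p n)) ++ cartesianProductWith _∷_ as (allVecs p n)
    ≡⟨ cong (λ vs → map (a ∷_) vs ++ cartesianProductWith _∷_ as (allVecs p n)) (map-tabulate-allFuns p n) ⟩
      map (a ∷_) (allVecs p n) ++ cartesianProductWith _∷_ as (allVecs p n) ∎

homVecs : (F G : Graph) → List (Vec (Fin (size G)) (size F))
homVecs F G = filterᵇ (isHom F G ∘ Vec.lookup) (allVecs (size F) (size G))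

filterᵇ-cong : ∀ {A : Set} {f g : A → Bool} → f ≗ g → filterᵇ f ≗ filterᵇ g
filterᵇ-cong e [] = refl
filterᵇ-cong {f = f} {g} e (x ∷ xs) with f x | g x | e x
... | true  | .true  | refl = cong (x ∷_) (filterᵇ-cong e xs)
... | false | .false | refl = filterᵇ-cong e xs

hom≡length : ∀ F G → hom F G ≡ length (homVecs F G)
hom≡length F G = begin
    length (filterᵇ (isHom F G) (allFuns (size F) (size G)))
  ≡⟨ cong length (filterᵇ-cong same (allFuns (size F) (size G))) ⟩
    length (filterᵇ (isHom F G ∘ Vec.lookup ∘ Vec.tabulate) (allFuns (size F) (size G)))
  ≡⟨ length-filterᵇ-map (isHom F G ∘ Vec.lookup) Vec.tabulate (allFuns (size F) (size G)) ⟨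
    length (filterᵇ (isHom F G ∘ Vec.lookup) (map Vec.tabulate (allFuns (size F) (size G))))
  ≡⟨ cong (length ∘ filterᵇ (isHom F G ∘ Vec.lookup)) (map-tabulate-allFuns (size F) (size G)) ⟩
    length (homVecs F G) ∎
  where
  open ≡-Reasoning
  same : ∀ f → isHom F G f ≡ isHom F G (Vec.lookup (Vec.tabulate f))
  same f with bool-split (isHom F G f) | bool-split (isHom F G (Vec.lookup (Vec.tabulate f)))
  ... | inj₁ e | _ = trans e (sym (IsHom⇒isHom F G (IsHom-cong F G (sym ∘ Vec.lookup∘tabulate f) (isHom⇒IsHom F G e))))
  ... | inj₂ e | inj₂ e′ = trans e (sym e′)
  ... | inj₂ e | inj₁ e′ = ⊥-elim (true≢false (IsHom⇒isHom F G (IsHom-cong F G (Vec.lookup∘tabulate f) (isHom⇒IsHom F G e′))) e)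

∈-homVecs : ∀ F G {f} → IsHom F G f → Vec.tabulate f ∈ homVecs F G
∈-homVecs F G {f} h = ∈-filterᵇ⁺ _ (∈-allVecs _) (IsHom⇒isHom F G (IsHom-cong F G (sym ∘ Vec.lookup∘tabulate f) h))

∈-homVecs⁻ : ∀ F G {v} → v ∈ homVecs F G → IsHom F G (Vec.lookup v)
∈-homVecs⁻ F G v∈ = isHom⇒IsHom F G (proj₂ (∈-filterᵇ⁻ (isHom F G ∘ Vec.lookup) {allVecs (size F) (size G)} v∈))

lookup-injective : ∀ {n} {A : Set} {v w : Vec A n} → Vec.lookup v ≗ Vec.lookup w → v ≡ w
lookup-injective {v = v} {w} e = trans (sym (Vec.tabulate∘lookup v)) (trans (Vec.tabulate-cong e) (Vec.tabulate∘lookup w))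

tabulate-injective : ∀ {n} {A : Set} {f g : Fin n → A} → Vec.tabulate f ≡ Vec.tabulate g → f ≗ g
tabulate-injective {f = f} {g} e i = trans (sym (Vec.lookup∘tabulate f i)) (trans (cong (λ v → Vec.lookup v i) e) (Vec.lookup∘tabulate g i))

module _ (F G H : Graph) (Φ : (Fin (size F) → Fin (size G)) → Fin (size F) → Fin (size H))
  (Φ-hom : ∀ {f} → IsHom F G f → IsHom F H (Φ f))
  (Φ-inj : ∀ {f g} → IsHom F G f → IsHom F G g → Φ f ≗ Φ g → f ≗ g) where

  private
    image : List (Vec (Fin (size G)) (size F)) → List (Vec (Fin (size H)) (size F))
    image = map (Vec.tabulate ∘ Φ ∘ Vec.lookup)

    unique-image : ∀ vs → Unique vs → (∀ {v} → v ∈ vs → IsHom F G (Vec.lookup v)) → Unique (image vs)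
    unique-image []       []       h = []
    unique-image (v ∷ vs) (v∉ ∷ u) h = All.tabulate fresh ∷ unique-image vs u (h ∘ there)
      where
      fresh : ∀ {w} → w ∈ image vs → Vec.tabulate (Φ (Vec.lookup v)) ≢ w
      fresh w∈ e with v′ , v′∈ , refl ← ∈-map⁻ _ w∈ =
        All.lookup v∉ v′∈ (lookup-injective (Φ-inj (h (here refl)) (h (there v′∈)) (tabulate-injective e)))

    uniq : Unique (image (homVecs F G))
    uniq = unique-image (homVecs F G) (unique-filterᵇ _ (unique-allVecs _ _)) (∈-homVecs⁻ F G)

    image⊆ : ∀ {w} → w ∈ image (homVecs F G) → w ∈ homVecs F H
    image⊆ w∈ with v , v∈ , refl ← ∈-map⁻ _ w∈ = ∈-homVecs F H (Φ-hom (∈-homVecs⁻ F G v∈))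

  hom-≤ : hom F G ≤ hom F H
  hom-≤ rewrite hom≡length F G | hom≡length F H
    | sym (List.length-map (Vec.tabulate ∘ Φ ∘ Vec.lookup) (homVecs F G)) = unique-⊆-length uniq image⊆

  hom-< : ∀ {h} → IsHom F H h → (∀ {f} → IsHom F G f → ¬ Φ f ≗ h) → hom F G < hom F H
  hom-< {h} h-hom h∉ rewrite hom≡length F G | hom≡length F H
    | sym (List.length-map (Vec.tabulate ∘ Φ ∘ Vec.lookup) (homVecs F G)) =
    unique-⊆-length {xs = Vec.tabulate h ∷ image (homVecs F G)} (All.tabulate fresh ∷ uniq)
      λ { (here refl) → ∈-homVecs F H h-hom ; (there w∈) → image⊆ w∈ }
    where
    fresh : ∀ {w} → w ∈ image (homVecs F G) → Vec.tabulate h ≢ w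
    fresh w∈ e with v , v∈ , refl ← ∈-map⁻ _ w∈ = h∉ (∈-homVecs⁻ F G v∈) (tabulate-injective (sym e))

hom-≅ : ∀ F {G H} → G ≅ H → hom F G ≤ hom F H
hom-≅ F {G} {H} iso = hom-≤ F G H (to ∘_) (λ h i j a → trans (adj-pres _ _) (h i j a))
  (λ {f} {g} _ _ e i → trans (sym (from-to (f i))) (trans (cong from (e i)) (from-to (g i))))
  where open _≅_ iso

-- CFI graphs over complete graphs

Kₙ : ℕ → Graph
Kₙ n = record
  { size = n
  ; adj = λ i j → not (i == j)
  ; adj-sym = λ i j → cong not (==-sym i j)
  ; adj-irrefl = λ i → cong not (==-refl i)
  }

-- The obstruction to lifting φ to the twisted CFI graph: Roberson's weak oddomorphism, where Z is
-- (the edge set of) the subgraph and y its set of odd vertices.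
record Odd (F : Graph) {N : ℕ} (r : Fin N) (φ : Fin (size F) → Fin N) : Set where
  field
    Z     : Fin (size F) → Fin (size F) → Bool
    Z-sym : ∀ i j → Z i j ≡ Z j i
    Z-adj : ∀ i j → Z i j ≡ true → adj F i j ≡ true
    y     : Fin (size F) → Bool
    Z-deg : ∀ i u → ∑ (λ j → Z i j ∧ (φ j == u)) ≡ y i ∧ not (φ i == u)
    odd   : ∑ (λ i → y i ∧ (φ i == r)) ≡ true

-- Adding `s i` to the label of the image of i preserves every edge condition and changes the parity
-- exactly over r. This carries homomorphisms over φ from either CFI graph to the other.
record Twist (F : Graph) {N : ℕ} (r : Fin N) (φ : Fin (size F) → Fin N) : Set where
  field
    s        : Fin (size F) → Fin N → Bool
    s-parity : ∀ i → ∑ (λ u → not (φ i == u) ∧ s i u) ≡ (φ i == r)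
    s-edge   : ∀ i j → adj F i j ≡ true → s i (φ j) ≡ s j (φ i)

module _ (F : Graph) {N : ℕ} (r : Fin N) (φ : Fin (size F) → Fin N) where

  private
    q = size F
    Unknown = Fin q × Fin N
    Equation = Fin q ⊎ (Fin q × Fin q)

    equations : List Equation
    equations = map inj₁ (allFin q) ++ map inj₂ (cartesianProduct (allFin q) (allFin q))

    unknowns : List Unknown
    unknowns = cartesianProduct (allFin q) (allFin N)

    unique-pairs : ∀ {m n} → Unique (cartesianProduct (allFin m) (allFin n))
    unique-pairs = Unique.cartesianProduct⁺ (Unique.allFin⁺ _) (Unique.allFin⁺ _)

    unique-equations : Unique equations
    unique-equations = Unique.++⁺ (Unique.map⁺ Sum.inj₁-injective (Unique.allFin⁺ q)) (Unique.map⁺ Sum.inj₂-injective unique-pairs) disj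
      where
      disj : Disjoint (map inj₁ (allFin q)) (map inj₂ (cartesianProduct (allFin q) (allFin q)))
      disj (a , b) with _ , _ , refl ← ∈-map⁻ inj₁ a with ∈-map⁻ inj₂ b
      ... | _ , _ , ()

    M : Equation → Unknown → Bool
    M (inj₁ i)       (k , u) = (k == i) ∧ not (φ i == u)
    M (inj₂ (i , j)) (k , u) = adj F i j ∧ (((k == i) ∧ (u == φ j)) xor ((k == j) ∧ (u == φ i)))

    rhs : Equation → Bool
    rhs (inj₁ i) = φ i == r
    rhs (inj₂ _) = false

    ∈-unknowns : ∀ k u → (k , u) ∈ unknowns
    ∈-unknowns k u = ∈-cartesianProduct⁺ (∈-allFin k) (∈-allFin u)

    ⨁-equations : ∀ f → ⨁ equations f ≡ ∑ (λ i → f (inj₁ i)) xor ∑ (λ i → ∑ (λ j → f (inj₂ (i , j))))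
    ⨁-equations f = trans (⨁-++ (map inj₁ (allFin q)) _ f)
      (cong₂ _xor_ (⨁-map inj₁ (allFin q) f) (trans (⨁-map inj₂ (cartesianProduct (allFin q) (allFin q)) f) (⨁-product (allFin q) (allFin q) (f ∘ inj₂))))

    ∑-vertex : ∀ (s : Unknown → Bool) i (g : Fin N → Bool) →
      ⨁ unknowns (λ x → ((proj₁ x == i) ∧ g (proj₂ x)) ∧ s x) ≡ ∑ (λ u → g u ∧ s (i , u))
    ∑-vertex s i g = begin
        ⨁ unknowns (λ x → ((proj₁ x == i) ∧ g (proj₂ x)) ∧ s x)
      ≡⟨ ⨁-product (allFin q) (allFin N) _ ⟩
        ∑ (λ k → ∑ (λ u → ((k == i) ∧ g u) ∧ s (k , u)))
      ≡⟨ ∑-cong q (λ k → trans (∑-cong N (λ u → ∧-assoc (k == i) (g u) (s (k , u)))) (∑-∧ˡ N (k == i) _)) ⟩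
        ∑ (λ k → (k == i) ∧ ∑ (λ u → g u ∧ s (k , u)))
      ≡⟨ ∑-pick i _ ⟩
        ∑ (λ u → g u ∧ s (i , u)) ∎
      where open ≡-Reasoning

    twist : (Σ (Unknown → Bool) λ s → ∀ {e} → e ∈ equations → ⨁ unknowns (λ x → M e x ∧ s x) ≡ rhs e) → Twist F r φ
    twist (s , sol) = record
      { s = λ i u → s (i , u)
      ; s-parity = λ i → trans (sym (∑-vertex s i (λ u → not (φ i == u)))) (sol (∈-++⁺ˡ (∈-map⁺ inj₁ (∈-allFin i))))
      ; s-edge = λ i j a → xor-false⇒≡ (trans (sym (edge i j a)) (sol (∈-++⁺ʳ (map inj₁ (allFin q)) (∈-map⁺ inj₂ (∈-cartesianProduct⁺ (∈-allFin i) (∈-allFin j))))))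
      }
      where
      open ≡-Reasoning
      edge : ∀ i j → adj F i j ≡ true → ⨁ unknowns (λ x → M (inj₂ (i , j)) x ∧ s x) ≡ s (i , φ j) xor s (j , φ i)
      edge i j a = begin
          ⨁ unknowns (λ x → M (inj₂ (i , j)) x ∧ s x)
        ≡⟨ ⨁-cong unknowns (λ { (k , u) → trans (cong (λ b → (b ∧ (((k == i) ∧ (u == φ j)) xor ((k == j) ∧ (u == φ i)))) ∧ s (k , u)) a)
             (∧-distribʳ-xor (s (k , u)) ((k == i) ∧ (u == φ j)) ((k == j) ∧ (u == φ i))) }) ⟩
          ⨁ unknowns (λ x → (((proj₁ x == i) ∧ (proj₂ x == φ j)) ∧ s x) xor (((proj₁ x == j) ∧ (proj₂ x == φ i)) ∧ s x))
        ≡⟨ ⨁-xor unknowns _ _ ⟩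
          ⨁ unknowns (λ x → ((proj₁ x == i) ∧ (proj₂ x == φ j)) ∧ s x) xor ⨁ unknowns (λ x → ((proj₁ x == j) ∧ (proj₂ x == φ i)) ∧ s x)
        ≡⟨ cong₂ _xor_ (∑-vertex s i (_== φ j)) (∑-vertex s j (_== φ i)) ⟩
          ∑ (λ u → (u == φ j) ∧ s (i , u)) xor ∑ (λ u → (u == φ i) ∧ s (j , u))
        ≡⟨ cong₂ _xor_ (∑-pick (φ j) _) (∑-pick (φ i) _) ⟩
          s (i , φ j) xor s (j , φ i) ∎

    -- The transposed reading of the system. The weight of the parity equation at i tells whether i
    -- is odd; the weights of the edge equations (i, j) and (j, i) add up to the edge ij of Z.
    -- Vanishing of column (k, u) is `Z-deg`, and the nonzero right-hand side is `odd`.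
    odd-certificate : (Σ (Equation → Bool) λ c → (∀ {x} → x ∈ unknowns → ⨁ equations (λ e → c e ∧ M e x) ≡ false) ×
      ⨁ equations (λ e → c e ∧ rhs e) ≡ true) → Odd F r φ
    odd-certificate (c , zer , one) = record
      { Z = Z
      ; Z-sym = λ i j → cong₂ _∧_ (adj-sym F i j) (xor-comm (z i j) (z j i))
      ; Z-adj = λ i j → ∧-trueˡ
      ; y = y
      ; Z-deg = λ k u → sym (xor-false⇒≡ (trans (sym (deg k u)) (zer (∈-unknowns k u))))
      ; odd = begin
          ∑ (λ i → y i ∧ (φ i == r))
        ≡⟨ xor-identityʳ _ ⟨
          ∑ (λ i → y i ∧ (φ i == r)) xor false
        ≡⟨ cong (∑ (λ i → y i ∧ (φ i == r)) xor_) (∑-zero q (λ i → ∑-zero q (λ j → ∧-zeroʳ (z i j)))) ⟨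
          ∑ (λ i → y i ∧ (φ i == r)) xor ∑ (λ i → ∑ (λ j → z i j ∧ false))
        ≡⟨ ⨁-equations _ ⟨
          ⨁ equations (λ e → c e ∧ rhs e)
        ≡⟨ one ⟩
          true ∎
      }
      where
      open ≡-Reasoning
      y : Fin q → Bool
      y i = c (inj₁ i)
      z Z : Fin q → Fin q → Bool
      z i j = c (inj₂ (i , j))
      Z i j = adj F i j ∧ (z i j xor z j i)
      expand : ∀ z a p b q d → z ∧ (a ∧ ((p ∧ b) xor (q ∧ d))) ≡ (p ∧ (b ∧ (a ∧ z))) xor (q ∧ (d ∧ (a ∧ z)))
      expand = solve 6 (λ z a p b q d → z :* (a :* ((p :* b) :+ (q :* d))) := (p :* (b :* (a :* z))) :+ (q :* (d :* (a :* z)))) refl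
        where open xor-∧-Solver
      deg : ∀ k u → ⨁ equations (λ e → c e ∧ M e (k , u)) ≡ (y k ∧ not (φ k == u)) xor ∑ (λ j → Z k j ∧ (φ j == u))
      deg k u = trans (⨁-equations _) (cong₂ _xor_ vertex edge)
        where
        swap : ∀ a b c → a ∧ (b ∧ c) ≡ b ∧ (a ∧ c)
        swap = solve 3 (λ a b c → a :* (b :* c) := b :* (a :* c)) refl
          where open xor-∧-Solver
        vertex : ∑ (λ i → y i ∧ ((k == i) ∧ not (φ i == u))) ≡ y k ∧ not (φ k == u)
        vertex = trans (∑-cong q (λ i → swap (y i) (k == i) _)) (∑-pick′ k (λ i → y i ∧ not (φ i == u)))
        edge : ∑ (λ i → ∑ (λ j → z i j ∧ (adj F i j ∧ (((k == i) ∧ (u == φ j)) xor ((k == j) ∧ (u == φ i)))))) ≡ ∑ (λ j → Z k j ∧ (φ j == u))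
        edge = begin
            ∑ (λ i → ∑ (λ j → z i j ∧ (adj F i j ∧ (((k == i) ∧ (u == φ j)) xor ((k == j) ∧ (u == φ i))))))
          ≡⟨ ∑-cong q (λ i → trans (∑-cong q (λ j → expand (z i j) (adj F i j) (k == i) (u == φ j) (k == j) (u == φ i)))
               (∑-xor q _ _)) ⟩
            ∑ (λ i → ∑ (λ j → (k == i) ∧ ((u == φ j) ∧ (adj F i j ∧ z i j))) xor ∑ (λ j → (k == j) ∧ ((u == φ i) ∧ (adj F i j ∧ z i j))))
          ≡⟨ ∑-xor q _ _ ⟩
            ∑ (λ i → ∑ (λ j → (k == i) ∧ ((u == φ j) ∧ (adj F i j ∧ z i j)))) xor ∑ (λ i → ∑ (λ j → (k == j) ∧ ((u == φ i) ∧ (adj F i j ∧ z i j))))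
          ≡⟨ cong₂ _xor_ (trans (∑-cong q (λ i → ∑-∧ˡ q (k == i) _)) (∑-pick′ k _))
                         (∑-cong q (λ i → ∑-pick′ k _)) ⟩
            ∑ (λ j → (u == φ j) ∧ (adj F k j ∧ z k j)) xor ∑ (λ i → (u == φ i) ∧ (adj F i k ∧ z i k))
          ≡⟨ ∑-xor q _ _ ⟨
            ∑ (λ j → ((u == φ j) ∧ (adj F k j ∧ z k j)) xor ((u == φ j) ∧ (adj F j k ∧ z j k)))
          ≡⟨ ∑-cong q (λ j → trans (cong₂ (λ b a → ((b ∧ (adj F k j ∧ z k j)) xor (b ∧ (a ∧ z j k)))) (==-sym u (φ j)) (adj-sym F j k))
               (solve 4 (λ b a z w → (b :* (a :* z)) :+ (b :* (a :* w)) := (a :* (z :+ w)) :* b) refl (φ j == u) (adj F k j) (z k j) (z j k))) ⟩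
            ∑ (λ j → Z k j ∧ (φ j == u)) ∎
          where open xor-∧-Solver

  twist⊎odd : Twist F r φ ⊎ Odd F r φ
  twist⊎odd with solvable⊎certificate (Product.≡-dec Fin._≟_ Fin._≟_) (Sum.≡-dec Fin._≟_ (Product.≡-dec Fin._≟_ Fin._≟_))
                   unique-equations unique-pairs M rhs
  ... | inj₁ s = inj₁ (twist s)
  ... | inj₂ c = inj₂ (odd-certificate c)

  -- The sum of Z i j · s i (φ j) over ordered pairs counts each edge twice by `s-edge`, hence
  -- vanishes. Summed at each i first, it equals `odd` by `Z-deg` and `s-parity`.
  ¬twist×odd : Twist F r φ → Odd F r φ → ⊥
  ¬twist×odd t o = true≢false odd (begin
      ∑ (λ i → y i ∧ (φ i == r))
    ≡⟨ ∑-cong q (λ i → begin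
         y i ∧ (φ i == r)
           ≡⟨ cong (y i ∧_) (sym (s-parity i)) ⟩
         y i ∧ ∑ (λ u → not (φ i == u) ∧ s i u)
           ≡⟨ sym (∑-∧ˡ N (y i) _) ⟩
         ∑ (λ u → y i ∧ (not (φ i == u) ∧ s i u))
           ≡⟨ ∑-cong N (λ u → trans (sym (∧-assoc (y i) _ _)) (trans (cong (_∧ s i u) (sym (Z-deg i u))) (sym (∑-∧ʳ q (s i u) _)))) ⟩
         ∑ (λ u → ∑ (λ j → (Z i j ∧ (φ j == u)) ∧ s i u))
           ≡⟨ ∑-swap N q _ ⟩
         ∑ (λ j → ∑ (λ u → (Z i j ∧ (φ j == u)) ∧ s i u))
           ≡⟨ ∑-cong q (λ j → trans (∑-cong N (λ u → ∧-assoc (Z i j) _ _)) (trans (∑-∧ˡ N (Z i j) _) (cong (Z i j ∧_) (∑-pick′ (φ j) (s i))))) ⟩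
         ∑ (λ j → Z i j ∧ s i (φ j)) ∎) ⟩
      ∑ (λ i → ∑ (λ j → Z i j ∧ s i (φ j)))
    ≡⟨ ⨁-symmetric (allFin q) (λ i j → Z i j ∧ s i (φ j))
         (λ i j → trans (∧-cong-true (λ z → s-edge i j (Z-adj i j z))) (cong (_∧ s j (φ i)) (Z-sym i j)))
         (λ i → cong (_∧ s i (φ i)) (¬-not (λ z → true≢false (Z-adj i i z) (adj-irrefl F i)))) ⟩
      false ∎)
    where
    open ≡-Reasoning
    open Odd o
    open Twist t

module CFI (N : ℕ) (r : Fin N) where

  -- The size N · 2^N stands for a base vertex together with an N-bit label, whose bit at u labels
  -- the edge to u.
  Vertex : Set
  Vertex = Fin (N * 2 ^ N)

  private
    toBool : Fin 2 → Bool
    toBool zero       = false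
    toBool (suc _)    = true

    fromBool : Bool → Fin 2
    fromBool false = zero
    fromBool true  = suc zero

    toBool-fromBool : ∀ b → toBool (fromBool b) ≡ b
    toBool-fromBool false = refl
    toBool-fromBool true  = refl

    toBool-injective : ∀ {i j} → toBool i ≡ toBool j → i ≡ j
    toBool-injective {zero}     {zero}     _ = refl
    toBool-injective {suc zero} {suc zero} _ = refl
    toBool-injective {zero}     {suc zero} ()
    toBool-injective {suc zero} {zero}     ()

    funToFin-cong : ∀ {m n} {f g : Fin m → Fin n} → f ≗ g → Fin.funToFin f ≡ Fin.funToFin g
    funToFin-cong {zero}  e = refl
    funToFin-cong {suc m} e = cong₂ Fin.combine (e zero) (funToFin-cong (e ∘ suc))

  base : Vertex → Fin N
  base a = proj₁ (Fin.remQuot {N} (2 ^ N) a)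

  bits : Vertex → Fin N → Bool
  bits a u = toBool (Fin.finToFun (proj₂ (Fin.remQuot {N} (2 ^ N) a)) u)

  vertex : Fin N → (Fin N → Bool) → Vertex
  vertex v s = Fin.combine v (Fin.funToFin (fromBool ∘ s))

  base-vertex : ∀ v s → base (vertex v s) ≡ v
  base-vertex v s = cong proj₁ (Fin.remQuot-combine v (Fin.funToFin (fromBool ∘ s)))

  bits-vertex : ∀ v s u → bits (vertex v s) u ≡ s u
  bits-vertex v s u = trans (cong (λ p → toBool (Fin.finToFun (proj₂ p) u)) (Fin.remQuot-combine v (Fin.funToFin (fromBool ∘ s))))
    (trans (cong toBool (Fin.finToFun-funToFin (fromBool ∘ s) u)) (toBool-fromBool (s u)))

  vertex-ext : ∀ {a b} → base a ≡ base b → bits a ≗ bits b → a ≡ b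
  vertex-ext {a} {b} e f = begin
      a
    ≡⟨ Fin.combine-remQuot {N} (2 ^ N) a ⟨
      Fin.combine (base a) (code a)
    ≡⟨ cong₂ Fin.combine e (begin
         code a                            ≡⟨ Fin.funToFin-finToFin {N} {2} (code a) ⟨
         Fin.funToFin (Fin.finToFun {2} {N} (code a)) ≡⟨ funToFin-cong (λ u → toBool-injective (f u)) ⟩
         Fin.funToFin (Fin.finToFun {2} {N} (code b)) ≡⟨ Fin.funToFin-finToFin {N} {2} (code b) ⟩
         code b ∎) ⟩
      Fin.combine (base b) (code b)
    ≡⟨ Fin.combine-remQuot {N} (2 ^ N) b ⟩
      b ∎
    where
    open ≡-Reasoning
    code : Vertex → Fin (2 ^ N)
    code a = proj₂ (Fin.remQuot {N} (2 ^ N) a)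

  parity : Vertex → Bool
  parity a = ∑ (λ u → not (base a == u) ∧ bits a u)

  legal : Bool → Vertex → Bool
  legal b a = not (parity a xor (b ∧ (base a == r)))

  -- Labels of the wrong parity are kept as isolated vertices, so that the vertex set is a plain product.
  cfi : Bool → Graph
  cfi b = record
    { size = N * 2 ^ N
    ; adj = λ a a′ → not (base a == base a′) ∧ ((legal b a ∧ legal b a′) ∧ not (bits a (base a′) xor bits a′ (base a)))
    ; adj-sym = λ a a′ → cong₂ _∧_ (cong not (==-sym (base a) (base a′)))
        (cong₂ _∧_ (∧-comm (legal b a) (legal b a′)) (cong not (xor-comm (bits a (base a′)) (bits a′ (base a)))))
    ; adj-irrefl = λ a → cong (λ c → not c ∧ ((legal b a ∧ legal b a) ∧ not (bits a (base a) xor bits a (base a)))) (==-refl (base a))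
    }

  shift : (Fin N → Bool) → Vertex → Vertex
  shift s a = vertex (base a) (λ u → bits a u xor s u)

  base-shift : ∀ s a → base (shift s a) ≡ base a
  base-shift s a = base-vertex (base a) _

  bits-shift : ∀ s a u → bits (shift s a) u ≡ bits a u xor s u
  bits-shift s a u = bits-vertex (base a) _ u

  parity-shift : ∀ s a → parity (shift s a) ≡ parity a xor ∑ (λ u → not (base a == u) ∧ s u)
  parity-shift s a = trans (∑-cong N (λ u → trans (cong₂ (λ v b → not (v == u) ∧ b) (base-shift s a) (bits-shift s a u))
    (∧-distribˡ-xor (not (base a == u)) (bits a u) (s u)))) (∑-xor N _ _)

  module _ (F : Graph) where

    private
      code : (Fin (size F) → Vertex) → Vec (Fin N) (size F)
      code f = Vec.tabulate (base ∘ f)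

      retwistAt : Vec (Fin N) (size F) → (Fin (size F) → Vertex) → Fin (size F) → Vertex
      retwistAt v f with twist⊎odd F r (Vec.lookup v)
      ... | inj₁ t = λ i → shift (Twist.s t i) (f i)
      ... | inj₂ _ = f

      base-retwistAt : ∀ v f i → base (retwistAt v f i) ≡ base (f i)
      base-retwistAt v f i with twist⊎odd F r (Vec.lookup v)
      ... | inj₁ t = base-shift _ _
      ... | inj₂ _ = refl

      retwistAt-injective : ∀ v {f g} i → base (f i) ≡ base (g i) → retwistAt v f i ≡ retwistAt v g i → f i ≡ g i
      retwistAt-injective v {f} {g} i b≡ e with twist⊎odd F r (Vec.lookup v)
      ... | inj₂ _ = e
      ... | inj₁ t = vertex-ext b≡ (λ u → xor-cancelʳ (Twist.s t i u)
              (trans (sym (bits-shift _ (f i) u)) (trans (cong (λ a → bits a u) e) (bits-shift _ (g i) u))))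
        where
        xor-cancelʳ : ∀ {a b} c → a xor c ≡ b xor c → a ≡ b
        xor-cancelʳ {a} {b} c e = xor-false⇒≡ (trans
          (solve 3 (λ a b c → a :+ b := (a :+ c) :+ (b :+ c)) refl a b c) (≡⇒xor-false e))
          where open xor-∧-Solver

    -- Routing φ through a vector makes the chosen twist depend only on the values of φ.
    retwist : (Fin (size F) → Vertex) → Fin (size F) → Vertex
    retwist f = retwistAt (code f) f

    base-retwist : ∀ f i → base (retwist f i) ≡ base (f i)
    base-retwist f = base-retwistAt (code f) f

    -- Since `base ∘ f` survives retwisting, f and g with equal images are shifted by the same
    -- twist, and adding a fixed label is injective.
    retwist-injective : ∀ {f g} → retwist f ≗ retwist g → f ≗ g
    retwist-injective {f} {g} e i = retwistAt-injective (code f) i (base≗ i)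
        (trans (e i) (cong (λ v → retwistAt v g i) (sym (Vec.tabulate-cong base≗))))
      where
      base≗ : base ∘ f ≗ base ∘ g
      base≗ i = trans (sym (base-retwist f i)) (trans (cong base (e i)) (base-retwist g i))

    shift-hom : ∀ b {f} (t : Twist F r (Vec.lookup (code f))) → IsHom F (cfi b) f → IsHom F (cfi (not b)) (λ i → shift (Twist.s t i) (f i))
    shift-hom b {f} t h i j a = ∧-true
        (trans (cong₂ (λ v w → not (v == w)) (base-shift _ (f i)) (base-shift _ (f j))) (∧-trueˡ e))
        (∧-true (∧-true (legal-shift i (∧-trueˡ (∧-trueˡ e′))) (legal-shift j (∧-trueʳ {legal b (f i)} (∧-trueˡ e′))))
          (not-true (≡⇒xor-false bits≡)))
      where
      open Twist t
      e = h i j a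
      e′ = ∧-trueʳ {not (base (f i) == base (f j))} e
      φ≡ : ∀ i → Vec.lookup (code f) i ≡ base (f i)
      φ≡ = Vec.lookup∘tabulate (base ∘ f)
      legal-shift : ∀ i → legal b (f i) ≡ true → legal (not b) (shift (s i) (f i)) ≡ true
      legal-shift i l = not-true (begin
          parity (shift (s i) (f i)) xor (not b ∧ (base (shift (s i) (f i)) == r))
        ≡⟨ cong₂ (λ p v → p xor (not b ∧ (v == r))) (parity-shift (s i) (f i)) (base-shift (s i) (f i)) ⟩
          (parity (f i) xor ∑ (λ u → not (base (f i) == u) ∧ s i u)) xor (not b ∧ (base (f i) == r))
        ≡⟨ cong (λ p → (parity (f i) xor p) xor (not b ∧ (base (f i) == r)))
             (subst (λ v → ∑ (λ u → not (v == u) ∧ s i u) ≡ (v == r)) (φ≡ i) (s-parity i)) ⟩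
          (parity (f i) xor (base (f i) == r)) xor (not b ∧ (base (f i) == r))
        ≡⟨ lemma b (parity (f i)) (base (f i) == r) ⟩
          parity (f i) xor (b ∧ (base (f i) == r))
        ≡⟨ not-true⁻ l ⟩
          false ∎)
        where
        open ≡-Reasoning
        lemma : ∀ b p q → (p xor q) xor (not b ∧ q) ≡ p xor (b ∧ q)
        lemma false = solve 2 (λ p q → (p :+ q) :+ q := p :+ con false) refl where open xor-∧-Solver
        lemma true  = solve 2 (λ p q → (p :+ q) :+ con false := p :+ q) refl where open xor-∧-Solver
      bits≡ : bits (shift (s i) (f i)) (base (shift (s j) (f j))) ≡ bits (shift (s j) (f j)) (base (shift (s i) (f i)))
      bits≡ rewrite base-shift (s j) (f j) | base-shift (s i) (f i)
        | bits-shift (s i) (f i) (base (f j)) | bits-shift (s j) (f j) (base (f i)) =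
        cong₂ _xor_ (xor-false⇒≡ {bits (f i) (base (f j))} {bits (f j) (base (f i))} (not-true⁻ (∧-trueʳ {legal b (f i) ∧ legal b (f j)} e′)))
          (subst (λ v → s i v ≡ s j (base (f i))) (φ≡ j) (subst (λ v → s i (Vec.lookup (code f) j) ≡ s j v) (φ≡ i) (s-edge i j a)))

    retwist-hom : ∀ b → (∀ {f} → IsHom F (cfi b) f → ¬ Odd F r (Vec.lookup (code f))) →
      ∀ {f} → IsHom F (cfi b) f → IsHom F (cfi (not b)) (retwist f)
    retwist-hom b ¬odd {f} h with twist⊎odd F r (Vec.lookup (code f))
    ... | inj₁ t = shift-hom b {f} t h
    ... | inj₂ o = ⊥-elim (¬odd h o)

    hom-cfi : (∀ φ → ¬ Odd F r φ) → hom F (cfi false) ≡ hom F (cfi true)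
    hom-cfi ¬odd = ℕ.≤-antisym (compare false) (compare true)
      where
      compare : ∀ b → hom F (cfi b) ≤ hom F (cfi (not b))
      compare b = hom-≤ F (cfi b) (cfi (not b)) retwist (retwist-hom b (λ _ → ¬odd _)) (λ _ _ → retwist-injective)

    -- The bits of the images are themselves the twist. Legality is visible only on edges, so every
    -- vertex needs a neighbour to have a legal image.
    hom⇒twist : (∀ i → ∃ λ j → adj F i j ≡ true) → ∀ {f} → IsHom F (cfi true) f → Twist F r (base ∘ f)
    hom⇒twist nbr {f} h = record
      { s = λ i → bits (f i)
      ; s-parity = λ i → let j , a = nbr i in xor-false⇒≡ (not-true⁻ {parity (f i) xor (base (f i) == r)} (∧-trueˡ (∧-trueˡ (∧-trueʳ {not (base (f i) == base (f j))} (h i j a)))))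
      ; s-edge = λ i j a → xor-false⇒≡ (not-true⁻ (∧-trueʳ {legal true (f i) ∧ legal true (f j)} (∧-trueʳ {not (base (f i) == base (f j))} (h i j a))))
      }

  -- Homomorphisms from K_N tell the graphs apart. Those into the twisted graph have twistable base
  -- maps, so `retwist` sends them injectively to homomorphisms into the untwisted graph. The
  -- all-zero section `h₀` is missed, because it lies over the identity of K_N, which is odd.
  cfi-≇ : (∀ i → ∃ λ j → adj (Kₙ N) i j ≡ true) → ¬ (cfi false ≅ cfi true)
  cfi-≇ nbr iso = ℕ.<⇒≱ (hom-< K (cfi true) (cfi false) (retwist K) (retwist-hom K true no-odd) (λ _ _ → retwist-injective K) h₀-hom h₀∉)
    (hom-≅ K iso)
    where
    K = Kₙ N
    twist-cong : ∀ {φ ψ} → φ ≗ ψ → Twist K r φ → Twist K r ψ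
    twist-cong {φ} {ψ} e t = record
      { s = s
      ; s-parity = λ i → subst (λ v → ∑ (λ u → not (v == u) ∧ s i u) ≡ (v == r)) (e i) (s-parity i)
      ; s-edge = λ i j a → subst (λ v → s i v ≡ s j (ψ i)) (e j) (subst (λ v → s i (φ j) ≡ s j v) (e i) (s-edge i j a))
      }
      where open Twist t
    no-odd : ∀ {f} → IsHom K (cfi true) f → ¬ Odd K r (Vec.lookup (Vec.tabulate (base ∘ f)))
    no-odd {f} h = ¬twist×odd K r _ (twist-cong (sym ∘ Vec.lookup∘tabulate (base ∘ f)) (hom⇒twist K nbr h))
    h₀ : Fin N → Vertex
    h₀ i = vertex i (λ _ → false)
    h₀-legal : ∀ i → legal false (h₀ i) ≡ true
    h₀-legal i = not-true (trans (xor-identityʳ _) (∑-zero N (λ u → trans (cong (not (base (h₀ i) == u) ∧_) (bits-vertex i _ u)) (∧-zeroʳ _))))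
    h₀-hom : IsHom K (cfi false) h₀
    h₀-hom i j a = ∧-true (trans (cong₂ (λ v w → not (v == w)) (base-vertex i _) (base-vertex j _)) a)
      (∧-true (∧-true (h₀-legal i) (h₀-legal j)) (not-true (cong₂ _xor_ (bits-vertex i _ _) (bits-vertex j _ _))))
    id-odd : Odd K r (λ i → i)
    id-odd = record
      { Z = adj K
      ; Z-sym = adj-sym K
      ; Z-adj = λ _ _ a → a
      ; y = λ _ → true
      ; Z-deg = λ i u → trans (∑-cong N (λ j → ∧-comm (not (i == j)) (j == u))) (∑-pick u (λ j → not (i == j)))
      ; odd = trans (∑-cong N (λ i → sym (∧-identityʳ (i == r)))) (∑-pick r (λ _ → true))
      }
    h₀∉ : ∀ {f} → IsHom K (cfi true) f → ¬ retwist K f ≗ h₀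
    h₀∉ {f} h e = ¬twist×odd K r (λ i → i)
      (twist-cong (λ i → trans (sym (base-retwist K f i)) (trans (cong base (e i)) (base-vertex i _))) (hom⇒twist K nbr h)) id-odd

-- Intersection numbers on embedded graphs

iter-+ : ∀ {A : Set} (f : A → A) i j x → iter f (i + j) x ≡ iter f i (iter f j x)
iter-+ f zero    j x = refl
iter-+ f (suc i) j x = cong f (iter-+ f i j x)

iter-suc : ∀ {A : Set} (f : A → A) i x → iter f (suc i) x ≡ iter f i (f x)
iter-suc f zero    x = refl
iter-suc f (suc i) x = cong f (iter-suc f i x)

anyN-true : ∀ {k} {f : ℕ → Bool} i → i < k → f i ≡ true → anyN k f ≡ true
anyN-true {suc k} {f} i (s≤s i≤k) e with i ℕ.≟ k
... | yes refl = ∨-trueˡ e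
... | no i≢k   = ∨-trueʳ {f k} (anyN-true i (ℕ.≤∧≢⇒< i≤k i≢k) e)

anyN-true⁻ : ∀ k {f : ℕ → Bool} → anyN k f ≡ true → ∃ λ i → f i ≡ true
anyN-true⁻ (suc k) e with ∨-true⁻ e
... | inj₁ p = k , p
... | inj₂ p = anyN-true⁻ k p

iff⇒≡ : ∀ {a b} → (a ≡ true → b ≡ true) → (b ≡ true → a ≡ true) → a ≡ b
iff⇒≡ {true}  {b}     f g = sym (f refl)
iff⇒≡ {false} {true}  f g = g refl
iff⇒≡ {false} {false} f g = refl

∑-const∧ : ∀ {n} (g b : Fin n → Bool) → (∀ {w w′} → b w ≡ true → b w′ ≡ true → g w ≡ g w′) →
  ∑ b ≡ false → ∑ (λ w → g w ∧ b w) ≡ false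
∑-const∧ {n} g b const even with search b (allFin n)
... | inj₂ none = ∑-zero n (λ w → trans (cong (g w ∧_) (none (∈-allFin w))) (∧-zeroʳ (g w)))
... | inj₁ (w₀ , _ , bw₀) = begin
    ∑ (λ w → g w ∧ b w)   ≡⟨ ∑-cong n (λ w → trans (∧-comm (g w) (b w)) (trans (∧-cong-true (λ bw → const bw bw₀)) (∧-comm (b w) (g w₀)))) ⟩
    ∑ (λ w → g w₀ ∧ b w)  ≡⟨ ∑-∧ˡ n (g w₀) b ⟩
    g w₀ ∧ ∑ b            ≡⟨ cong (g w₀ ∧_) even ⟩
    g w₀ ∧ false          ≡⟨ ∧-zeroʳ (g w₀) ⟩
    false ∎
  where open ≡-Reasoning

flags : ∀ n → List (Flag n)
flags n = cartesianProduct (allFin n) (cartesianProduct (allFin n) (false ∷ true ∷ []))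

_≟ᶠ_ : ∀ {n} → DecidableEquality (Flag n)
_≟ᶠ_ = Product.≡-dec Fin._≟_ (Product.≡-dec Fin._≟_ Bool._≟_)

unique-flags : ∀ n → Unique (flags n)
unique-flags n = Unique.cartesianProduct⁺ (Unique.allFin⁺ n) (Unique.cartesianProduct⁺ (Unique.allFin⁺ n) (((λ ()) ∷ []) ∷ [] ∷ []))

∈-flags : ∀ {n} (x : Flag n) → x ∈ flags n
∈-flags (v , w , s) = ∈-cartesianProduct⁺ (∈-allFin v) (∈-cartesianProduct⁺ (∈-allFin w) (∈-bools s))
  where
  ∈-bools : ∀ s → s ∈ false ∷ true ∷ []
  ∈-bools false = here refl
  ∈-bools true  = there (here refl)

⨁-flags : ∀ {n} f → ⨁ (flags n) f ≡ ∑ (λ v → ∑ (λ w → f (v , w , false) xor f (v , w , true)))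
⨁-flags {n} f = trans (⨁-product (allFin n) _ f) (∑-cong n (λ v →
  trans (⨁-product (allFin n) _ (λ p → f (v , p))) (∑-cong n (λ w → cong (f (v , w , false) xor_) (xor-identityʳ _)))))

eqFlag-refl : ∀ {n} (x : Flag n) → eqFlag x x ≡ true
eqFlag-refl (v , w , false) = ∧-true (eqFin-refl v) (∧-true (eqFin-refl w) refl)
eqFlag-refl (v , w , true)  = ∧-true (eqFin-refl v) (∧-true (eqFin-refl w) refl)

eqFlag⇒≡ : ∀ {n} (x y : Flag n) → eqFlag x y ≡ true → x ≡ y
eqFlag⇒≡ (v , w , s) (v′ , w′ , s′) e
  with refl ← eqFin⇒≡ {i = v} {v′} (∧-trueˡ e)
  with refl ← eqFin⇒≡ {i = w} {w′} (∧-trueˡ (∧-trueʳ {eqFin v v′} e))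
  with refl ← xor-false⇒≡ {s} {s′} (not-true⁻ (∧-trueʳ {eqFin w w′} (∧-trueʳ {eqFin v v′} e))) = refl

anyFlag-true : ∀ {n} {f : Flag n → Bool} x → f x ≡ true → anyFlag n f ≡ true
anyFlag-true (v , w , false) e = anyF-true v (anyF-true w (∨-trueˡ e))
anyFlag-true {f = f} (v , w , true)  e = anyF-true v (anyF-true w (∨-trueʳ {f (v , w , false)} e))

side : Bool → Fin 2
side false = zero
side true  = suc zero

side-injective : ∀ {s s′} → side s ≡ side s′ → s ≡ s′
side-injective {false} {false} _ = refl
side-injective {true}  {true}  _ = refl

toℕ-side : ∀ s → toℕ (side s) ≡ (if s then 1 else 0)
toℕ-side false = refl
toℕ-side true  = refl

toℕ-code : ∀ {n} (v w : Fin n) s → toℕ (Fin.combine {n * n} {2} (Fin.combine v w) (side s)) ≡ flagCode (v , w , s)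
toℕ-code {n} v w s = begin
    toℕ (Fin.combine {n * n} {2} (Fin.combine v w) (side s))
  ≡⟨ Fin.toℕ-combine {n * n} {2} (Fin.combine v w) (side s) ⟩
    2 * toℕ (Fin.combine v w) + toℕ (side s)
  ≡⟨ cong₂ _+_ (trans (ℕ.*-comm 2 (toℕ (Fin.combine v w))) (cong (_* 2) (trans (Fin.toℕ-combine v w) (cong (_+ toℕ w) (ℕ.*-comm n (toℕ v)))))) (toℕ-side s) ⟩
    (toℕ v * n + toℕ w) * 2 + (if s then 1 else 0) ∎
  where open ≡-Reasoning

flagCode-injective : ∀ {n} (x y : Flag n) → flagCode x ≡ flagCode y → x ≡ y
flagCode-injective {n} (v , w , s) (v′ , w′ , s′) e
  with vw , ss ← Fin.combine-injective {n * n} {2} (Fin.combine v w) (side s) (Fin.combine v′ w′) (side s′)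
         (Fin.toℕ-injective (trans (toℕ-code v w s) (trans e (sym (toℕ-code v′ w′ s′)))))
  with refl , refl ← Fin.combine-injective v w v′ w′ vw
  with refl ← side-injective ss = refl

countFlag≡length : ∀ n f → countFlag n f ≡ length (filterᵇ f (flags n))
countFlag≡length n f = trans (sumF-cong n (λ v → trans (sumF-cong n (λ w → two v w))
    (sumF≡length n (λ p → f (v , p)) (false ∷ true ∷ []))))
    (sumF≡length n f (cartesianProduct (allFin n) (false ∷ true ∷ [])))
  where
  two : ∀ v w → (if f (v , w , false) then 1 else 0) + (if f (v , w , true) then 1 else 0) ≡
    length (filterᵇ (λ s → f (v , w , s)) (false ∷ true ∷ []))
  two v w with f (v , w , false)
  ... | true with f (v , w , true)
  ...   | true  = refl
  ...   | false = refl
  two v w | false with f (v , w , true)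
  ...   | true  = refl
  ...   | false = refl

module Surface (G : Graph) (Y : Sub (size G)) (E : Embedding G Y) where

  private
    n = size G
    valid = validFlag G Y

  -- An element of the cycle space over 𝔽₂, that is, a subgraph of `G[Y]` with all degrees even.
  record Cycle (a : Fin n → Fin n → Bool) : Set where
    field
      symm : ∀ v w → a v w ≡ a w v
      supp : ∀ {v w} → a v w ≡ true → valid (v , w , false) ≡ true
      even : ∀ v → ∑ (a v) ≡ false
  open Cycle

  valid-r0 : ∀ x → valid x ≡ true → valid (r0 x) ≡ true
  valid-r0 (v , w , s) e = ∧-true {Y w} (∧-trueˡ {Y w} (∧-trueʳ {Y v} e)) (∧-true {Y v} (∧-trueˡ {Y v} e)
    (trans (adj-sym G w v) (∧-trueʳ {Y w} (∧-trueʳ {Y v} e))))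

  valid-≢ : ∀ {v w s} → valid (v , w , s) ≡ true → v ≢ w
  valid-≢ {v} e refl = true≢false (∧-trueʳ {Y v} (∧-trueʳ {Y v} e)) (adj-irrefl G v)

  record InvariantAt (v : Fin n) (g : Flag n → Bool) : Set where
    field
      inv-r1 : ∀ {x} → proj₁ x ≡ v → valid x ≡ true → g (r1 E x) ≡ g x
      inv-r2 : ∀ {x} → proj₁ x ≡ v → valid x ≡ true → g (r2 x) ≡ g x
  open InvariantAt

  private
    iter-invariant : ∀ {v g} → InvariantAt v g → ∀ i {x} → proj₁ x ≡ v → valid x ≡ true →
      let z = iter (λ z → r1 E (r2 z)) i x in proj₁ z ≡ v × valid z ≡ true × g z ≡ g x
    iter-invariant inv zero    at ok = at , ok , refl
    iter-invariant {g = g} inv (suc i) {x} at ok with at′ , ok′ , e ← iter-invariant inv i at ok =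
      trans (r1-vertex E _ ok′) at′ , r1-valid E _ ok′ , trans (inv-r1 inv {r2 z} at′ ok′) (trans (inv-r2 inv at′ ok′) e)
      where z = iter (λ z → r1 E (r2 z)) i x

  -- The involutions r1 and r2 act transitively on the flags at v.
  invariant-const : ∀ {v g} → InvariantAt v g → ∀ {x y} → proj₁ x ≡ v → proj₁ y ≡ v →
    valid x ≡ true → valid y ≡ true → g x ≡ g y
  invariant-const inv {x} {y} atx aty okx oky with r1-transitive E x y okx oky (trans atx (sym aty))
  ... | i , inj₁ refl = sym (proj₂ (proj₂ (iter-invariant inv i atx okx)))
  ... | i , inj₂ refl = sym (trans (proj₂ (proj₂ (iter-invariant inv i (trans (r1-vertex E x okx) atx) (r1-valid E x okx)))) (inv-r1 inv atx okx))

  ω-at : (Flag n → Bool) → (Fin n → Fin n → Bool) → Fin n → Bool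
  ω-at p b v = ∑ (λ w → p (v , w , false) ∧ b v w)

  -- The intersection number of a and b, if p is a potential of a. An edge of b is read at both ends
  -- on the same side, so it counts exactly when the colour changes along it; where b shares an edge
  -- with a, this amounts to pushing b off to one side.
  ω : (Flag n → Bool) → (Fin n → Fin n → Bool) → Bool
  ω p b = ∑ (ω-at p b)

  -- A constant colour is counted once for each edge of b at v, and these are even in number. So a
  -- potential matters only up to a constant at each vertex.
  ω-at-invariant : ∀ {p b v} → Cycle b → InvariantAt v p → ω-at p b v ≡ false
  ω-at-invariant {p} {b} {v} cb inv = ∑-const∧ (λ w → p (v , w , false)) (b v)
    (λ bw bw′ → invariant-const inv refl refl (supp cb bw) (supp cb bw′)) (even cb v)

  -- p colours the corners at each vertex so that the colour changes exactly across the edges of a.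
  record Potential (a : Fin n → Fin n → Bool) (p : Flag n → Bool) : Set where
    field
      pot-r1 : ∀ {x} → valid x ≡ true → p (r1 E x) ≡ p x
      pot-r2 : ∀ {v w s} → valid (v , w , s) ≡ true → p (v , w , not s) ≡ p (v , w , s) xor a v w
  open Potential

  potential-diff : ∀ {a a′ p p′ v} → Potential a p → Potential a′ p′ → (∀ w → a v w ≡ a′ v w) →
    InvariantAt v (λ x → p x xor p′ x)
  potential-diff {a} {a′} {p} {p′} pot pot′ e = record
    { inv-r1 = λ _ ok → cong₂ _xor_ (pot-r1 pot ok) (pot-r1 pot′ ok)
    ; inv-r2 = λ { {v , w , s} refl ok → trans (cong₂ _xor_ (pot-r2 pot ok) (trans (pot-r2 pot′ ok) (cong (p′ (v , w , s) xor_) (sym (e w)))))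
        (solve 3 (λ p q a → (p :+ a) :+ (q :+ a) := p :+ q) refl (p (v , w , s)) (p′ (v , w , s)) (a v w)) }
    }
    where open xor-∧-Solver

  potential-zero : ∀ {a p v} → Potential a p → (∀ w → a v w ≡ false) → InvariantAt v p
  potential-zero {p = p} pot e = record
    { inv-r1 = λ _ → pot-r1 pot
    ; inv-r2 = λ { {v , w , s} refl ok → trans (pot-r2 pot ok) (trans (cong (p (v , w , s) xor_) (e w)) (xor-identityʳ _)) }
    }

  -- Each corner consists of two flags.
  ∑-corners : ∀ v (g : Flag n → Bool) → (∀ {x} → valid x ≡ true → g (r1 E x) ≡ g x) →
    ∑ (λ w → valid (v , w , false) ∧ (g (v , w , false) xor g (v , w , true))) ≡ false
  ∑-corners v g inv = begin
      ∑ (λ w → valid (v , w , false) ∧ (g (v , w , false) xor g (v , w , true)))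
    ≡⟨ ∑-pick v (λ v → ∑ (λ w → valid (v , w , false) ∧ (g (v , w , false) xor g (v , w , true)))) ⟨
      ∑ (λ v′ → (v′ == v) ∧ ∑ (λ w → valid (v′ , w , false) ∧ (g (v′ , w , false) xor g (v′ , w , true))))
    ≡⟨ ∑-cong n (λ v′ → trans (sym (∑-∧ˡ n (v′ == v) _)) (∑-cong n (λ w →
         solve 4 (λ d c g h → d :* (c :* (g :+ h)) := ((d :* c) :* g) :+ ((d :* c) :* h)) refl (v′ == v) (valid (v′ , w , false)) (g (v′ , w , false)) (g (v′ , w , true))))) ⟩
      ∑ (λ v′ → ∑ (λ w → (((v′ == v) ∧ valid (v′ , w , false)) ∧ g (v′ , w , false)) xor (((v′ == v) ∧ valid (v′ , w , true)) ∧ g (v′ , w , true))))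
    ≡⟨ ⨁-flags (λ x → ((proj₁ x == v) ∧ valid x) ∧ g x) ⟨
      ⨁ (flags n) (λ x → ((proj₁ x == v) ∧ valid x) ∧ g x)
    ≡⟨ ⨁-involution _≟ᶠ_ (unique-flags n) (λ x → (proj₁ x == v) ∧ valid x) (r1 E) g
         (λ {x} e → ∧-true (trans (cong (_== v) (r1-vertex E x (∧-trueʳ {proj₁ x == v} e))) (∧-trueˡ e)) (r1-valid E x (∧-trueʳ {proj₁ x == v} e)))
         (λ {x} _ → ∈-flags (r1 E x))
         (λ {x} e → r1-invol E x (∧-trueʳ {proj₁ x == v} e))
         (λ {x} e fixed → true≢false (trans (cong (eqFlag (r1 E x)) (sym fixed)) (eqFlag-refl (r1 E x))) (r1-nofix E x (∧-trueʳ {proj₁ x == v} e)))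
         (λ {x} e → inv (∧-trueʳ {proj₁ x == v} e)) ⟩
      false ∎
    where
    open ≡-Reasoning
    open xor-∧-Solver

  -- A Leibniz rule: across an edge the product p · q changes by p · b + q · a + a · b, and the
  -- changes around v add up to zero.
  ω-at-product : ∀ {a b p q} v → Cycle a → Cycle b → Potential a p → Potential b q →
    ω-at p b v xor ω-at q a v ≡ ∑ (λ w → a v w ∧ b v w)
  ω-at-product {a} {b} {p} {q} v ca cb pa qb = xor-false⇒≡ (begin
      (ω-at p b v xor ω-at q a v) xor ∑ (λ w → a v w ∧ b v w)
    ≡⟨ trans (∑-xor n _ _) (cong (_xor ∑ (λ w → a v w ∧ b v w)) (∑-xor n _ _)) ⟨
      ∑ (λ w → ((p (v , w , false) ∧ b v w) xor (q (v , w , false) ∧ a v w)) xor (a v w ∧ b v w))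
    ≡⟨ ∑-cong n (λ w → leibniz w) ⟩
      ∑ (λ w → valid (v , w , false) ∧ ((p (v , w , false) ∧ q (v , w , false)) xor (p (v , w , true) ∧ q (v , w , true))))
    ≡⟨ ∑-corners v (λ x → p x ∧ q x) (λ ok → cong₂ _∧_ (pot-r1 pa ok) (pot-r1 qb ok)) ⟩
      false ∎)
    where
    open ≡-Reasoning
    leibniz : ∀ w → ((p (v , w , false) ∧ b v w) xor (q (v , w , false) ∧ a v w)) xor (a v w ∧ b v w) ≡
      valid (v , w , false) ∧ ((p (v , w , false) ∧ q (v , w , false)) xor (p (v , w , true) ∧ q (v , w , true)))
    leibniz w with bool-split (valid (v , w , false))
    ... | inj₁ ok rewrite ok | pot-r2 pa {v} {w} {false} ok | pot-r2 qb {v} {w} {false} ok =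
      solve 4 (λ p q a b → ((p :* b) :+ (q :* a)) :+ (a :* b) := (p :* q) :+ ((p :+ a) :* (q :+ b))) refl
        (p (v , w , false)) (q (v , w , false)) (a v w) (b v w)
      where open xor-∧-Solver
    ... | inj₂ bad rewrite bad | ¬-not (λ t → true≢false (supp ca {v} {w} t) bad) | ¬-not (λ t → true≢false (supp cb {v} {w} t) bad)
      | ∧-zeroʳ (p (v , w , false)) | ∧-zeroʳ (q (v , w , false)) = refl

  -- Invariance under r0 makes both ends of an edge read the same colour. For a potential this means
  -- that it colours faces, so its cycle bounds.
  ω-r0-invariant : ∀ {f b} → Cycle b → (∀ {x} → valid x ≡ true → f (r0 x) ≡ f x) → ω f b ≡ false
  ω-r0-invariant {f} {b} cb inv = ⨁-symmetric (allFin n) (λ v w → f (v , w , false) ∧ b v w)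
    (λ v w → begin
      f (v , w , false) ∧ b v w   ≡⟨ ∧-comm (f (v , w , false)) (b v w) ⟩
      b v w ∧ f (v , w , false)   ≡⟨ ∧-cong-true (λ t → sym (inv (supp cb t))) ⟩
      b v w ∧ f (w , v , false)   ≡⟨ cong (_∧ f (w , v , false)) (symm cb v w) ⟩
      b w v ∧ f (w , v , false)   ≡⟨ ∧-comm (b w v) (f (w , v , false)) ⟩
      f (w , v , false) ∧ b w v   ∎)
    (λ v → trans (cong (f (v , v , false) ∧_) (¬-not (λ t → valid-≢ {s = false} (supp cb t) refl))) (∧-zeroʳ _))
    where open ≡-Reasoning

  module _ {a : Fin n → Fin n → Bool} (ca : Cycle a) where

    private
      Equation = Flag n ⊎ Flag n

      equations : List Equation
      equations = map inj₁ (flags n) ++ map inj₂ (flags n)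

      unique-equations : Unique equations
      unique-equations = Unique.++⁺ (Unique.map⁺ Sum.inj₁-injective (unique-flags n)) (Unique.map⁺ Sum.inj₂-injective (unique-flags n)) disj
        where
        disj : Disjoint (map inj₁ (flags n)) (map inj₂ (flags n))
        disj (a , b) with _ , _ , refl ← ∈-map⁻ inj₁ a with ∈-map⁻ inj₂ b
        ... | _ , _ , ()

      M : Equation → Flag n → Bool
      M (inj₁ x) z = valid x ∧ (does (z ≟ᶠ r1 E x) xor does (z ≟ᶠ x))
      M (inj₂ x) z = valid x ∧ (does (z ≟ᶠ r2 x) xor does (z ≟ᶠ x))

      rhs : Equation → Bool
      rhs (inj₁ x)           = false
      rhs (inj₂ (v , w , s)) = a v w

      pick : ∀ σ (p : Flag n → Bool) {x} → valid x ≡ true →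
        ⨁ (flags n) (λ z → (valid x ∧ (does (z ≟ᶠ σ) xor does (z ≟ᶠ x))) ∧ p z) ≡ p σ xor p x
      pick σ p {x} ok = trans (⨁-cong (flags n) (λ z → trans (cong (λ b → (b ∧ (does (z ≟ᶠ σ) xor does (z ≟ᶠ x))) ∧ p z) ok)
          (∧-distribʳ-xor (p z) (does (z ≟ᶠ σ)) (does (z ≟ᶠ x)))))
        (trans (⨁-xor (flags n) _ _) (cong₂ _xor_ (⨁-pick _≟ᶠ_ (unique-flags n) (∈-flags σ) p) (⨁-pick _≟ᶠ_ (unique-flags n) (∈-flags x) p)))

      solution : (Σ (Flag n → Bool) λ p → ∀ {e} → e ∈ equations → ⨁ (flags n) (λ z → M e z ∧ p z) ≡ rhs e) → ∃ (Potential a)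
      solution (p , sol) = p , record
        { pot-r1 = λ {x} ok → xor-false⇒≡ (trans (sym (pick (r1 E x) p ok)) (sol (∈-++⁺ˡ (∈-map⁺ inj₁ (∈-flags x)))))
        ; pot-r2 = λ {v} {w} {s} ok → let x = (v , w , s) in
            trans (solve 2 (λ p q → p := q :+ (p :+ q)) refl (p (r2 x)) (p x))
              (cong (p x xor_) (trans (sym (pick (r2 x) p ok)) (sol (∈-++⁺ʳ (map inj₁ (flags n)) (∈-map⁺ inj₂ (∈-flags x))))))
        }
        where open xor-∧-Solver

      ⨁-equations : ∀ f → ⨁ equations f ≡ ⨁ (flags n) (f ∘ inj₁) xor ⨁ (flags n) (f ∘ inj₂)
      ⨁-equations f = trans (⨁-++ (map inj₁ (flags n)) (map inj₂ (flags n)) f) (cong₂ _xor_ (⨁-map inj₁ (flags n) f) (⨁-map inj₂ (flags n) f))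

      transpose : ∀ (σ : Flag n → Flag n) → (∀ {x} → valid x ≡ true → valid (σ x) ≡ true) → (∀ {x} → valid x ≡ true → σ (σ x) ≡ x) →
        ∀ (c : Flag n → Bool) {z} → valid z ≡ true →
        ⨁ (flags n) (λ x → c x ∧ (valid x ∧ (does (z ≟ᶠ σ x) xor does (z ≟ᶠ x)))) ≡ c (σ z) xor c z
      transpose σ σ-ok σ-σ c {z} ok = begin
          ⨁ (flags n) (λ x → c x ∧ (valid x ∧ (does (z ≟ᶠ σ x) xor does (z ≟ᶠ x))))
        ≡⟨ ⨁-cong (flags n) (λ x → trans
             (solve 4 (λ c v p q → c :* (v :* (p :+ q)) := ((v :* p) :* c) :+ ((v :* q) :* c)) refl (c x) (valid x) (does (z ≟ᶠ σ x)) (does (z ≟ᶠ x)))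
             (cong₂ (λ p q → (p ∧ c x) xor (q ∧ c x)) (move x) (stay x))) ⟩
          ⨁ (flags n) (λ x → (does (x ≟ᶠ σ z) ∧ c x) xor (does (x ≟ᶠ z) ∧ c x))
        ≡⟨ trans (⨁-xor (flags n) _ _) (cong₂ _xor_ (⨁-pick _≟ᶠ_ (unique-flags n) (∈-flags (σ z)) c) (⨁-pick _≟ᶠ_ (unique-flags n) (∈-flags z) c)) ⟩
          c (σ z) xor c z ∎
        where
        open ≡-Reasoning
        open xor-∧-Solver
        move : ∀ x → valid x ∧ does (z ≟ᶠ σ x) ≡ does (x ≟ᶠ σ z)
        move x = iff⇒≡
          (λ e → dec-true (x ≟ᶠ σ z) (trans (sym (σ-σ (∧-trueˡ e))) (cong σ (sym (does⇒≡ _≟ᶠ_ {z} {σ x} (∧-trueʳ {valid x} e))))))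
          (λ e → let x≡ = does⇒≡ _≟ᶠ_ {x} {σ z} e in ∧-true (trans (cong valid x≡) (σ-ok ok)) (dec-true (z ≟ᶠ σ x) (trans (sym (σ-σ ok)) (cong σ (sym x≡)))))
        stay : ∀ x → valid x ∧ does (z ≟ᶠ x) ≡ does (x ≟ᶠ z)
        stay x = iff⇒≡
          (λ e → dec-true (x ≟ᶠ z) (sym (does⇒≡ _≟ᶠ_ {z} {x} (∧-trueʳ {valid x} e))))
          (λ e → let x≡ = does⇒≡ _≟ᶠ_ {x} {z} e in ∧-true (trans (cong valid x≡) ok) (dec-true (z ≟ᶠ x) (sym x≡)))

      r2-r2 : ∀ (x : Flag n) → r2 (r2 x) ≡ x
      r2-r2 (v , w , false) = refl
      r2-r2 (v , w , true)  = refl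

      -- The two weights on the r2-equations at an edge add up to `C`. By the certificate `C` is
      -- also a sum over the two flags of a corner, so it is constant around each vertex, and
      -- pairing it with the even set of a-edges there cannot give 1.
      no-certificate : (Σ (Equation → Bool) λ c → (∀ {x} → x ∈ flags n → ⨁ equations (λ e → c e ∧ M e x) ≡ false) ×
        ⨁ equations (λ e → c e ∧ rhs e) ≡ true) → ⊥
      no-certificate (c , zer , one) = true≢false one (begin
          ⨁ equations (λ e → c e ∧ rhs e)
        ≡⟨ ⨁-equations _ ⟩
          ⨁ (flags n) (λ x → c₁ x ∧ false) xor ⨁ (flags n) (λ x → c₂ x ∧ rhs (inj₂ x))
        ≡⟨ cong₂ _xor_ (⨁-zero (flags n) (λ x → ∧-zeroʳ (c₁ x))) (⨁-flags (λ x → c₂ x ∧ rhs (inj₂ x))) ⟩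
          ∑ (λ v → ∑ (λ w → (c₂ (v , w , false) ∧ a v w) xor (c₂ (v , w , true) ∧ a v w)))
        ≡⟨ ∑-cong n (λ v → ∑-cong n (λ w → trans (sym (∧-distribʳ-xor (a v w) (c₂ (v , w , false)) (c₂ (v , w , true))))
             (cong (_∧ a v w) (xor-comm (c₂ (v , w , false)) (c₂ (v , w , true)))))) ⟩
          ∑ (λ v → ω-at C a v)
        ≡⟨ ∑-zero n (λ v → ω-at-invariant ca (C-invariant v)) ⟩
          false ∎)
        where
        open ≡-Reasoning
        c₁ c₂ C : Flag n → Bool
        c₁ x = c (inj₁ x)
        c₂ x = c (inj₂ x)
        C x = c₂ (r2 x) xor c₂ x
        C≡ : ∀ {x} → valid x ≡ true → C x ≡ c₁ (r1 E x) xor c₁ x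
        C≡ {x} ok = sym (xor-false⇒≡ (trans (sym (trans (⨁-equations _) (cong₂ _xor_
          (transpose (r1 E) (λ {x} → r1-valid E x) (λ {x} → r1-invol E x) c₁ ok)
          (transpose r2 (λ ok → ok) (λ {x} _ → r2-r2 x) c₂ ok)))) (zer (∈-flags x))))
        C-invariant : ∀ v → InvariantAt v C
        C-invariant v = record
          { inv-r1 = λ {x} _ ok → begin
              C (r1 E x)                              ≡⟨ C≡ (r1-valid E x ok) ⟩
              c₁ (r1 E (r1 E x)) xor c₁ (r1 E x)      ≡⟨ cong (λ z → c₁ z xor c₁ (r1 E x)) (r1-invol E x ok) ⟩
              c₁ x xor c₁ (r1 E x)                    ≡⟨ xor-comm (c₁ x) _ ⟩
              c₁ (r1 E x) xor c₁ x                    ≡⟨ C≡ ok ⟨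
              C x                                     ∎
          ; inv-r2 = λ {x} _ _ → trans (cong (λ z → c₂ z xor c₂ (r2 x)) (r2-r2 x)) (xor-comm (c₂ x) (c₂ (r2 x)))
          }

    abstract
      -- Going once around a vertex crosses evenly many edges of a, so an alternating colouring of
      -- the corners closes up.
      potential : ∃ (Potential a)
      potential with solvable⊎certificate _≟ᶠ_ (Sum.≡-dec _≟ᶠ_ _≟ᶠ_) unique-equations (unique-flags n) M rhs
      ... | inj₁ s = solution s
      ... | inj₂ c = ⊥-elim (no-certificate c)

-- Faces and the Euler genus

module Faces (G : Graph) (Y : Sub (size G)) (E : Embedding G Y) where

  open Surface G Y E
  open Cycle

  private
    n = size G
    valid = validFlag G Y

    ρ : Flag n → Flag n
    ρ z = r0 (r1 E z)

    iter-valid : ∀ i {x} → valid x ≡ true → valid (iter ρ i x) ≡ true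
    iter-valid zero    ok = ok
    iter-valid (suc i) {x} ok = valid-r0 (r1 E (iter ρ i x)) (r1-valid E _ (iter-valid i ok))

    ρ-injective : ∀ {x y} → valid x ≡ true → valid y ≡ true → ρ x ≡ ρ y → x ≡ y
    ρ-injective {x} {y} okx oky e = trans (sym (r1-invol E x okx)) (trans (cong (r1 E ∘ r0) e) (r1-invol E y oky))

    iter-injective : ∀ i {x y} → valid x ≡ true → valid y ≡ true → iter ρ i x ≡ iter ρ i y → x ≡ y
    iter-injective zero    okx oky e = e
    iter-injective (suc i) okx oky e = iter-injective i okx oky (ρ-injective (iter-valid i okx) (iter-valid i oky) e)

    position : Flag n → Fin (2 * n * n)
    position (v , w , s) = Fin.combine (Fin.combine (side s) v) w

    position-injective : ∀ x y → position x ≡ position y → x ≡ y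
    position-injective (v , w , s) (v′ , w′ , s′) e
      with sv , refl ← Fin.combine-injective (Fin.combine (side s) v) w (Fin.combine (side s′) v′) w′ e
      with ss , refl ← Fin.combine-injective (side s) v (side s′) v′ sv
      with refl ← side-injective ss = refl

    period : ∀ {x} → valid x ≡ true → ∃ λ P → suc P ≤ 2 * n * n × iter ρ (suc P) x ≡ x
    period {x} ok with i , j , i<j , e ← Fin.pigeonhole {2 * n * n} {suc (2 * n * n)} ℕ.≤-refl (λ i → position (iter ρ (toℕ i) x))
      with o , i+o≡j ← ℕ.m≤n⇒∃[o]m+o≡n i<j =
      o , ℕ.≤-trans (ℕ.m+n≤o⇒n≤o (toℕ i) (subst (_≤ 2 * n * n) (sym i+1+o≡j) (ℕ.≤-pred (Fin.toℕ<n j)))) ℕ.≤-refl ,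
      sym (iter-injective (toℕ i) ok (iter-valid (suc o) ok)
        (trans (position-injective _ _ e) (trans (cong (λ k → iter ρ k x) (sym i+1+o≡j)) (iter-+ ρ (toℕ i) (suc o) x))))
      where
      i+1+o≡j : toℕ i + suc o ≡ toℕ j
      i+1+o≡j = trans (ℕ.+-suc (toℕ i) o) i+o≡j

    iter-multiple : ∀ {P x} → iter ρ P x ≡ x → ∀ q → iter ρ (q * P) x ≡ x
    iter-multiple e zero = refl
    iter-multiple {P} {x} e (suc q) = trans (iter-+ ρ P (q * P) x) (trans (cong (iter ρ P) (iter-multiple e q)) e)

    iter-inverse : ∀ {x} → valid x ≡ true → ∀ i → ∃ λ j → iter ρ j (iter ρ i x) ≡ x
    iter-inverse {x} ok i with P , _ , e ← period ok = i * P , (begin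
        iter ρ (i * P) (iter ρ i x)  ≡⟨ iter-+ ρ (i * P) i x ⟨
        iter ρ (i * P + i) x         ≡⟨ cong (λ k → iter ρ k x) (trans (ℕ.+-comm (i * P) i) (sym (ℕ.*-suc i P))) ⟩
        iter ρ (i * suc P) x         ≡⟨ iter-multiple e i ⟩
        x                            ∎)
      where open ≡-Reasoning

    -- The period of ρ is at most 2n², the number of flags, so reducing the exponent modulo the
    -- period reaches the range searched by `sameFace`.
    iter-bounded : ∀ {x} → valid x ≡ true → ∀ i → ∃ λ j → j < 2 * n * n + 1 × iter ρ j x ≡ iter ρ i x
    iter-bounded {x} ok i with P , P≤ , e ← period ok = i ℕ.% suc P ,
      ℕ.<-≤-trans (ℕ.m%n<n i (suc P)) (ℕ.≤-trans P≤ (ℕ.m≤m+n (2 * n * n) 1)) , sym (begin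
        iter ρ i x                                          ≡⟨ cong (λ k → iter ρ k x) (ℕ.m≡m%n+[m/n]*n i (suc P)) ⟩
        iter ρ (i ℕ.% suc P + (i ℕ./ suc P) * suc P) x      ≡⟨ iter-+ ρ (i ℕ.% suc P) _ x ⟩
        iter ρ (i ℕ.% suc P) (iter ρ ((i ℕ./ suc P) * suc P) x) ≡⟨ cong (iter ρ (i ℕ.% suc P)) (iter-multiple e (i ℕ./ suc P)) ⟩
        iter ρ (i ℕ.% suc P) x                              ∎)
      where open ≡-Reasoning

    -- r0 conjugates ρ to its inverse.
    iter-r0-iter : ∀ i {x} → valid x ≡ true → iter ρ i (r0 (iter ρ i x)) ≡ r0 x
    iter-r0-iter zero    ok = refl
    iter-r0-iter (suc i) {x} ok = begin
        iter ρ (suc i) (r0 (ρ (iter ρ i x)))       ≡⟨ iter-suc ρ i _ ⟩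
        iter ρ i (r0 (r1 E (r1 E (iter ρ i x))))   ≡⟨ cong (iter ρ i ∘ r0) (r1-invol E _ (iter-valid i ok)) ⟩
        iter ρ i (r0 (iter ρ i x))                 ≡⟨ iter-r0-iter i ok ⟩
        r0 x                                       ∎
      where open ≡-Reasoning

    r0-iter : ∀ i {x} → valid x ≡ true → ∃ λ j → r0 (iter ρ i x) ≡ iter ρ j (r0 x)
    r0-iter i {x} ok with j , e ← iter-inverse (valid-r0 (iter ρ i x) (iter-valid i ok)) i =
      j , trans (sym e) (cong (iter ρ j) (iter-r0-iter i ok))

    Orbit : Flag n → Flag n → Set
    Orbit x y = ∃ λ i → y ≡ iter ρ i x ⊎ y ≡ iter ρ i (r0 x)

    orbit-r0 : ∀ {x y} → valid x ≡ true → Orbit x y → Orbit x (r0 y)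
    orbit-r0 ok (i , inj₁ refl) with j , e ← r0-iter i ok = j , inj₂ e
    orbit-r0 {x} ok (i , inj₂ refl) with j , e ← r0-iter i (valid-r0 x ok) = j , inj₁ e

    orbit-ρ : ∀ {x y} → Orbit x y → Orbit x (ρ y)
    orbit-ρ (i , inj₁ refl) = suc i , inj₁ refl
    orbit-ρ (i , inj₂ refl) = suc i , inj₂ refl

    orbit-sym : ∀ {x y} → valid x ≡ true → valid y ≡ true → Orbit x y → Orbit y x
    orbit-sym okx oky (i , inj₁ refl) with j , e ← iter-inverse okx i = j , inj₁ (sym e)
    orbit-sym {x} {y} okx oky (i , inj₂ refl) with j , e ← iter-inverse (valid-r0 x okx) i =
      orbit-r0 oky (j , inj₁ (sym e))

    orbit⇒sameFace : ∀ {x y} → valid x ≡ true → Orbit x y → sameFace G Y E x y ≡ true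
    orbit⇒sameFace {x} ok (i , inj₁ refl) with j , j< , e ← iter-bounded ok i =
      anyN-true j j< (∨-trueˡ (trans (cong (eqFlag (iter ρ i x)) e) (eqFlag-refl (iter ρ i x))))
    orbit⇒sameFace {x} ok (i , inj₂ refl) with j , j< , e ← iter-bounded (valid-r0 x ok) i =
      anyN-true j j< (∨-trueʳ {eqFlag (iter ρ i (r0 x)) (iter ρ j x)}
        (trans (cong (eqFlag (iter ρ i (r0 x))) e) (eqFlag-refl (iter ρ i (r0 x)))))

    sameFace⇒orbit : ∀ x y → sameFace G Y E x y ≡ true → Orbit x y
    sameFace⇒orbit x y e with i , e′ ← anyN-true⁻ (2 * size G * size G + 1) e with ∨-true⁻ {eqFlag y (iter ρ i x)} e′
    ... | inj₁ p = i , inj₁ (eqFlag⇒≡ _ _ p)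
    ... | inj₂ p = i , inj₂ (eqFlag⇒≡ _ _ p)

  -- The flag of least code in its face, spelled as in `faces`.
  canonical : Flag n → Bool
  canonical x = valid x ∧ not (anyFlag n (λ y → validFlag G Y y ∧ (flagCode y <ᵇ flagCode x) ∧ sameFace G Y E x y))

  abstract
    face : Flag n → Flag n → Bool
    face = sameFace G Y E

    face-refl : ∀ {x} → valid x ≡ true → face x x ≡ true
    face-refl ok = orbit⇒sameFace ok (0 , inj₁ refl)

    face-sym : ∀ {x y} → valid x ≡ true → valid y ≡ true → face x y ≡ true → face y x ≡ true
    face-sym {x} {y} okx oky e = orbit⇒sameFace oky (orbit-sym okx oky (sameFace⇒orbit x y e))

    face-r0 : ∀ {x y} → valid x ≡ true → face x (r0 y) ≡ face x y
    face-r0 {x} {y} ok = iff⇒≡ (move (r0 y)) (move y)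
      where
      move : ∀ y → face x y ≡ true → face x (r0 y) ≡ true
      move y e = orbit⇒sameFace ok (orbit-r0 ok (sameFace⇒orbit x y e))

    face-r1 : ∀ {x y} → valid x ≡ true → valid y ≡ true → face x (r1 E y) ≡ face x y
    face-r1 {x} {y} okx oky = iff⇒≡
      (λ e → trans (cong (face x) (sym (r1-invol E y oky))) (move (r1 E y) e)) (move y)
      where
      move : ∀ y → face x y ≡ true → face x (r1 E y) ≡ true
      move y e = orbit⇒sameFace okx (orbit-r0 okx (orbit-ρ (sameFace⇒orbit x y e)))

    canonical-unique : ∀ {x y} → canonical x ≡ true → canonical y ≡ true → face x y ≡ true → x ≡ y
    canonical-unique {x} {y} cx cy e = flagCode-injective x y (ℕ.≤-antisym
        (ℕ.≮⇒≥ (least-code cx (∧-trueˡ cy) e)) (ℕ.≮⇒≥ (least-code cy (∧-trueˡ cx) (face-sym (∧-trueˡ cx) (∧-trueˡ cy) e))))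
      where
      least-code : ∀ {x y} → canonical x ≡ true → valid y ≡ true → face x y ≡ true → ¬ flagCode y < flagCode x
      least-code {x} {y} cx oky e lt = true≢false (anyFlag-true {f = λ y → validFlag G Y y ∧ (flagCode y <ᵇ flagCode x) ∧ sameFace G Y E x y} y (∧-true oky (∧-true (<⇒<ᵇ lt) e))) (not-true⁻ (∧-trueʳ {valid x} cx))

  -- For a colouring g of the faces, this is the 𝔽₂-boundary of the coloured ones: the edges with
  -- different colours on their sides.
  boundary : (Flag n → Bool) → Fin n → Fin n → Bool
  boundary g v w = valid (v , w , false) ∧ (g (v , w , false) xor g (v , w , true))

  boundary-cycle : ∀ {g} → (∀ {x} → valid x ≡ true → g (r0 x) ≡ g x) → (∀ {x} → valid x ≡ true → g (r1 E x) ≡ g x) → Cycle (boundary g)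
  boundary-cycle {g} inv0 inv1 = record
    { symm = λ v w → trans (∧-cong-true (λ ok → cong₂ _xor_ (sym (inv0 {v , w , false} ok)) (sym (inv0 {v , w , true} ok))))
        (cong (_∧ (g (w , v , false) xor g (w , v , true))) (iff⇒≡ (valid-r0 (v , w , false)) (valid-r0 (w , v , false))))
    ; supp = ∧-trueˡ
    ; even = λ v → ∑-corners v g inv1
    }

  private
    isEdge : Fin n × Fin n → Bool
    isEdge (i , j) = Y i ∧ Y j ∧ (toℕ i <ᵇ toℕ j) ∧ adj G i j

    valid⇒edge : ∀ {v w s} → valid (v , w , s) ≡ true → isEdge (v , w) ≡ true ⊎ isEdge (w , v) ≡ true
    valid⇒edge {v} {w} {s} ok with ℕ.<-cmp (toℕ v) (toℕ w) | ∧-trueˡ {Y v} ok | ∧-trueʳ {Y v} ok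
    ... | tri< lt _ _ | yv | t = inj₁ (∧-true {Y v} yv (∧-true {Y w} (∧-trueˡ {Y w} t) (∧-true (<⇒<ᵇ lt) (∧-trueʳ {Y w} t))))
    ... | tri≈ _ eq _ | _ | _ = ⊥-elim (valid-≢ {s = s} ok (Fin.toℕ-injective eq))
    ... | tri> _ _ gt | yv | t = inj₂ (∧-true {Y w} (∧-trueˡ {Y w} t) (∧-true {Y v} yv (∧-true (<⇒<ᵇ gt) (trans (adj-sym G w v) (∧-trueʳ {Y w} t)))))

    edge⇒valid : ∀ {v w} → isEdge (v , w) ≡ true → valid (v , w , false) ≡ true
    edge⇒valid {v} {w} e = ∧-true {Y v} (∧-trueˡ {Y v} e) (∧-true {Y w} (∧-trueˡ {Y w} (∧-trueʳ {Y v} e)) (∧-trueʳ {toℕ v <ᵇ toℕ w} (∧-trueʳ {Y w} (∧-trueʳ {Y v} e))))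

    edge⇒< : ∀ {v w} → isEdge (v , w) ≡ true → toℕ v < toℕ w
    edge⇒< {v} {w} e = <ᵇ⇒< (toℕ v) (toℕ w) (∧-trueˡ (∧-trueʳ {Y w} (∧-trueʳ {Y v} e)))

    isEdge-once : ∀ {b} → Cycle b → ∀ v w → (isEdge (v , w) xor isEdge (w , v)) ∧ b v w ≡ b v w
    isEdge-once {b} cb v w with bool-split (b v w)
    ... | inj₂ bf rewrite bf = ∧-zeroʳ _
    ... | inj₁ bt rewrite bt = trans (∧-identityʳ _) (once (valid⇒edge {s = false} (supp cb bt)))
      where
      once : isEdge (v , w) ≡ true ⊎ isEdge (w , v) ≡ true → isEdge (v , w) xor isEdge (w , v) ≡ true
      once (inj₁ e) = cong₂ _xor_ e (¬-not (λ e′ → ℕ.<-asym (edge⇒< {v} {w} e) (edge⇒< {w} {v} e′)))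
      once (inj₂ e) = cong₂ _xor_ (¬-not (λ e′ → ℕ.<-asym (edge⇒< {w} {v} e) (edge⇒< {v} {w} e′))) e

    edgeList : List (Fin n × Fin n)
    edgeList = filterᵇ isEdge (cartesianProduct (allFin n) (allFin n))

    -- The pairing is the degree of u in b. Since `edgeList` holds each edge in one direction, the
    -- degree is assembled from both ends by `isEdge-once`.
    star-⊥ : ∀ {b} → Cycle b → ∀ u → ⨁ edgeList (λ e → b (proj₁ e) (proj₂ e) ∧ ((proj₁ e == u) xor (proj₂ e == u))) ≡ false
    star-⊥ {b} cb u = begin
        ⨁ edgeList (λ e → b (proj₁ e) (proj₂ e) ∧ ((proj₁ e == u) xor (proj₂ e == u)))
      ≡⟨ trans (⨁-filter isEdge (cartesianProduct (allFin n) (allFin n)) _) (⨁-product (allFin n) (allFin n) _) ⟩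
        ∑ (λ v → ∑ (λ w → isEdge (v , w) ∧ (b v w ∧ ((v == u) xor (w == u)))))
      ≡⟨ ∑-cong n (λ v → trans (∑-cong n (λ w →
           solve 4 (λ e b p q → e :* (b :* (p :+ q)) := (p :* (e :* b)) :+ (q :* (e :* b))) refl (isEdge (v , w)) (b v w) (v == u) (w == u)))
           (trans (∑-xor n _ _) (cong₂ _xor_ (∑-∧ˡ n (v == u) _) (∑-pick u _)))) ⟩
        ∑ (λ v → ((v == u) ∧ ∑ (λ w → isEdge (v , w) ∧ b v w)) xor (isEdge (v , u) ∧ b v u))
      ≡⟨ trans (∑-xor n _ _) (cong (_xor ∑ (λ v → isEdge (v , u) ∧ b v u)) (∑-pick u _)) ⟩
        ∑ (λ w → isEdge (u , w) ∧ b u w) xor ∑ (λ v → isEdge (v , u) ∧ b v u)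
      ≡⟨ ∑-xor n _ _ ⟨
        ∑ (λ w → (isEdge (u , w) ∧ b u w) xor (isEdge (w , u) ∧ b w u))
      ≡⟨ ∑-cong n (λ w → trans (cong (λ c → (isEdge (u , w) ∧ b u w) xor (isEdge (w , u) ∧ c)) (symm cb w u))
           (trans (sym (∧-distribʳ-xor (b u w) (isEdge (u , w)) (isEdge (w , u)))) (isEdge-once cb u w))) ⟩
        ∑ (b u)
      ≡⟨ even cb u ⟩
        false ∎
      where
      open ≡-Reasoning
      open xor-∧-Solver

    isolated? : Fin n → Bool
    isolated? v = Y v ∧ not (anyF n (λ w → Y w ∧ adj G v w))

    isolated⇒root : ∀ {v} → isolated? v ≡ true → root G Y v ≡ true
    isolated⇒root {v} iso = ∧-true (∧-trueˡ iso) (not-true (¬-not bad))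
      where
      alone : ∀ {w} → Walk G Y w v → w ≡ v
      alone (start _) = refl
      alone (step {w} p a _) = ⊥-elim (true≢false (∧-true (walk-target p) (trans (adj-sym G v w) a)) (anyF-false⁻ (not-true⁻ (∧-trueʳ {Y v} iso)) w))
      bad : ¬ anyF n (λ w → (toℕ w <ᵇ toℕ v) ∧ conn G Y w v) ≡ true
      bad e with w , e′ ← anyF-true⁻ n e with refl ← alone (conn⇒walk G Y {w} {v} (∧-trueʳ {toℕ w <ᵇ toℕ v} e′)) =
        ℕ.<-irrefl refl (<ᵇ⇒< (toℕ w) (toℕ w) (∧-trueˡ e′))

    neighbour : ∀ v → (∃ λ w → w ∈ allFin n × valid (v , w , false) ≡ true) ⊎ (∀ {w} → w ∈ allFin n → valid (v , w , false) ≡ false)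
    neighbour v = search (λ w → valid (v , w , false)) (allFin n)

    -- One reference flag at r. A root without flags is isolated, and its face has a vector of its
    -- own.
    at-root : (Flag n → Bool) → Fin n → Bool
    at-root g r with neighbour r
    ... | inj₁ (w , _) = g (r , w , false)
    ... | inj₂ _       = false

  module _ {I : Set} (_≟_ : DecidableEquality I) {is : List I} (uis : Unique is)
    (a : I → Fin n → Fin n → Bool) (ca : ∀ {i} → i ∈ is → Cycle (a i))
    {g : ℕ} (bound : 2 * components G Y + edges G Y ≤ g + ∣ Y ∣ₛ + faces G Y E) (g<is : g < length is) where

    private
      X = I ⊎ (Flag n ⊎ Fin n)
      Coordinate = (Fin n × Fin n) ⊎ Fin n

      faceList = filterᵇ canonical (flags n)
      isoList = filterᵇ isolated? (allFin n)
      rootList = filterᵇ (root G Y) (allFin n)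

      nonroot : Fin n → Bool
      nonroot u = Y u ∧ not (not (anyF n (λ w → (toℕ w <ᵇ toℕ u) ∧ conn G Y w u)))

      nonrootList = filterᵇ nonroot (allFin n)

      xs : List X
      xs = map inj₁ is ++ map inj₂ (map inj₁ faceList ++ map inj₂ isoList)

      es : List Coordinate
      es = map inj₁ edgeList ++ map inj₂ rootList

      disjoint-inj : ∀ {A B : Set} (as : List A) (bs : List B) → Disjoint (map {B = A ⊎ B} inj₁ as) (map inj₂ bs)
      disjoint-inj as bs (p , q) with _ , _ , refl ← ∈-map⁻ inj₁ p with ∈-map⁻ inj₂ q
      ... | _ , _ , ()

      unique-⊎ : ∀ {A B : Set} {as : List A} {bs : List B} → Unique as → Unique bs → Unique (map {B = A ⊎ B} inj₁ as ++ map inj₂ bs)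
      unique-⊎ {as = as} {bs} ua ub = Unique.++⁺ (Unique.map⁺ Sum.inj₁-injective ua) (Unique.map⁺ Sum.inj₂-injective ub) (disjoint-inj as bs)

      uxs : Unique xs
      uxs = unique-⊎ uis (unique-⊎ (unique-filterᵇ canonical (unique-flags n)) (unique-filterᵇ isolated? (Unique.allFin⁺ n)))

      length-⊎ : ∀ {A B : Set} (as : List A) (bs : List B) → length (map {B = A ⊎ B} inj₁ as ++ map inj₂ bs) ≡ length as + length bs
      length-⊎ as bs = trans (List.length-++ (map inj₁ as)) (cong₂ _+_ (List.length-map inj₁ as) (List.length-map inj₂ bs))

      ⨁-⊎ : ∀ {A B : Set} (as : List A) (bs : List B) f → ⨁ (map inj₁ as ++ map inj₂ bs) f ≡ ⨁ as (f ∘ inj₁) xor ⨁ bs (f ∘ inj₂)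
      ⨁-⊎ as bs f = trans (⨁-++ (map inj₁ as) (map inj₂ bs) f) (cong₂ _xor_ (⨁-map inj₁ as f) (⨁-map inj₂ bs f))

      star : Fin n → Coordinate → Bool
      star u (inj₁ (v , w)) = (v == u) xor (w == u)
      star u (inj₂ _)       = false

      -- One vector per given cycle, per face and per isolated vertex (which is a face of its own); the extra coordinates,
      -- one per component, kill the sum of all faces of a component.
      vector : X → Coordinate → Bool
      vector (inj₁ i)        (inj₁ (v , w)) = a i v w
      vector (inj₁ i)        (inj₂ r)       = false
      vector (inj₂ (inj₁ x)) (inj₁ (v , w)) = boundary (face x) v w
      vector (inj₂ (inj₁ x)) (inj₂ r)       = at-root (face x) r
      vector (inj₂ (inj₂ u)) (inj₁ _)       = false
      vector (inj₂ (inj₂ u)) (inj₂ r)       = r == u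

      face-cycle : ∀ {x} → valid x ≡ true → Cycle (boundary (face x))
      face-cycle {x} okx = boundary-cycle {face x} (λ {y} _ → face-r0 {x} {y} okx) (λ {y} → face-r1 {x} {y} okx)

      orthogonal : ∀ {x u} → x ∈ xs → u ∈ nonrootList → ⨁ es (λ e → vector x e ∧ star u e) ≡ false
      orthogonal {x} {u} x∈ _ = trans (⨁-⊎ edgeList rootList _) (cong₂ _xor_ (edge-part x x∈) (⨁-zero rootList (λ r → ∧-zeroʳ (vector x (inj₂ r)))))
        where
        edge-part : ∀ x → x ∈ xs → ⨁ edgeList (λ e → vector x (inj₁ e) ∧ star u (inj₁ e)) ≡ false
        edge-part x x∈ with ∈-++⁻ (map inj₁ is) x∈
        ... | inj₁ p with i , i∈ , refl ← ∈-map⁻ inj₁ p = star-⊥ (ca i∈) u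
        ... | inj₂ p with _ , q , refl ← ∈-map⁻ inj₂ p with ∈-++⁻ (map inj₁ faceList) q
        ...   | inj₁ q′ with y , y∈ , refl ← ∈-map⁻ inj₁ q′ = star-⊥ (face-cycle (∧-trueˡ (proj₂ (∈-filterᵇ⁻ canonical {flags n} y∈)))) u
        ...   | inj₂ q′ with v , v∈ , refl ← ∈-map⁻ inj₂ q′ = ⨁-zero edgeList (λ _ → refl)

      along-walks : ∀ (h : Fin n → Bool) → (∀ {v w} → isEdge (v , w) ≡ true → h v ≡ h w) → ∀ {u v} → Walk G Y u v → h u ≡ h v
      along-walks h e (start _) = refl
      along-walks h e (step {w} {v} p adj≡ y) with valid⇒edge {w} {v} {false} (∧-true (walk-target p) (∧-true y adj≡))
      ... | inj₁ q = trans (along-walks h e p) (e q)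
      ... | inj₂ q = trans (along-walks h e p) (sym (e q))

      -- The stars of a whole component add up to zero, which is why the root is left out: the
      -- coefficients of a vanishing combination agree along edges, and at the root they are 0.
      independent : Independent nonrootList es star
      independent c zer {u} u∈ = conclude (∈-filterᵇ⁻ nonroot {allFin n} u∈)
        where
        h : Fin n → Bool
        h v = nonroot v ∧ c v
        expand : ∀ v w → ⨁ nonrootList (λ u → c u ∧ ((v == u) xor (w == u))) ≡ h v xor h w
        expand v w = trans (⨁-filter nonroot (allFin n) _) (trans (∑-cong n (λ u →
            solve 4 (λ d c p q → d :* (c :* (p :+ q)) := (p :* (d :* c)) :+ (q :* (d :* c))) refl (nonroot u) (c u) (v == u) (w == u)))
            (trans (∑-xor n _ _) (cong₂ _xor_ (∑-pick′ v h) (∑-pick′ w h))))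
          where open xor-∧-Solver
        edge-eq : ∀ {v w} → isEdge (v , w) ≡ true → h v ≡ h w
        edge-eq {v} {w} e = xor-false⇒≡ (trans (sym (expand v w)) (zer (∈-++⁺ˡ (∈-map⁺ inj₁ (∈-filterᵇ⁺ isEdge (∈-cartesianProduct⁺ (∈-allFin v) (∈-allFin w)) e)))))
        root-zero : ∀ {r} → root G Y r ≡ true → h r ≡ false
        root-zero {r} ρr = cong (_∧ c r) (trans (cong (λ b → Y r ∧ not b) (∧-trueʳ {Y r} ρr)) (∧-zeroʳ (Y r)))
        conclude : u ∈ allFin n × nonroot u ≡ true → c u ≡ false
        conclude (_ , nr) with r , ρr , cr ← root-exists G Y (∧-trueˡ nr) =
          trans (sym (cong (_∧ c u) nr)) (trans (sym (along-walks h edge-eq (conn⇒walk G Y cr))) (root-zero ρr))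

      -- Euler's formula as a dimension count: there are E + c coordinates, |is| + F vectors and V -
      -- c stars, while 2c + E ≤ g + V + F < |is| + V + F. Adding c to both sides avoids
      -- subtraction.
      counts : length es < length xs + length nonrootList
      counts = ℕ.+-cancelˡ-< c _ _ (begin-strict
          c + length es
        ≡⟨ cong (c +_) (trans (length-⊎ edgeList rootList) (cong₂ _+_ (sym edges≡) (sym c≡))) ⟩
          c + (e + c)
        ≡⟨ trans (cong (c +_) (ℕ.+-comm e c)) (trans (sym (ℕ.+-assoc c c e)) (cong (λ d → c + d + e) (sym (ℕ.+-identityʳ c)))) ⟩
          2 * c + e
        ≤⟨ bound ⟩
          g + ∣ Y ∣ₛ + faces G Y E
        <⟨ ℕ.+-monoˡ-< (faces G Y E) (ℕ.+-monoˡ-< ∣ Y ∣ₛ g<is) ⟩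
          length is + ∣ Y ∣ₛ + faces G Y E
        ≡⟨ cong₂ (λ V F → length is + V + F) (sym split) (cong₂ _+_ (countFlag≡length n canonical) (countF≡length n isolated?)) ⟩
          length is + (c + length nonrootList) + (length faceList + length isoList)
        ≡⟨ solve 4 (λ l c m f → l :+ (c :+ m) :+ f := c :+ ((l :+ f) :+ m)) refl (length is) c (length nonrootList) (length faceList + length isoList) ⟩
          c + (length is + (length faceList + length isoList) + length nonrootList)
        ≡⟨ cong (λ l → c + (l + length nonrootList)) (trans (length-⊎ is _) (cong (length is +_) (length-⊎ faceList isoList))) ⟨
          c + (length xs + length nonrootList) ∎)
        where
        open ℕ.≤-Reasoning
        open +-*-Solver
        c = components G Y
        e = edges G Y
        c≡ : c ≡ length rootList
        c≡ = countF≡length n (root G Y)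
        edges≡ : e ≡ length edgeList
        edges≡ = trans (sumF-cong n (λ i → countF≡length n (λ j → isEdge (i , j)))) (sumF≡length n isEdge (allFin n))
        split : c + length nonrootList ≡ ∣ Y ∣ₛ
        split = trans (cong (c +_) (sym (countF≡length n nonroot)))
          (countF-split n Y (λ u → not (anyF n (λ w → (toℕ w <ᵇ toℕ u) ∧ conn G Y w u))))

      module Combination (c : X → Bool) (zer : ∀ {e} → e ∈ es → ⨁ xs (λ x → c x ∧ vector x e) ≡ false) where
        open ≡-Reasoning
        c₁ = λ i → c (inj₁ i)
        c₂ = λ x → c (inj₂ (inj₁ x))
        c₃ = λ u → c (inj₂ (inj₂ u))
        f : Flag n → Bool
        f x = ⨁ faceList (λ y → c₂ y ∧ face y x)
        canonical-∈ : ∀ {y} → y ∈ faceList → canonical y ≡ true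
        canonical-∈ y∈ = proj₂ (∈-filterᵇ⁻ canonical {flags n} y∈)
        f-r0 : ∀ {x} → valid x ≡ true → f (r0 x) ≡ f x
        f-r0 {x} ok = ⨁-cong∈ faceList (λ {y} y∈ → cong (c₂ y ∧_) (face-r0 {y} {x} (∧-trueˡ (canonical-∈ y∈))))
        f-r1 : ∀ {x} → valid x ≡ true → f (r1 E x) ≡ f x
        f-r1 {x} ok = ⨁-cong∈ faceList (λ {y} y∈ → cong (c₂ y ∧_) (face-r1 {y} {x} (∧-trueˡ (canonical-∈ y∈)) ok))
        A : Fin n → Fin n → Bool
        A v w = ⨁ is (λ i → c₁ i ∧ a i v w)
        combination : ∀ e → e ∈ es → (⨁ is (λ i → c₁ i ∧ vector (inj₁ i) e) xor
          (⨁ faceList (λ y → c₂ y ∧ vector (inj₂ (inj₁ y)) e) xor ⨁ isoList (λ u → c₃ u ∧ vector (inj₂ (inj₂ u)) e))) ≡ false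
        combination e e∈ = trans (sym (trans (⨁-⊎ is (map inj₁ faceList ++ map inj₂ isoList) _)
          (cong (⨁ is (λ i → c₁ i ∧ vector (inj₁ i) e) xor_) (⨁-⊎ faceList isoList _)))) (zer e∈)
        boundary-sum : ∀ {v w} → valid (v , w , false) ≡ true → ⨁ faceList (λ y → c₂ y ∧ boundary (face y) v w) ≡ f (v , w , false) xor f (v , w , true)
        boundary-sum {v} {w} ok = trans (⨁-cong faceList (λ y → trans (cong (λ b → c₂ y ∧ (b ∧ (face y (v , w , false) xor face y (v , w , true)))) ok)
          (∧-distribˡ-xor (c₂ y) (face y (v , w , false)) (face y (v , w , true))))) (⨁-xor faceList _ _)
        edge-eq : ∀ {v w} → isEdge (v , w) ≡ true → A v w ≡ f (v , w , false) xor f (v , w , true)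
        edge-eq {v} {w} e = xor-false⇒≡ (begin
            A v w xor (f (v , w , false) xor f (v , w , true))
          ≡⟨ cong (A v w xor_) (sym (trans (cong₂ _xor_ (boundary-sum (edge⇒valid {v} {w} e)) (⨁-zero isoList (λ u → ∧-zeroʳ (c₃ u)))) (xor-identityʳ _))) ⟩
            A v w xor (⨁ faceList (λ y → c₂ y ∧ boundary (face y) v w) xor ⨁ isoList (λ u → c₃ u ∧ false))
          ≡⟨ combination (inj₁ (v , w)) (∈-++⁺ˡ (∈-map⁺ inj₁ (∈-filterᵇ⁺ isEdge (∈-cartesianProduct⁺ (∈-allFin v) (∈-allFin w)) e))) ⟩
            false ∎)
        sides : ∀ {v w} → valid (v , w , false) ≡ true → A v w ≡ f (v , w , false) xor f (v , w , true)
        sides {v} {w} ok with valid⇒edge {v} {w} {false} ok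
        ... | inj₁ e = edge-eq e
        ... | inj₂ e = begin
            A v w                                       ≡⟨ ⨁-cong∈ is (λ {i} i∈ → cong (c₁ i ∧_) (symm (ca i∈) v w)) ⟩
            A w v                                       ≡⟨ edge-eq e ⟩
            f (w , v , false) xor f (w , v , true)      ≡⟨ cong₂ _xor_ (f-r0 {v , w , false} ok) (f-r0 {v , w , true} ok) ⟩
            f (v , w , false) xor f (v , w , true)      ∎
        f-r2 : ∀ {v w s} → valid (v , w , s) ≡ true → f (v , w , not s) ≡ f (v , w , s) xor A v w
        f-r2 {v} {w} {false} ok = trans (solve 2 (λ p q → q := p :+ (p :+ q)) refl (f (v , w , false)) (f (v , w , true))) (cong (f (v , w , false) xor_) (sym (sides ok)))
          where open xor-∧-Solver
        f-r2 {v} {w} {true} ok = trans (solve 2 (λ p q → p := q :+ (p :+ q)) refl (f (v , w , false)) (f (v , w , true))) (cong (f (v , w , true) xor_) (sym (sides ok)))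
          where open xor-∧-Solver

        -- Faces alone satisfy no relation. With A = 0 the colouring f does not change across edges,
        -- so it is constant on components. The coordinate of the root makes it 0 there, or kills
        -- the coefficient of an isolated root. As distinct canonical flags lie in distinct faces,
        -- every coefficient vanishes.
        module AllZero (none : ∀ {i} → i ∈ is → c₁ i ≡ false) where
          A≡false : ∀ v w → A v w ≡ false
          A≡false v w = ⨁-zero∈ is (λ {i} i∈ → cong (_∧ a i v w) (none i∈))
          f-inv : ∀ v → InvariantAt v f
          f-inv v = potential-zero {a = A} (record { pot-r1 = f-r1 ; pot-r2 = λ {v} {w} {s} → f-r2 {v} {w} {s} }) (A≡false v)
          root-eq : ∀ r → root G Y r ≡ true → at-root f r xor ⨁ isoList (λ u → c₃ u ∧ (r == u)) ≡ false
          root-eq r ρr = trans (cong (_xor ⨁ isoList (λ u → c₃ u ∧ (r == u))) (sym at-root-sum)) (trans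
            (sym (cong (_xor (⨁ faceList (λ y → c₂ y ∧ at-root (face y) r) xor ⨁ isoList (λ u → c₃ u ∧ (r == u)))) (⨁-zero is (λ i → ∧-zeroʳ (c₁ i)))))
            (combination (inj₂ r) (∈-++⁺ʳ (map inj₁ edgeList) (∈-map⁺ inj₂ (∈-filterᵇ⁺ (root G Y) (∈-allFin r) ρr)))))
            where
            at-root-sum : ⨁ faceList (λ y → c₂ y ∧ at-root (face y) r) ≡ at-root f r
            at-root-sum with neighbour r
            ... | inj₁ _ = refl
            ... | inj₂ _ = ⨁-zero faceList (λ y → ∧-zeroʳ (c₂ y))
          root-flags : ∀ {r x} → root G Y r ≡ true → proj₁ x ≡ r → valid x ≡ true → f x ≡ false
          root-flags {r} {x@(.r , w , s)} ρr refl ok = trans (value (neighbour r) refl) (trans (sym (xor-identityʳ _)) (trans (cong (at-root f r xor_) (sym no-iso)) (root-eq r ρr)))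
            where
            value : ∀ nb → neighbour r ≡ nb → f x ≡ at-root f r
            value (inj₁ (w′ , _ , ok′)) e rewrite e = invariant-const (f-inv r) refl refl ok ok′
            value (inj₂ none′) e = ⊥-elim (true≢false ok (none′ (∈-allFin w)))
            no-iso : ⨁ isoList (λ u → c₃ u ∧ (r == u)) ≡ false
            no-iso = ⨁-zero∈ isoList (λ {u} u∈ → trans (cong (c₃ u ∧_) (≢⇒== (λ r≡u → not-iso (subst (λ v → isolated? v ≡ true) (sym r≡u) (proj₂ (∈-filterᵇ⁻ isolated? {allFin n} u∈)))))) (∧-zeroʳ (c₃ u)))
              where
              not-iso : ¬ isolated? r ≡ true
              not-iso iso = true≢false (∧-trueʳ {Y r} ok) (anyF-false⁻ (not-true⁻ (∧-trueʳ {Y r} iso)) w)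
          along : ∀ {r v} → root G Y r ≡ true → Walk G Y r v → ∀ {x} → proj₁ x ≡ v → valid x ≡ true → f x ≡ false
          along ρr (start _) at ok = root-flags ρr at ok
          along ρr (step {w} {v} p adj≡ y) {x} refl ok = begin
              f x               ≡⟨ invariant-const (f-inv v) refl refl ok (valid-r0 (w , v , false) wv) ⟩
              f (v , w , false) ≡⟨ f-r0 {w , v , false} wv ⟩
              f (w , v , false) ≡⟨ along ρr p refl wv ⟩
              false             ∎
            where
            wv : valid (w , v , false) ≡ true
            wv = ∧-true (walk-target p) (∧-true y adj≡)
          f≡false : ∀ {x} → valid x ≡ true → f x ≡ false
          f≡false {x@(v , _)} ok with r , ρr , cr ← root-exists G Y {v} (∧-trueˡ ok) = along ρr (conn⇒walk G Y cr) {x} refl ok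
          c₂≡false : ∀ {y} → y ∈ faceList → c₂ y ≡ false
          c₂≡false {y} y∈ = begin
              c₂ y
            ≡⟨ ⨁-pick _≟ᶠ_ (unique-filterᵇ canonical (unique-flags n)) y∈ c₂ ⟨
              ⨁ faceList (λ z → does (z ≟ᶠ y) ∧ c₂ z)
            ≡⟨ ⨁-cong∈ faceList (λ {z} z∈ → trans (∧-comm _ (c₂ z)) (cong (c₂ z ∧_) (iff⇒≡
                 (λ e → trans (cong (face z) (sym (does⇒≡ _≟ᶠ_ {z} {y} e))) (face-refl (∧-trueˡ (canonical-∈ z∈))))
                 (λ e → dec-true (z ≟ᶠ y) (canonical-unique (canonical-∈ z∈) (canonical-∈ y∈) e))))) ⟩
              f y
            ≡⟨ f≡false (∧-trueˡ (canonical-∈ y∈)) ⟩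
              false ∎
          c₃≡false : ∀ {u} → u ∈ isoList → c₃ u ≡ false
          c₃≡false {u} u∈ with iso ← proj₂ (∈-filterᵇ⁻ isolated? {allFin n} u∈) = begin
              c₃ u
            ≡⟨ ⨁-pick Fin._≟_ (unique-filterᵇ isolated? (Unique.allFin⁺ n)) u∈ c₃ ⟨
              ⨁ isoList (λ v → (v == u) ∧ c₃ v)
            ≡⟨ ⨁-cong isoList (λ v → trans (∧-comm (v == u) (c₃ v)) (cong (c₃ v ∧_) (==-sym v u))) ⟩
              ⨁ isoList (λ v → c₃ v ∧ (u == v))
            ≡⟨ cong (_xor ⨁ isoList (λ v → c₃ v ∧ (u == v))) (sym (value (neighbour u) refl iso)) ⟩
              at-root f u xor ⨁ isoList (λ v → c₃ v ∧ (u == v))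
            ≡⟨ root-eq u (isolated⇒root iso) ⟩
              false ∎
            where
            value : ∀ nb → neighbour u ≡ nb → isolated? u ≡ true → at-root f u ≡ false
            value (inj₁ (w , _ , ok)) e iso = ⊥-elim (true≢false (∧-trueʳ {Y u} ok) (anyF-false⁻ (not-true⁻ (∧-trueʳ {Y u} iso)) w))
            value (inj₂ _) e iso rewrite e = refl
          absurd : (∃ λ x → x ∈ xs × c x ≡ true) → ⊥
          absurd (x , x∈ , cx) with ∈-++⁻ (map inj₁ is) x∈
          ... | inj₁ p with i , i∈ , refl ← ∈-map⁻ inj₁ p = true≢false cx (none i∈)
          ... | inj₂ p with _ , q , refl ← ∈-map⁻ inj₂ p with ∈-++⁻ (map inj₁ faceList) q
          ...   | inj₁ q′ with y , y∈ , refl ← ∈-map⁻ inj₁ q′ = true≢false cx (c₂≡false y∈)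
          ...   | inj₂ q′ with u , u∈ , refl ← ∈-map⁻ inj₂ q′ = true≢false cx (c₃≡false u∈)

        nonzero : (∃ λ x → x ∈ xs × c x ≡ true) → ∃ λ i → i ∈ is × c₁ i ≡ true
        nonzero nz with search c₁ is
        ... | inj₁ found = found
        ... | inj₂ none = ⊥-elim (AllZero.absurd none nz)

    -- The cycle space modulo face boundaries has dimension at most the Euler genus.
    bounding-combination : Σ (I → Bool) λ c → (∃ λ i → i ∈ is × c i ≡ true) × Σ (Flag n → Bool) λ f →
      (∀ {x} → valid x ≡ true → f (r0 x) ≡ f x) × Potential (λ v w → ⨁ is (λ i → c i ∧ a i v w)) f
    bounding-combination =
      let c , nz , zer = dependent-⊥ (Sum.≡-dec _≟_ (Sum.≡-dec _≟ᶠ_ Fin._≟_)) Fin._≟_ uxs es vector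
                           (unique-filterᵇ nonroot (Unique.allFin⁺ n)) star independent orthogonal counts
          open Combination c zer
      in c₁ , nonzero nz , f , f-r0 , record { pot-r1 = f-r1 ; pot-r2 = λ {v} {w} {s} → f-r2 {v} {w} {s} }

-- Locating a bag

-- The n - 2 equations σ a ≡ σ b given by the other edges leave room for a nonzero σ vanishing at s.
tree-cut : ∀ {T} → IsTree T → ∀ {s t} → adj T s t ≡ true → Σ (Fin (size T) → Bool) λ σ → σ s ≢ σ t ×
  (∀ {a b} → adj T a b ≡ true → ¬ (a ≡ s × b ≡ t) → ¬ (a ≡ t × b ≡ s) → σ a ≡ σ b)
tree-cut {T} (1≤n , connected , e≡) {s} {t} st =
  let c , (x , _ , cx) , zer = dependent Fin._≟_ (Unique.allFin⁺ n) es z small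
  in c , (λ cs≡ct → nonconstant c zer x cx cs≡ct) , edge-const c zer
  where
  n = size T
  isEdge keep : Fin n × Fin n → Bool
  isEdge (a , b) = true ∧ true ∧ (toℕ a <ᵇ toℕ b) ∧ adj T a b
  _≟ₚ_ : DecidableEquality (Fin n × Fin n)
  _≟ₚ_ = Product.≡-dec Fin._≟_ Fin._≟_
  keep p = isEdge p ∧ not (does (p ≟ₚ (s , t)) ∨ does (p ≟ₚ (t , s)))
  pairs keepList : List (Fin n × Fin n)
  pairs = cartesianProduct (allFin n) (allFin n)
  keepList = filterᵇ keep pairs
  Coordinate = (Fin n × Fin n) ⊎ (Fin 1)
  es : List Coordinate
  es = inj₂ zero ∷ map inj₁ keepList
  z : Fin n → Coordinate → Bool
  z v (inj₁ (a , b)) = (a == v) xor (b == v)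
  z v (inj₂ _)       = s == v
  ends≢ : ∀ {a b} → adj T a b ≡ true → a ≢ b
  ends≢ {a} e refl = true≢false e (adj-irrefl T a)
  ordered : ∀ {a b} → adj T a b ≡ true → isEdge (a , b) ≡ true ⊎ isEdge (b , a) ≡ true
  ordered {a} {b} e with ℕ.<-cmp (toℕ a) (toℕ b)
  ... | tri< lt _ _ = inj₁ (∧-true (<⇒<ᵇ lt) e)
  ... | tri≈ _ eq _ = ⊥-elim (ends≢ e (Fin.toℕ-injective eq))
  ... | tri> _ _ gt = inj₂ (∧-true (<⇒<ᵇ gt) (trans (adj-sym T b a) e))
  st-edge : ∃ λ p → isEdge p ≡ true × keep p ≡ false
  st-edge with ordered st
  ... | inj₁ e = (s , t) , e , trans (cong (λ d → isEdge (s , t) ∧ not (d ∨ does ((s , t) ≟ₚ (t , s)))) (dec-true ((s , t) ≟ₚ (s , t)) refl)) (∧-zeroʳ (isEdge (s , t)))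
  ... | inj₂ e = (t , s) , e , trans (cong (λ d → isEdge (t , s) ∧ not d) (∨-trueʳ {does ((t , s) ≟ₚ (s , t))} (dec-true ((t , s) ≟ₚ (t , s)) refl))) (∧-zeroʳ (isEdge (t , s)))
  fewer : suc (length keepList) ≤ length (filterᵇ isEdge pairs)
  fewer with p , pe , pk ← st-edge = unique-⊆-length {xs = p ∷ keepList}
      (All.tabulate (λ q∈ p≡q → true≢false (proj₂ (∈-filterᵇ⁻ keep {pairs} q∈)) (trans (cong keep (sym p≡q)) pk)) ∷
        unique-filterᵇ keep (Unique.cartesianProduct⁺ (Unique.allFin⁺ n) (Unique.allFin⁺ n)))
      λ { (here refl) → ∈-filterᵇ⁺ isEdge (∈-cartesianProduct⁺ (∈-allFin _) (∈-allFin _)) pe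
        ; (there q∈) → let q∈′ , k = ∈-filterᵇ⁻ keep {pairs} q∈ in ∈-filterᵇ⁺ isEdge q∈′ (∧-trueˡ k) }
  small : length es < length (allFin n)
  small = begin-strict
      suc (length (map inj₁ keepList))   ≡⟨ cong suc (List.length-map inj₁ keepList) ⟩
      suc (length keepList)              ≤⟨ fewer ⟩
      length (filterᵇ isEdge pairs)      ≡⟨ trans (sumF-cong n (λ i → countF≡length n (λ j → isEdge (i , j)))) (sumF≡length n isEdge (allFin n)) ⟨
      edges T allV                       ≡⟨ e≡ ⟩
      n ∸ 1                              <⟨ ℕ.∸-monoʳ-< {n} (s≤s z≤n) 1≤n ⟩
      n                                  ≡⟨ List.length-tabulate (λ i → i) ⟨
      length (allFin n)                  ∎
    where open ℕ.≤-Reasoning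
  module _ (c : Fin n → Bool) (zer : ∀ {e} → e ∈ es → ⨁ (allFin n) (λ v → c v ∧ z v e) ≡ false) where
    at : ∀ a → ∑ (λ v → c v ∧ (a == v)) ≡ c a
    at a = trans (∑-cong n (λ v → ∧-comm (c v) (a == v))) (∑-pick′ a c)
    kept : ∀ {a b} → keep (a , b) ≡ true → c a ≡ c b
    kept {a} {b} k = xor-false⇒≡ (trans (sym (trans (∑-cong n (λ v → ∧-distribˡ-xor (c v) (a == v) (b == v)))
      (trans (∑-xor n _ _) (cong₂ _xor_ (at a) (at b)))))
      (zer (there (∈-map⁺ inj₁ (∈-filterᵇ⁺ keep (∈-cartesianProduct⁺ (∈-allFin a) (∈-allFin b)) k)))))
    not-st : ∀ {a b} → ¬ (a ≡ s × b ≡ t) → ¬ (a ≡ t × b ≡ s) → not (does ((a , b) ≟ₚ (s , t)) ∨ does ((a , b) ≟ₚ (t , s))) ≡ true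
    not-st {a} {b} p q = not-true (cong₂ _∨_ (dec-false ((a , b) ≟ₚ (s , t)) (p ∘ Product.,-injective)) (dec-false ((a , b) ≟ₚ (t , s)) (q ∘ Product.,-injective)))
    edge-const : ∀ {a b} → adj T a b ≡ true → ¬ (a ≡ s × b ≡ t) → ¬ (a ≡ t × b ≡ s) → c a ≡ c b
    edge-const {a} {b} e p q with ordered e
    ... | inj₁ o = kept (∧-true o (not-st p q))
    ... | inj₂ o = sym (kept (∧-true o (not-st (λ { (x , y) → q (y , x) }) (λ { (x , y) → p (y , x) }))))
    nonconstant : ∀ x → c x ≡ true → c s ≡ c t → ⊥
    nonconstant x cx cs≡ct = true≢false cx (trans (sym (const (conn⇒walk T allV (connected s x)))) (trans (sym (at s)) (zer (here refl))))
      where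
      const : ∀ {a b} → Walk T allV a b → c a ≡ c b
      const (start _) = refl
      const (step {a} {b} p e _) with a Fin.≟ s | b Fin.≟ t
      ... | yes refl | yes refl = trans (const p) cs≡ct
      ... | yes a≡s  | no b≢t   = trans (const p) (edge-const e (b≢t ∘ proj₂) (λ { (a≡t , b≡s) → ends≢ e (trans a≡s (sym b≡s)) }))
      ... | no a≢s   | _ with a Fin.≟ t | b Fin.≟ s
      ...   | yes refl | yes refl = trans (const p) (sym cs≡ct)
      ...   | yes _    | no b≢s   = trans (const p) (edge-const e (a≢s ∘ proj₁) (b≢s ∘ proj₂))
      ...   | no a≢t   | _        = trans (const p) (edge-const e (a≢s ∘ proj₁) (a≢t ∘ proj₁))

walk-enter : ∀ {T} (P : Sub (size T)) {a b} → Walk T allV a b → P a ≡ false → P b ≡ true →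
  ∃ λ s → ∃ λ t → adj T s t ≡ true × P t ≡ true × Walk T (λ x → not (P x)) a s
walk-enter P (start _) ¬Pa Pa = ⊥-elim (true≢false Pa ¬Pa)
walk-enter {T} P {a} {b} w ¬Pa Pb = go w Pb
  where
  go : ∀ {b} → Walk T allV a b → P b ≡ true → ∃ λ s → ∃ λ t → adj T s t ≡ true × P t ≡ true × Walk T (λ x → not (P x)) a s
  stay : ∀ {b} → Walk T allV a b → (∃ λ s → ∃ λ t → adj T s t ≡ true × P t ≡ true × Walk T (λ x → not (P x)) a s) ⊎ Walk T (λ x → not (P x)) a b
  stay (start _) = inj₂ (start (not-true ¬Pa))
  stay (step {w} {v} p e _) with stay p
  ... | inj₁ found = inj₁ found
  ... | inj₂ q with bool-split (P v)
  ...   | inj₁ Pv = inj₁ (w , v , e , Pv , q)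
  ...   | inj₂ ¬Pv = inj₂ (step q e (not-true ¬Pv))
  go p Pb with stay p
  ... | inj₁ found = found
  ... | inj₂ q = ⊥-elim (true≢false Pb (not-true⁻ (walk-target q)))

neighbours : (F : Graph) → Sub (size F) → Sub (size F)
neighbours F C x = not (C x) ∧ anyF (size F) (λ c → C c ∧ adj F c x)

module Adhesion {F : Graph} (D : TreeDecomposition F) where

  private
    T = tree D
    n = size F

  module _ (t : Fin (size T)) where

    component : Fin n → Sub n
    component u = conn F (λ z → not (bag D t z)) u

  module _ (t : Fin (size T)) {u : Fin n} (u∉t : bag D t u ≡ false) where

    private
      C : Sub n
      C = component t u

      C-outside : ∀ {c} → C c ≡ true → bag D t c ≡ false
      C-outside Cc = not-true⁻ (conn-target F (λ z → not (bag D t z)) Cc)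

      meets : Sub (size T)
      meets τ = anyF n (λ c → C c ∧ bag D τ c)

    -- The bags meeting C form a subtree avoiding t, which is entered from t through a single edge of the tree.
    component-adhesion : ∃ λ s → ∃ λ s′ → adj T s′ s ≡ true ×
      (∀ x → neighbours F C x ≡ true → bag D s x ≡ true × bag D s′ x ≡ true) × (∃ λ c → C c ≡ true × bag D s c ≡ true)
    component-adhesion
      with τ , uτ ← cover-v D u
      with s′ , s , e , s-meets , w ← walk-enter meets (conn⇒walk T allV (proj₁ (proj₂ (is-tree D)) t τ))
             (¬-not (λ m → let c , p = anyF-true⁻ n m in true≢false (∧-trueʳ {C c} p) (C-outside (∧-trueˡ p))))
             (anyF-true u (∧-true (conn-refl F (λ z → not (bag D t z)) (not-true u∉t)) uτ))
      with σ , σs′≢σs , σ-const ← tree-cut (is-tree D) e =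
      s , s′ , e , (λ x nx → crossing x nx) , anyF-∧⁻ s-meets
      where
      anyF-∧⁻ : ∀ {p q : Fin n → Bool} → anyF n (λ c → p c ∧ q c) ≡ true → ∃ λ c → p c ≡ true × q c ≡ true
      anyF-∧⁻ {p} m with c , pq ← anyF-true⁻ n m = c , ∧-trueˡ pq , ∧-trueʳ {p c} pq
      ¬meets-s′ : meets s′ ≡ false
      ¬meets-s′ = not-true⁻ (walk-target w)
      -- A set of bags that misses one end of the cut edge supports no walk across the cut.
      avoid : ∀ {P : Sub (size T)} → (P s ≡ true → P s′ ≡ true → ⊥) → ∀ {a b} → Walk T P a b → σ a ≡ σ b
      avoid av (start _) = refl
      avoid av (step p e y) = trans (avoid av p) (σ-const e
        (λ { (refl , refl) → av y (walk-target p) }) (λ { (refl , refl) → av (walk-target p) y }))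
      t-side : σ t ≡ σ s′
      t-side = avoid (λ s∉ _ → true≢false s-meets (not-true⁻ s∉)) w
      bags-const : ∀ {c} → C c ≡ true → ∀ {τ₁ τ₂} → bag D τ₁ c ≡ true → bag D τ₂ c ≡ true → σ τ₁ ≡ σ τ₂
      bags-const {c} Cc {τ₁} {τ₂} b₁ b₂ = avoid
        (λ _ s′∋c → true≢false (anyF-true c (∧-true Cc s′∋c)) ¬meets-s′)
        (conn⇒walk T (λ s → bag D s c) (coherent D c τ₁ τ₂ b₁ b₂))
      -- Consecutive vertices of C share a bag, so all bags meeting C lie on one side of the cut.
      same-side : ∀ {c} → Walk F (λ z → not (bag D t z)) u c → ∀ {τ₁ τ₂} → bag D τ₁ u ≡ true → bag D τ₂ c ≡ true → σ τ₁ ≡ σ τ₂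
      same-side p@(start _) b₁ b₂ = bags-const (walk⇒conn p) b₁ b₂
      same-side q@(step {c} {c′} p e _) b₁ b₂ with τ , bc , bc′ ← cover-e D c c′ e =
        trans (same-side p b₁ bc) (bags-const (walk⇒conn q) bc′ b₂)
      C-side : ∀ {c τ′} → C c ≡ true → bag D τ′ c ≡ true → σ τ′ ≡ σ s
      C-side Cc b with c₀ , Cc₀ , b₀ ← anyF-∧⁻ s-meets =
        trans (sym (same-side (conn⇒walk F _ Cc) (proj₂ (cover-v D u)) b)) (same-side (conn⇒walk F _ Cc₀) (proj₂ (cover-v D u)) b₀)
      crossing : ∀ x → neighbours F C x ≡ true → bag D s x ≡ true × bag D s′ x ≡ true
      crossing x nx with c , Cc , cx ← anyF-∧⁻ (∧-trueʳ {not (C x)} nx) with τ′ , bc , bx ← cover-e D c x cx =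
        both (bag D s x) refl (bag D s′ x) refl
        where
        x∈t : bag D t x ≡ true
        x∈t = ¬-not (λ x∉t → true≢false (conn-adj F (λ z → not (bag D t z)) Cc cx (not-true x∉t)) (not-true⁻ (∧-trueˡ nx)))
        -- The bags of x include t and τ′, on different sides of the cut, and they are connected in
        -- the tree; hence they contain both ends of the cut edge.
        impossible : (bag D s x ≡ true → bag D s′ x ≡ true → ⊥) → ⊥
        impossible av = σs′≢σs (trans (sym t-side) (trans (avoid av (conn⇒walk T (λ s → bag D s x) (coherent D x t τ′ x∈t bx))) (C-side Cc bc)))
        both : ∀ p → bag D s x ≡ p → ∀ q → bag D s′ x ≡ q → bag D s x ≡ true × bag D s′ x ≡ true
        both true  ep true  eq = ep , eq
        both false ep _     eq = ⊥-elim (impossible (λ p _ → true≢false p ep))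
        both true  ep false eq = ⊥-elim (impossible (λ _ q → true≢false q eq))

-- Parities of parts of F, and the descent to an all-even bag

module Descent {F : Graph} {N : ℕ} {r : Fin N} {φ : Fin (size F) → Fin N} (o : Odd F r φ) where

  open Odd o

  private
    n = size F

  infix 8 _⟨_⟩_
  _⟨_⟩_ : Sub n → Fin N → Sub n
  (C ⟨ v ⟩ i) = C i ∧ (φ i == v)

  oddness : Sub n → Fin N → Bool
  oddness C v = ∑ (λ i → C ⟨ v ⟩ i ∧ y i)

  inner : Sub n → Fin N → Fin N → Bool
  inner C v u = ∑ (λ i → ∑ (λ j → (C ⟨ v ⟩ i ∧ C ⟨ u ⟩ j) ∧ Z i j))

  outer : Sub n → Fin N → Fin N → Bool
  outer C v u = ∑ (λ i → ∑ (λ x → (C ⟨ v ⟩ i ∧ (not (C x) ∧ (φ x == u))) ∧ Z i x))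

  Avoids : Sub n → Fin N → Set
  Avoids C v = ∀ x → neighbours F C x ≡ true → φ x ≢ v

  -- Counting the Z-edges from the fibre of v in C to the fibre of u.
  oddness-split : ∀ C {v u} → v ≢ u → oddness C v ≡ inner C v u xor outer C v u
  oddness-split C {v} {u} v≢u = begin
      ∑ (λ i → C ⟨ v ⟩ i ∧ y i)
    ≡⟨ ∑-cong n (λ i → ∧-cong-true {C ⟨ v ⟩ i} (λ Ci → sym (trans (Z-deg i u) (trans
         (cong (λ b → y i ∧ not b) (≢⇒== {i = φ i} (λ φi≡u → v≢u (trans (sym (==⇒≡ {i = φ i} (∧-trueʳ {C i} Ci))) φi≡u)))) (∧-identityʳ (y i)))))) ⟩
      ∑ (λ i → C ⟨ v ⟩ i ∧ ∑ (λ j → Z i j ∧ (φ j == u)))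
    ≡⟨ ∑-cong n (λ i → trans (sym (∑-∧ˡ n (C ⟨ v ⟩ i) _)) (trans (∑-cong n (λ j → split (C ⟨ v ⟩ i) (Z i j) (φ j == u) (C j))) (∑-xor n _ _))) ⟩
      ∑ (λ i → ∑ (λ j → (C ⟨ v ⟩ i ∧ C ⟨ u ⟩ j) ∧ Z i j) xor ∑ (λ j → (C ⟨ v ⟩ i ∧ (not (C j) ∧ (φ j == u))) ∧ Z i j))
    ≡⟨ ∑-xor n _ _ ⟩
      inner C v u xor outer C v u ∎
    where
    open ≡-Reasoning
    split : ∀ p z q c → p ∧ (z ∧ q) ≡ ((p ∧ (c ∧ q)) ∧ z) xor ((p ∧ (not c ∧ q)) ∧ z)
    split p z q true  = solve 3 (λ p z q → p :* (z :* q) := ((p :* q) :* z) :+ ((p :* con false) :* z)) refl p z q where open xor-∧-Solver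
    split p z q false = solve 3 (λ p z q → p :* (z :* q) := ((p :* con false) :* z) :+ ((p :* q) :* z)) refl p z q where open xor-∧-Solver

  inner-sym : ∀ C v u → inner C v u ≡ inner C u v
  inner-sym C v u = trans (∑-swap n n _) (∑-cong n (λ j → ∑-cong n (λ i →
    cong₂ _∧_ (∧-comm (C ⟨ v ⟩ i) (C ⟨ u ⟩ j)) (Z-sym i j))))

  outer-avoids : ∀ C {v u} → Avoids C u → outer C v u ≡ false
  outer-avoids C {v} {u} av = ∑-zero n (λ i → ∑-zero n (λ x → ¬-not (λ e →
    let e₁ = ∧-trueˡ {C ⟨ v ⟩ i ∧ (not (C x) ∧ (φ x == u))} e
        Ci = ∧-trueˡ (∧-trueˡ {C ⟨ v ⟩ i} e₁)
        e₂ = ∧-trueʳ {C ⟨ v ⟩ i} e₁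
    in av x (∧-true (∧-trueˡ e₂) (anyF-true i (∧-true Ci (Z-adj i x (∧-trueʳ {C ⟨ v ⟩ i ∧ (not (C x) ∧ (φ x == u))} e)))))
         (==⇒≡ (∧-trueʳ {not (C x)} e₂)))))

  oddness-avoids : ∀ C {v u} → v ≢ u → Avoids C u → oddness C v ≡ inner C v u
  oddness-avoids C v≢u av = trans (oddness-split C v≢u) (trans (cong (inner C _ _ xor_) (outer-avoids C av)) (xor-identityʳ _))

  -- Over fibres avoided by the neighbours of C, both sides count the Z-edges inside C between the
  -- two fibres, and that number is symmetric. So C has a parity of its own, visible over any such
  -- fibre.
  oddness-const : ∀ C {v u} → Avoids C v → Avoids C u → oddness C v ≡ oddness C u
  oddness-const C {v} {u} avv avu with v Fin.≟ u
  ... | yes refl = refl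
  ... | no v≢u = trans (oddness-avoids C v≢u avu) (trans (inner-sym C v u) (sym (oddness-avoids C (v≢u ∘ sym) avv)))

  module _ (D : TreeDecomposition F) {k : ℕ}
    (adhesion : ∀ t t′ → adj (tree D) t t′ ≡ true → ∣ (λ v → bag D t v ∧ bag D t′ v) ∣ₛ ≤ k) where

    open Adhesion D

    -- An odd part C of F, attached to the rest through at most k vertices, that is a union of components of F minus the bag
    -- of t together with bag vertices.
    record OddPart : Set where
      field
        C      : Sub n
        t      : Fin (size (tree D))
        thin   : countF n (neighbours F C) ≤ k
        isOdd  : ∀ v → Avoids C v → oddness C v ≡ true
        closed : ∀ {i j} → bag D t i ≡ false → bag D t j ≡ false → adj F i j ≡ true → C i ≡ true → C j ≡ true

    EvenComponents : OddPart → Set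
    EvenComponents P = ∀ u → bag D t u ≡ false → C u ≡ true → ∀ v → Avoids (component t u) v → oddness (component t u) v ≡ false
      where open OddPart P

    component-⊆ : ∀ (P : OddPart) → let open OddPart P in ∀ {u} → C u ≡ true → ∀ {i} → component t u i ≡ true → C i ≡ true
    component-⊆ P {u} Cu Ki = go (conn⇒walk F (λ z → not (bag D t z)) Ki)
      where
      open OddPart P
      go : ∀ {i} → Walk F (λ z → not (bag D t z)) u i → C i ≡ true
      go (start _) = Cu
      go (step p e y) = closed (not-true⁻ (walk-target p)) (not-true⁻ y) e (go p)

    private
      whole : OddPart
      whole with i , _ ← ⨁-true⁻ (allFin n) odd with t , _ ← cover-v D i = record
        { C = allV
        ; t = t
        ; thin = subst (_≤ k) (sym (zero-count n)) z≤n
        -- The fibre of r is odd by `odd`; all of F has no outer neighbours, so every other fibre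
        -- has the same parity.
        ; isOdd = λ v _ → trans (oddness-const allV {v} {r} (λ _ ()) (λ _ ())) (trans (∑-cong n (λ i → ∧-comm (φ i == r) (y i))) odd)
        ; closed = λ _ _ _ _ → refl
        }
        where
        zero-count : ∀ m → countF m (λ _ → false) ≡ 0
        zero-count zero    = refl
        zero-count (suc m) = zero-count m

      avoids? : Sub n → Fin N → Bool
      avoids? C v = not (anyF n (λ x → neighbours F C x ∧ (φ x == v)))

      avoids⇒ : ∀ C {v} → avoids? C v ≡ true → Avoids C v
      avoids⇒ C av x nx φx≡v = true≢false (∧-true nx (≡⇒== φx≡v)) (anyF-false⁻ (not-true⁻ av) x)

      ⇒avoids : ∀ C {v} → Avoids C v → avoids? C v ≡ true
      ⇒avoids C av = not-true (¬-not (λ e → let x , p = anyF-true⁻ n e in av x (∧-trueˡ p) (==⇒≡ (∧-trueʳ {neighbours F C x} p))))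

      -- While some component K of C off the bag is odd, K replaces C and the tree edge separating K
      -- from t supplies the next bag. The measure is the number of vertices of C outside its bag.
      -- It drops because K was outside the old bag and the new bag meets K.
      refine : ∀ fuel (P : OddPart) → let open OddPart P in countF n (λ i → C i ∧ not (bag D t i)) < fuel → Σ OddPart EvenComponents
      refine (suc fuel) P (s≤s lt) with search bad (cartesianProduct (allFin n) (allFin N))
        where
        open OddPart P
        bad : Fin n × Fin N → Bool
        bad (u , v) = (not (bag D t u) ∧ C u) ∧ (avoids? (component t u) v ∧ oddness (component t u) v)
      ... | inj₂ none = P , λ u u∉ Cu v av → ¬-not (λ od →
              true≢false (∧-true (∧-true (not-true u∉) Cu) (∧-true (⇒avoids (component (OddPart.t P) u) av) od)) (none (∈-cartesianProduct⁺ (∈-allFin u) (∈-allFin v))))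
      ... | inj₁ ((u , v) , _ , isbad) = shrink (component-adhesion t u∉)
        where
        open OddPart P
        K = component t u
        u∉ : bag D t u ≡ false
        u∉ = not-true⁻ (∧-trueˡ (∧-trueˡ {not (bag D t u) ∧ C u} isbad))
        Cu : C u ≡ true
        Cu = ∧-trueʳ {not (bag D t u)} (∧-trueˡ {not (bag D t u) ∧ C u} isbad)
        av×od = ∧-trueʳ {not (bag D t u) ∧ C u} isbad
        shrink : (∃ λ s → ∃ λ s′ → adj (tree D) s′ s ≡ true ×
          (∀ x → neighbours F K x ≡ true → bag D s x ≡ true × bag D s′ x ≡ true) × (∃ λ c → K c ≡ true × bag D s c ≡ true)) → Σ OddPart EvenComponents
        shrink (s , s′ , e , attached , c , Kc , c∈s) = refine fuel
          (record
            { C = K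
            ; t = s
            ; thin = ℕ.≤-trans (countF-mono n (λ x nx → let p , q = attached x nx in ∧-true q p)) (adhesion s′ s e)
            ; isOdd = λ v′ av′ → trans (oddness-const K av′ (avoids⇒ K (∧-trueˡ av×od))) (∧-trueʳ {avoids? K v} av×od)
            -- All neighbours of K lie in the bag of s, so an edge of F from K that ends outside
            -- that bag stays in K.
            ; closed = λ {i} {j} i∉ j∉ ij Ki → ¬-not (λ ¬Kj → true≢false (proj₁ (attached j (∧-true (not-true ¬Kj) (anyF-true i (∧-true Ki ij))))) j∉)
            })
          (ℕ.<-≤-trans (countF-strict n inside c (∧-true (component-⊆ P Cu Kc) (conn-target F (λ z → not (bag D t z)) Kc))
             (trans (cong (λ b → K c ∧ not b) c∈s) (∧-zeroʳ (K c)))) lt)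
          where
          inside : ∀ i → K i ∧ not (bag D s i) ≡ true → C i ∧ not (bag D t i) ≡ true
          inside i p = let Ki = ∧-trueˡ {K i} p in ∧-true (component-⊆ P Cu Ki) (conn-target F (λ z → not (bag D t z)) Ki)

    abstract
      locate : Σ OddPart EvenComponents
      locate = refine (suc n) whole (s≤s (countF-≤ n _))

-- Cycles in the torso

module TorsoCycles {F : Graph} {N : ℕ} {r₀ : Fin N} {φ : Fin (size F) → Fin N} (o : Odd F r₀ φ) (D : TreeDecomposition F) {k : ℕ}
  (adhesion : ∀ t t′ → adj (tree D) t t′ ≡ true → ∣ (λ v → bag D t v ∧ bag D t′ v) ∣ₛ ≤ k) where

  open Odd o
  open Descent o
  open Adhesion D

  module _ (P : OddPart D adhesion) (even-components : EvenComponents D adhesion P) where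

    open OddPart P

    private
      n = size F

    β : Sub n
    β = bag D t

    private
      H : Sub n
      H z = not (β z)

    K : Fin n → Sub n
    K r = component t r

    rep : Sub n
    rep r = C r ∧ root F H r

    att : Fin n → Sub n
    att r = neighbours F (K r)

    -- The least attachment vertex in its fibre, which represents that fibre in the edges replacing
    -- K r.
    lead : Fin n → Sub n
    lead r x = att r x ∧ not (anyF n (λ x′ → (toℕ x′ <ᵇ toℕ x) ∧ (att r x′ ∧ (φ x′ == φ x))))

    hit : Fin n → Fin N → Bool
    hit r u = anyF n (λ x → att r x ∧ (φ x == u))

    -- The Z-edges inside K r between two fibres, corrected so that they vanish unless both fibres
    -- contain attachment vertices. The correction is a term in v plus a term in u, which
    -- contributes nothing against a set of even degrees.
    θ : Fin n → Fin N → Fin N → Bool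
    θ r v u = inner (K r) v u xor (oddness (K r) v xor oddness (K r) u)

    rep⇒C : ∀ {r} → rep r ≡ true → C r ≡ true
    rep⇒C = ∧-trueˡ

    rep⇒∉β : ∀ {r} → rep r ≡ true → β r ≡ false
    rep⇒∉β {r} ρ = not-true⁻ (∧-trueˡ {H r} (∧-trueʳ {C r} ρ))

    K⇒∉β : ∀ {r i} → K r i ≡ true → β i ≡ false
    K⇒∉β Ki = not-true⁻ (conn-target F H Ki)

    K⇒C : ∀ {r i} → rep r ≡ true → K r i ≡ true → C i ≡ true
    K⇒C ρ = component-⊆ D adhesion P (rep⇒C ρ)

    K-adj : ∀ {r i j} → K r i ≡ true → adj F i j ≡ true → β j ≡ false → K r j ≡ true
    K-adj Ki a j∉ = conn-adj F H Ki a (not-true j∉)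

    β⇒∉K : ∀ {r i} → β i ≡ true → K r i ≡ false
    β⇒∉K i∈ = ¬-not (λ Ki → true≢false i∈ (K⇒∉β Ki))

    att⁻ : ∀ {r x} → att r x ≡ true → β x ≡ true × ∃ λ i → K r i ≡ true × adj F i x ≡ true
    att⁻ {r} {x} a with i , e ← anyF-true⁻ n (∧-trueʳ {not (K r x)} a) =
      ¬-not (λ x∉ → true≢false (K-adj Ki ix x∉) (not-true⁻ (∧-trueˡ a))) , i , Ki , ix
      where
      Ki = ∧-trueˡ {K r i} e
      ix = ∧-trueʳ {K r i} e

    att⁺ : ∀ {r i x} → K r i ≡ true → adj F i x ≡ true → K r x ≡ false → att r x ≡ true
    att⁺ {i = i} Ki ix x∉ = ∧-true (not-true x∉) (anyF-true i (∧-true Ki ix))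

    avoids-closed : ∀ {i x} → C i ≡ true → adj F i x ≡ true → Avoids C (φ x) → C x ≡ true
    avoids-closed {i} {x} Ci ix av = ¬-not (λ ¬Cx → av x (∧-true (not-true ¬Cx) (anyF-true i (∧-true Ci ix))) refl)

    -- By closedness, a component of F minus the bag that meets C lies inside C; so the components
    -- with `rep r` partition the part of C off the bag.
    ∑-rep : ∀ i → ∑ (λ r → rep r ∧ K r i) ≡ C i ∧ not (β i)
    ∑-rep i with bool-split (C i ∧ not (β i))
    ... | inj₂ e = trans (∑-zero n (λ r → ¬-not (λ p →
          true≢false (∧-true (K⇒C (∧-trueˡ p) (∧-trueʳ {rep r} p)) (not-true (K⇒∉β (∧-trueʳ {rep r} p)))) e))) (sym e)
    ... | inj₁ e = trans (∑-cong n (λ r → iff⇒≡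
            (λ p → ∧-true (∧-trueʳ {C r} (∧-trueˡ p)) (∧-trueʳ {rep r} p))
            (λ p → ∧-true (∧-true (component-⊆ D adhesion P (∧-trueˡ e) (conn-sym F H (∧-trueʳ {root F H r} p))) (∧-trueˡ p)) (∧-trueʳ {root F H r} p))))
          (trans (∑-root F H (∧-trueʳ {C i} e)) (sym e))

    lead⇒att : ∀ {r x} → lead r x ≡ true → att r x ≡ true
    lead⇒att = ∧-trueˡ

    lead-exists : ∀ {r x} → att r x ≡ true → ∃ λ x₀ → lead r x₀ ≡ true × φ x₀ ≡ φ x
    lead-exists {r} {x} a with x₀ , p , min ← least n (λ x′ → att r x′ ∧ (φ x′ == φ x)) x (∧-true a (==-refl (φ x))) =
      x₀ , ∧-true (∧-trueˡ p) (not-true (¬-not smaller)) , φ≡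
      where
      φ≡ : φ x₀ ≡ φ x
      φ≡ = ==⇒≡ (∧-trueʳ {att r x₀} p)
      smaller : ¬ anyF n (λ x′ → (toℕ x′ <ᵇ toℕ x₀) ∧ (att r x′ ∧ (φ x′ == φ x₀))) ≡ true
      smaller e with x′ , q ← anyF-true⁻ n e =
        true≢false (subst (λ u → att r x′ ∧ (φ x′ == u) ≡ true) φ≡ (∧-trueʳ {toℕ x′ <ᵇ toℕ x₀} q)) (min x′ (<ᵇ⇒< (toℕ x′) (toℕ x₀) (∧-trueˡ q)))

    lead-unique : ∀ {r x x′} → lead r x ≡ true → lead r x′ ≡ true → φ x ≡ φ x′ → x ≡ x′
    lead-unique {r} l l′ e = Fin.toℕ-injective (ℕ.≤-antisym (ℕ.≮⇒≥ (first l (lead⇒att l′) (sym e))) (ℕ.≮⇒≥ (first l′ (lead⇒att l) e)))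
      where
      first : ∀ {x x′} → lead r x ≡ true → att r x′ ≡ true → φ x′ ≡ φ x → ¬ toℕ x′ < toℕ x
      first {x} {x′} l a e lt = true≢false (∧-true (<⇒<ᵇ lt) (∧-true a (≡⇒== e))) (anyF-false⁻ (not-true⁻ (∧-trueʳ {att r x} l)) x′)

    lead-over : ∀ {r x} → lead r x ≡ true → ∀ x′ → (φ x′ == φ x) ∧ lead r x′ ≡ (x′ == x)
    lead-over {r} {x} l x′ = iff⇒≡
      (λ e → ≡⇒== (lead-unique (∧-trueʳ {φ x′ == φ x} e) l (==⇒≡ (∧-trueˡ e))))
      (λ e → let x′≡x = ==⇒≡ e in ∧-true (≡⇒== (cong φ x′≡x)) (trans (cong (lead r) x′≡x) l))

    ∑-lead : ∀ r u → ∑ (λ x → (φ x == u) ∧ lead r x) ≡ hit r u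
    ∑-lead r u with bool-split (hit r u)
    ... | inj₂ e = trans (∑-zero n (λ x → ¬-not (λ p →
          true≢false (∧-true (lead⇒att (∧-trueʳ {φ x == u} p)) (∧-trueˡ p)) (anyF-false⁻ e x)))) (sym e)
    ... | inj₁ e with x , p ← anyF-true⁻ n e with refl ← ==⇒≡ {i = φ x} {u} (∧-trueʳ {att r x} p) with x₀ , l , φ≡ ← lead-exists {r} {x} (∧-trueˡ p) =
          trans (∑-cong n (λ x′ → trans (subst (λ u → (φ x′ == u) ∧ lead r x′ ≡ (x′ == x₀)) φ≡ (lead-over l x′)) (sym (∧-identityʳ _))))
            (trans (∑-pick x₀ (λ _ → true)) (sym e))

    ¬hit⇒avoids : ∀ {r u} → hit r u ≡ false → Avoids (K r) u
    ¬hit⇒avoids e x a φx≡u = true≢false (∧-true a (≡⇒== φx≡u)) (anyF-false⁻ e x)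

    θ-sym : ∀ r v u → θ r v u ≡ θ r u v
    θ-sym r v u = cong₂ _xor_ (inner-sym (K r) v u) (xor-comm (oddness (K r) v) _)

    -- Here evenness of the components enters. Over a fibre u without attachment vertices the
    -- oddness is 0, and the inner edges towards u have the parity of `oddness (K r) v`. Without
    -- evenness the replacement would need edges ending in fibres that have no attachment vertex.
    θ-zero : ∀ {r v u} → rep r ≡ true → v ≢ u → hit r u ≡ false → θ r v u ≡ false
    θ-zero {r} {v} {u} ρ v≢u ¬h = trans (cong₂ (λ p q → inner (K r) v u xor (p xor q)) (oddness-avoids (K r) v≢u av) (even-components r (rep⇒∉β ρ) (rep⇒C ρ) u av))
        (trans (cong (inner (K r) v u xor_) (xor-identityʳ _)) (xor-same (inner (K r) v u)))
      where
      av : Avoids (K r) u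
      av = ¬hit⇒avoids ¬h

    -- Expanding the oddness over u cancels the inner edges. What is left are the Z-edges leaving K
    -- r from u towards v, plus a term that depends on v alone.
    θ-outer : ∀ r {v u} → v ≢ u → θ r v u ≡ outer (K r) u v xor oddness (K r) v
    θ-outer r {v} {u} v≢u = trans (cong₂ (λ i d → i xor (oddness (K r) v xor d)) (inner-sym (K r) v u) (oddness-split (K r) (v≢u ∘ sym)))
      (solve 3 (λ i d w → i :+ (d :+ (i :+ w)) := w :+ d) refl (inner (K r) u v) (oddness (K r) v) (outer (K r) u v))
      where open xor-∧-Solver

    ∑-fibres : ∀ (g : Fin n → Bool) (h : Fin N → Bool) → ∑ (λ i → g i ∧ h (φ i)) ≡ ∑ (λ u → h u ∧ ∑ (λ i → (φ i == u) ∧ g i))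
    ∑-fibres g h = begin
        ∑ (λ i → g i ∧ h (φ i))
      ≡⟨ ∑-cong n (λ i → trans (sym (∑-pick′ (φ i) (λ u → g i ∧ h u)))
           (∑-cong N (λ u → solve 3 (λ d g h → d :* (g :* h) := h :* (d :* g)) refl (φ i == u) (g i) (h u)))) ⟩
        ∑ (λ i → ∑ (λ u → h u ∧ ((φ i == u) ∧ g i)))
      ≡⟨ ∑-swap n N _ ⟩
        ∑ (λ u → ∑ (λ i → h u ∧ ((φ i == u) ∧ g i)))
      ≡⟨ ∑-cong N (λ u → ∑-∧ˡ n (h u) _) ⟩
        ∑ (λ u → h u ∧ ∑ (λ i → (φ i == u) ∧ g i)) ∎
      where
      open ≡-Reasoning
      open xor-∧-Solver

    -- An element of the cycle space of K_N, all of whose vertices are fibres free of neighbours of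
    -- C.
    record Cell (c : Fin N → Fin N → Bool) : Set where
      field
        cell-sym  : ∀ v u → c v u ≡ c u v
        cell-diag : ∀ v → c v v ≡ false
        cell-even : ∀ v → ∑ (c v) ≡ false
        cell-live : ∀ {v u} → c v u ≡ true → Avoids C v

    C∩β C∖β : Sub n
    C∩β i = C i ∧ β i
    C∖β i = C i ∧ not (β i)

    coeff : Fin n → Fin n → Bool
    coeff x x′ = (C∩β x ∧ C∩β x′) ∧ Z x x′

    module _ (c : Fin N → Fin N → Bool) where

      -- The degree of x towards K r in the lift of c along Z, which the replacing edges have to
      -- reproduce.
      κ : Fin n → Fin n → Bool
      κ r x = ∑ (λ i → (K r i ∧ Z x i) ∧ c (φ x) (φ i))

      -- What x receives from K r and passes on to its leader.
      load : Fin n → Fin n → Bool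
      load r x = (att r x ∧ not (lead r x)) ∧ κ r x

      connector tie piece : Fin n → Fin n → Fin n → Bool
      connector r x x′ = ((φ x == φ x′) ∧ lead r x′) ∧ load r x
      tie r x x′ = (lead r x ∧ lead r x′) ∧ (θ r (φ x) (φ x′) ∧ c (φ x) (φ x′))
      piece r x x′ = (connector r x x′ xor connector r x′ x) xor tie r x x′

      -- Each component K r of F minus the bag is replaced by edges between its attachment vertices: all of them in a common
      -- fibre send what they receive from K r to the leader of the fibre, and the leaders are joined according to θ.
      cycle : Fin n → Fin n → Bool
      cycle x x′ = (coeff x x′ ∧ c (φ x) (φ x′)) xor ∑ (λ r → rep r ∧ piece r x x′)

    κ-local : ∀ {c c′ x} → (∀ u → c (φ x) u ≡ c′ (φ x) u) → ∀ r → κ c r x ≡ κ c′ r x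
    κ-local e r = ∑-cong n (λ i → cong (_ ∧_) (e (φ i)))

    -- Connectors stay inside a fibre, so all edges at x are determined by row φ x of c. Rectangles
    -- with a common row thus share their torso edges there, which drives the cancellations in
    -- `local-crossing`.
    cycle-local : ∀ {c c′ x} → (∀ u → c (φ x) u ≡ c′ (φ x) u) → ∀ x′ → cycle c x x′ ≡ cycle c′ x x′
    cycle-local {c} {c′} {x} e x′ = cong₂ _xor_ (cong (coeff x x′ ∧_) (e (φ x′))) (∑-cong n (λ r → cong (rep r ∧_)
      (cong₂ _xor_ (cong₂ _xor_ (cong (λ q → ((φ x == φ x′) ∧ lead r x′) ∧ ((att r x ∧ not (lead r x)) ∧ q)) (κ-local {c} {c′} e r)) (back r))
        (cong (λ q → (lead r x ∧ lead r x′) ∧ (θ r (φ x) (φ x′) ∧ q)) (e (φ x′))))))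
      where
      back : ∀ r → connector c r x′ x ≡ connector c′ r x′ x
      back r = ∧-cong-true {(φ x′ == φ x) ∧ lead r x} (λ p → cong ((att r x′ ∧ not (lead r x′)) ∧_)
        (κ-local {c} {c′} (subst (λ v → ∀ u → c v u ≡ c′ v u) (sym (==⇒≡ {i = φ x′} (∧-trueˡ p))) e) r))

    cycle-zero : ∀ {c x} → (∀ u → c (φ x) u ≡ false) → ∀ x′ → cycle c x x′ ≡ false
    cycle-zero {c} {x} e x′ = trans (cycle-local {c} {λ _ _ → false} e x′) (cong₂ _xor_ (∧-zeroʳ (coeff x x′))
      (∑-zero n (λ r → trans (cong (rep r ∧_) (cong₂ _xor_ (cong₂ _xor_ (conn0 r x x′) (conn0 r x′ x))
        (trans (cong ((lead r x ∧ lead r x′) ∧_) (∧-zeroʳ _)) (∧-zeroʳ _)))) (∧-zeroʳ (rep r)))))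
      where
      conn0 : ∀ r x x′ → connector (λ _ _ → false) r x x′ ≡ false
      conn0 r x x′ = trans (cong (λ q → ((φ x == φ x′) ∧ lead r x′) ∧ ((att r x ∧ not (lead r x)) ∧ q)) (∑-zero n (λ i → ∧-zeroʳ _)))
        (trans (cong (((φ x == φ x′) ∧ lead r x′) ∧_) (∧-zeroʳ _)) (∧-zeroʳ _))

    -- The supply of torso edges between different fibres, from which c merely selects.
    link : Fin n → Fin n → Bool
    link x x′ = coeff x x′ xor ∑ (λ r → rep r ∧ ((lead r x ∧ lead r x′) ∧ θ r (φ x) (φ x′)))

    cycle-link : ∀ {c x x′} → φ x ≢ φ x′ → cycle c x x′ ≡ link x x′ ∧ c (φ x) (φ x′)
    cycle-link {c} {x} {x′} φ≢ = begin
        (coeff x x′ ∧ c (φ x) (φ x′)) xor ∑ (λ r → rep r ∧ piece c r x x′)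
      ≡⟨ cong ((coeff x x′ ∧ c (φ x) (φ x′)) xor_) (∑-cong n (λ r → trans
           (cong₂ (λ p q → rep r ∧ ((((p ∧ lead r x′) ∧ ((att r x ∧ not (lead r x)) ∧ κ c r x)) xor ((q ∧ lead r x) ∧ load c r x′)) xor tie c r x x′))
             (≢⇒== φ≢) (≢⇒== (φ≢ ∘ sym)))
           (trans (cong (rep r ∧_) (sym (∧-assoc (lead r x ∧ lead r x′) (θ r (φ x) (φ x′)) (c (φ x) (φ x′))))) (sym (∧-assoc (rep r) _ (c (φ x) (φ x′))))))) ⟩
        (coeff x x′ ∧ c (φ x) (φ x′)) xor ∑ (λ r → (rep r ∧ ((lead r x ∧ lead r x′) ∧ θ r (φ x) (φ x′))) ∧ c (φ x) (φ x′))
      ≡⟨ cong ((coeff x x′ ∧ c (φ x) (φ x′)) xor_) (∑-∧ʳ n (c (φ x) (φ x′)) _) ⟩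
        (coeff x x′ ∧ c (φ x) (φ x′)) xor (∑ (λ r → rep r ∧ ((lead r x ∧ lead r x′) ∧ θ r (φ x) (φ x′))) ∧ c (φ x) (φ x′))
      ≡⟨ ∧-distribʳ-xor (c (φ x) (φ x′)) (coeff x x′) _ ⟨
        link x x′ ∧ c (φ x) (φ x′) ∎
      where open ≡-Reasoning

    module _ {c : Fin N → Fin N → Bool} (cell : Cell c) where

      open Cell cell

      cycle-sym : ∀ x x′ → cycle c x x′ ≡ cycle c x′ x
      cycle-sym x x′ = cong₂ _xor_
        (cong₂ _∧_ (cong₂ _∧_ (∧-comm (C∩β x) (C∩β x′)) (Z-sym x x′)) (cell-sym (φ x) (φ x′)))
        (∑-cong n (λ r → cong (rep r ∧_) (cong₂ _xor_ (xor-comm (connector c r x x′) _)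
          (cong₂ _∧_ (∧-comm (lead r x) (lead r x′)) (cong₂ _∧_ (θ-sym r (φ x) (φ x′)) (cell-sym (φ x) (φ x′)))))))

      cycle-live : ∀ {x x′} → cycle c x x′ ≡ true → ∃ λ u → c (φ x) u ≡ true
      cycle-live {x} {x′} e with search (c (φ x)) (allFin N)
      ... | inj₁ (u , _ , p) = u , p
      ... | inj₂ none = ⊥-elim (true≢false e (cycle-zero {c} (λ u → none (∈-allFin u)) x′))

      cycle-torso : ∀ {x x′} → cycle c x x′ ≡ true → β x ≡ true × β x′ ≡ true × adj (torso F β) x x′ ≡ true
      cycle-torso {x} {x′} e with bool-split (coeff x x′ ∧ c (φ x) (φ x′))
      ... | inj₁ p = βx , βx′ , ∧-true (not-true (eqFin-false (λ x≡x′ → true≢false xx′ (trans (cong (adj F x) (sym x≡x′)) (adj-irrefl F x)))))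
                       (∨-trueˡ (∧-true βx (∧-true βx′ (∨-trueˡ xx′))))
        where
        q = ∧-trueˡ {coeff x x′} p
        βx = ∧-trueʳ {C x} (∧-trueˡ {C∩β x} (∧-trueˡ {C∩β x ∧ C∩β x′} q))
        βx′ = ∧-trueʳ {C x′} (∧-trueʳ {C∩β x} (∧-trueˡ {C∩β x ∧ C∩β x′} q))
        xx′ = Z-adj x x′ (∧-trueʳ {C∩β x ∧ C∩β x′} q)
      ... | inj₂ p with r , _ , q ← ⨁-true⁻ (allFin n) (trans (cong (_xor ∑ (λ r → rep r ∧ piece c r x x′)) (sym p)) e) =
        attached (∧-trueʳ {rep r} q)
        where
        joined : att r x ≡ true → att r x′ ≡ true → x ≢ x′ → β x ≡ true × β x′ ≡ true × adj (torso F β) x x′ ≡ true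
        joined a a′ x≢x′ with βx , i , Ki , ix ← att⁻ {r} {x} a with βx′ , i′ , Ki′ , ix′ ← att⁻ {r} {x′} a′ =
          βx , βx′ , ∧-true (not-true (eqFin-false x≢x′)) (∨-trueˡ (∧-true βx (∧-true βx′ (∨-trueʳ {adj F x x′}
            (anyF-true i (anyF-true i′ (∧-true ix (∧-true ix′ (conn-trans F H (conn-sym F H Ki) Ki′)))))))))
        via-connector : ∀ x x′ → connector c r x x′ ≡ true → att r x ≡ true × att r x′ ≡ true × x ≢ x′
        via-connector x x′ w = ∧-trueˡ aw , lead⇒att lw , λ x≡x′ → true≢false lw (trans (cong (lead r) (sym x≡x′)) (not-true⁻ (∧-trueʳ {att r x} aw)))
          where
          lw = ∧-trueʳ {φ x == φ x′} (∧-trueˡ {(φ x == φ x′) ∧ lead r x′} w)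
          aw = ∧-trueˡ {att r x ∧ not (lead r x)} (∧-trueʳ {(φ x == φ x′) ∧ lead r x′} w)
        attached : piece c r x x′ ≡ true → β x ≡ true × β x′ ≡ true × adj (torso F β) x x′ ≡ true
        attached w with bool-split (connector c r x x′) | bool-split (connector c r x′ x)
        ... | inj₁ s | _ = let a , a′ , x≢ = via-connector x x′ s in joined a a′ x≢
        ... | inj₂ _ | inj₁ s = let a′ , a , x≢ = via-connector x′ x s in joined a a′ (x≢ ∘ sym)
        ... | inj₂ s | inj₂ s′ = joined (lead⇒att (∧-trueˡ l)) (lead⇒att (∧-trueʳ {lead r x} l))
                (λ x≡x′ → true≢false (∧-trueʳ {θ r (φ x) (φ x′)} (∧-trueʳ {lead r x ∧ lead r x′} tw)) (trans (cong (c (φ x)) (sym (cong φ x≡x′))) (cell-diag (φ x))))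
          where
          tw : tie c r x x′ ≡ true
          tw = trans (sym (cong₂ (λ p q → (p xor q) xor tie c r x x′) s s′)) w
          l = ∧-trueˡ {lead r x ∧ lead r x′} tw

      cell-≢ : ∀ {v u} → c v u ≡ true → v ≢ u
      cell-≢ {v} e refl = true≢false e (cell-diag v)

      κ-att : ∀ {r x} → K r x ≡ false → κ c r x ≡ true → att r x ≡ true
      κ-att {r} {x} x∉ e with i , _ , p ← ⨁-true⁻ (allFin n) e =
        att⁺ (∧-trueˡ {K r i} (∧-trueˡ {K r i ∧ Z x i} p)) (Z-adj i x (trans (Z-sym i x) (∧-trueʳ {K r i} (∧-trueˡ {K r i ∧ Z x i} p)))) x∉

      ∑-outer : ∀ r v → ∑ (λ u → c v u ∧ outer (K r) u v) ≡ ∑ (λ x′ → (φ x′ == v) ∧ (att r x′ ∧ κ c r x′))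
      ∑-outer r v = begin
          ∑ (λ u → c v u ∧ outer (K r) u v)
        ≡⟨ ∑-cong N (λ u → cong (c v u ∧_) (∑-cong n (λ i → trans
             (∑-cong n (λ x → solve 4 (λ k d p z → ((k :* d) :* p) :* z := d :* ((k :* p) :* z)) refl (K r i) (φ i == u) (not (K r x) ∧ (φ x == v)) (Z i x)))
             (∑-∧ˡ n (φ i == u) _)))) ⟩
          ∑ (λ u → c v u ∧ ∑ (λ i → (φ i == u) ∧ ∑ (λ x → (K r i ∧ (not (K r x) ∧ (φ x == v))) ∧ Z i x)))
        ≡⟨ ∑-fibres (λ i → ∑ (λ x → (K r i ∧ (not (K r x) ∧ (φ x == v))) ∧ Z i x)) (c v) ⟨
          ∑ (λ i → ∑ (λ x → (K r i ∧ (not (K r x) ∧ (φ x == v))) ∧ Z i x) ∧ c v (φ i))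
        ≡⟨ ∑-cong n (λ i → sym (∑-∧ʳ n (c v (φ i)) _)) ⟩
          ∑ (λ i → ∑ (λ x → ((K r i ∧ (not (K r x) ∧ (φ x == v))) ∧ Z i x) ∧ c v (φ i)))
        ≡⟨ ∑-swap n n _ ⟩
          ∑ (λ x → ∑ (λ i → ((K r i ∧ (not (K r x) ∧ (φ x == v))) ∧ Z i x) ∧ c v (φ i)))
        ≡⟨ ∑-cong n (λ x → trans (∑-cong n (λ i → trans (cong (λ z → ((K r i ∧ (not (K r x) ∧ (φ x == v))) ∧ z) ∧ c v (φ i)) (Z-sym i x))
             (solve 5 (λ k m p z c → ((k :* (m :* p)) :* z) :* c := (p :* m) :* ((k :* z) :* c)) refl (K r i) (not (K r x)) (φ x == v) (Z x i) (c v (φ i)))))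
             (∑-∧ˡ n ((φ x == v) ∧ not (K r x)) _)) ⟩
          ∑ (λ x → ((φ x == v) ∧ not (K r x)) ∧ ∑ (λ i → (K r i ∧ Z x i) ∧ c v (φ i)))
        ≡⟨ ∑-cong n (λ x → trans (∧-assoc (φ x == v) _ _) (∧-cong-true (λ p → trans
             (cong (λ w → not (K r x) ∧ ∑ (λ i → (K r i ∧ Z x i) ∧ c w (φ i))) (sym (==⇒≡ {i = φ x} p)))
             (iff⇒≡ (λ e → ∧-true (κ-att (not-true⁻ (∧-trueˡ e)) (∧-trueʳ {not (K r x)} e)) (∧-trueʳ {not (K r x)} e))
                     (λ e → ∧-true (∧-trueˡ {not (K r x)} (∧-trueˡ {att r x} e)) (∧-trueʳ {att r x} e)))))) ⟩
          ∑ (λ x → (φ x == v) ∧ (att r x ∧ κ c r x)) ∎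
        where
        open ≡-Reasoning
        open xor-∧-Solver

      -- The term of θ that depends on the fibre of x alone is multiplied by an even degree of c.
      -- The rest counts the edges from K r to all attachment vertices in the fibre of x: the demand
      -- of the whole fibre.
      ∑-tie : ∀ {r x} → rep r ≡ true → lead r x ≡ true → ∑ (tie c r x) ≡ ∑ (λ x′ → (φ x′ == φ x) ∧ (att r x′ ∧ κ c r x′))
      ∑-tie {r} {x} ρ l = begin
          ∑ (tie c r x)
        ≡⟨ ∑-cong n (λ x′ → cong (λ b → (b ∧ lead r x′) ∧ (θ r v (φ x′) ∧ c v (φ x′))) l) ⟩
          ∑ (λ x′ → lead r x′ ∧ (θ r v (φ x′) ∧ c v (φ x′)))
        ≡⟨ ∑-fibres (lead r) (λ u → θ r v u ∧ c v u) ⟩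
          ∑ (λ u → (θ r v u ∧ c v u) ∧ ∑ (λ x′ → (φ x′ == u) ∧ lead r x′))
        ≡⟨ ∑-cong N (λ u → trans (cong ((θ r v u ∧ c v u) ∧_) (∑-lead r u)) (outer-term u)) ⟩
          ∑ (λ u → (c v u ∧ outer (K r) u v) xor (c v u ∧ oddness (K r) v))
        ≡⟨ trans (∑-xor N _ _) (cong (∑ (λ u → c v u ∧ outer (K r) u v) xor_) (trans (∑-∧ʳ N (oddness (K r) v) (c v)) (cong (_∧ oddness (K r) v) (cell-even v)))) ⟩
          ∑ (λ u → c v u ∧ outer (K r) u v) xor false
        ≡⟨ trans (xor-identityʳ _) (∑-outer r v) ⟩
          ∑ (λ x′ → (φ x′ == v) ∧ (att r x′ ∧ κ c r x′)) ∎
        where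
        open ≡-Reasoning
        v = φ x
        outer-term : ∀ u → (θ r v u ∧ c v u) ∧ hit r u ≡ (c v u ∧ outer (K r) u v) xor (c v u ∧ oddness (K r) v)
        outer-term u with bool-split (c v u)
        ... | inj₂ e rewrite e = cong (_∧ hit r u) (∧-zeroʳ (θ r v u))
        ... | inj₁ e rewrite e = trans (cong (_∧ hit r u) (∧-identityʳ (θ r v u))) (trans (drop (bool-split (hit r u))) (θ-outer r (cell-≢ e)))
          where
          drop : hit r u ≡ true ⊎ hit r u ≡ false → θ r v u ∧ hit r u ≡ θ r v u
          drop (inj₁ h) = trans (cong (θ r v u ∧_) h) (∧-identityʳ _)
          drop (inj₂ h) = trans (cong (_∧ hit r u) (θ-zero ρ (cell-≢ e) h)) (sym (θ-zero ρ (cell-≢ e) h))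

      -- A vertex that does not lead has its demand met by its one connector. The leader receives
      -- the demand of the fibre through its ties and hands on the shares of the others, which
      -- leaves its own.
      ∑-piece : ∀ {r x} → rep r ≡ true → β x ≡ true → ∑ (piece c r x) ≡ κ c r x
      ∑-piece {r} {x} ρ x∈ with bool-split (lead r x)
      ... | inj₂ ¬l = begin
          ∑ (piece c r x)
        ≡⟨ ∑-cong n (λ x′ → trans (cong₂ (λ p q → (connector c r x x′ xor p) xor q)
             (trans (cong (λ b → ((φ x′ == φ x) ∧ b) ∧ load c r x′) ¬l) (cong (_∧ load c r x′) (∧-zeroʳ (φ x′ == φ x))))
             (cong (λ b → (b ∧ lead r x′) ∧ (θ r (φ x) (φ x′) ∧ c (φ x) (φ x′))) ¬l))
             (trans (xor-identityʳ _) (trans (xor-identityʳ _)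
               (cong (λ b → ((φ x == φ x′) ∧ lead r x′) ∧ ((att r x ∧ not b) ∧ κ c r x)) ¬l)))) ⟩
          ∑ (λ x′ → ((φ x == φ x′) ∧ lead r x′) ∧ ((att r x ∧ true) ∧ κ c r x))
        ≡⟨ ∑-∧ʳ n ((att r x ∧ true) ∧ κ c r x) _ ⟩
          ∑ (λ x′ → (φ x == φ x′) ∧ lead r x′) ∧ ((att r x ∧ true) ∧ κ c r x)
        ≡⟨ cong₂ _∧_ (trans (∑-cong n (λ x′ → cong (_∧ lead r x′) (==-sym (φ x) (φ x′)))) (∑-lead r (φ x))) (cong (_∧ κ c r x) (∧-identityʳ (att r x))) ⟩
          hit r (φ x) ∧ (att r x ∧ κ c r x)
        ≡⟨ iff⇒≡ (λ e → ∧-trueʳ {att r x} (∧-trueʳ {hit r (φ x)} e))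
             (λ e → let a = κ-att {r} {x} (β⇒∉K x∈) e in ∧-true (anyF-true x (∧-true a (==-refl (φ x)))) (∧-true a e)) ⟩
          κ c r x ∎
        where open ≡-Reasoning
      ... | inj₁ l = begin
          ∑ (piece c r x)
        ≡⟨ ∑-cong n (λ x′ → cong (_xor tie c r x x′) (cong₂ _xor_ (out x′) (into x′))) ⟩
          ∑ (λ x′ → ((φ x′ == φ x) ∧ load c r x′) xor tie c r x x′)
        ≡⟨ trans (∑-xor n _ _) (cong (∑ (λ x′ → (φ x′ == φ x) ∧ load c r x′) xor_) (∑-tie ρ l)) ⟩
          ∑ (λ x′ → (φ x′ == φ x) ∧ load c r x′) xor ∑ (λ x′ → (φ x′ == φ x) ∧ (att r x′ ∧ κ c r x′))
        ≡⟨ ∑-xor n _ _ ⟨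
          ∑ (λ x′ → ((φ x′ == φ x) ∧ load c r x′) xor ((φ x′ == φ x) ∧ (att r x′ ∧ κ c r x′)))
        ≡⟨ ∑-cong n (λ x′ → trans (leaders (φ x′ == φ x) (κ c r x′) (lead⇒att {r} {x′})) (cong (_∧ κ c r x′) (lead-over l x′))) ⟩
          ∑ (λ x′ → (x′ == x) ∧ κ c r x′)
        ≡⟨ ∑-pick x (κ c r) ⟩
          κ c r x ∎
        where
        open ≡-Reasoning
        out : ∀ x′ → connector c r x x′ ≡ false
        out x′ = trans (cong (λ b → ((φ x == φ x′) ∧ lead r x′) ∧ ((att r x ∧ not b) ∧ κ c r x)) l)
          (trans (cong (λ b → ((φ x == φ x′) ∧ lead r x′) ∧ (b ∧ κ c r x)) (∧-zeroʳ (att r x))) (∧-zeroʳ _))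
        into : ∀ x′ → connector c r x′ x ≡ (φ x′ == φ x) ∧ load c r x′
        into x′ = cong (_∧ load c r x′) (trans (cong ((φ x′ == φ x) ∧_) l) (∧-identityʳ _))
        leaders : ∀ d q {a b} → (b ≡ true → a ≡ true) → (d ∧ ((a ∧ not b) ∧ q)) xor (d ∧ (a ∧ q)) ≡ (d ∧ b) ∧ q
        leaders false q f = refl
        leaders true q {true}  {true}  f = refl
        leaders true q {true}  {false} f = xor-same q
        leaders true q {false} {false} f = refl
        leaders true q {false} {true}  f with () ← f refl

      ∑-coeff : ∀ {x} → C x ≡ true → β x ≡ true → ∑ (λ x′ → coeff x x′ ∧ c (φ x) (φ x′)) ≡ ∑ (λ i → β i ∧ (Z x i ∧ c (φ x) (φ i)))
      ∑-coeff {x} Cx x∈ = ∑-cong n (λ i → trans (cong₂ (λ p q → (((p ∧ q) ∧ C∩β i) ∧ Z x i) ∧ c (φ x) (φ i)) Cx x∈)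
        (trans (∧-assoc (C∩β i) (Z x i) _) (iff⇒≡
          (λ e → ∧-true (∧-trueʳ {C i} (∧-trueˡ e)) (∧-trueʳ {C∩β i} e))
          (λ e → let zc = ∧-trueʳ {β i} e in ∧-true (∧-true (avoids-closed Cx (Z-adj x i (∧-trueˡ zc)) (cell-live (trans (cell-sym (φ i) (φ x)) (∧-trueʳ {Z x i} zc)))) (∧-trueˡ e)) zc))))

      -- A Z-edge over c that starts in C stays in C, as it ends over a live fibre; if it ends off
      -- the bag, it ends in exactly one of the components.
      ∑-κ : ∀ {x} → C x ≡ true → ∑ (λ r → rep r ∧ κ c r x) ≡ ∑ (λ i → not (β i) ∧ (Z x i ∧ c (φ x) (φ i)))
      ∑-κ {x} Cx = begin
          ∑ (λ r → rep r ∧ κ c r x)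
        ≡⟨ ∑-cong n (λ r → trans (sym (∑-∧ˡ n (rep r) _)) (∑-cong n (λ i →
             solve 4 (λ p k z c → p :* ((k :* z) :* c) := (p :* k) :* (z :* c)) refl (rep r) (K r i) (Z x i) (c (φ x) (φ i))))) ⟩
          ∑ (λ r → ∑ (λ i → (rep r ∧ K r i) ∧ (Z x i ∧ c (φ x) (φ i))))
        ≡⟨ ∑-swap n n _ ⟩
          ∑ (λ i → ∑ (λ r → (rep r ∧ K r i) ∧ (Z x i ∧ c (φ x) (φ i))))
        ≡⟨ ∑-cong n (λ i → trans (∑-∧ʳ n (Z x i ∧ c (φ x) (φ i)) _) (cong (_∧ (Z x i ∧ c (φ x) (φ i))) (∑-rep i))) ⟩
          ∑ (λ i → C∖β i ∧ (Z x i ∧ c (φ x) (φ i)))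
        ≡⟨ ∑-cong n (λ i → iff⇒≡
             (λ e → ∧-true (∧-trueʳ {C i} (∧-trueˡ e)) (∧-trueʳ {C∖β i} e))
             (λ e → let zc = ∧-trueʳ {not (β i)} e in ∧-true (∧-true (avoids-closed Cx (Z-adj x i (∧-trueˡ zc)) (cell-live (trans (cell-sym (φ i) (φ x)) (∧-trueʳ {Z x i} zc)))) (∧-trueˡ e)) zc)) ⟩
          ∑ (λ i → not (β i) ∧ (Z x i ∧ c (φ x) (φ i))) ∎
        where
        open ≡-Reasoning
        open xor-∧-Solver

      -- Over every u ≠ φ x the vertex x has y x many Z-neighbours mod 2, so its degree in the lift
      -- is y x times a degree of c.
      ∑-all : ∀ x → ∑ (λ i → Z x i ∧ c (φ x) (φ i)) ≡ false
      ∑-all x = begin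
          ∑ (λ i → Z x i ∧ c (φ x) (φ i))
        ≡⟨ ∑-fibres (Z x) (c (φ x)) ⟩
          ∑ (λ u → c (φ x) u ∧ ∑ (λ i → (φ i == u) ∧ Z x i))
        ≡⟨ ∑-cong N (λ u → trans (cong (c (φ x) u ∧_) (trans (∑-cong n (λ i → ∧-comm (φ i == u) (Z x i))) (Z-deg x u)))
             (∧-cong-true (λ e → trans (cong (λ b → y x ∧ not b) (≢⇒== (cell-≢ e))) (∧-identityʳ (y x))))) ⟩
          ∑ (λ u → c (φ x) u ∧ y x)
        ≡⟨ trans (∑-∧ʳ N (y x) (c (φ x))) (cong (_∧ y x) (cell-even (φ x))) ⟩
          false ∎
        where open ≡-Reasoning

      -- At a vertex of the bag lying in C the cycle has the degree of Z · c.
      cycle-even-inside : ∀ {x} → C x ≡ true → β x ≡ true → ∑ (cycle c x) ≡ false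
      cycle-even-inside {x} Cx x∈ = begin
          ∑ (cycle c x)
        ≡⟨ ∑-xor n _ _ ⟩
          ∑ (λ x′ → coeff x x′ ∧ c (φ x) (φ x′)) xor ∑ (λ x′ → ∑ (λ r → rep r ∧ piece c r x x′))
        ≡⟨ cong₂ _xor_ (∑-coeff Cx x∈) (trans (∑-swap n n _) (trans (∑-cong n (λ r → trans (∑-∧ˡ n (rep r) _)
             (∧-cong-true (λ ρ → ∑-piece ρ x∈)))) (∑-κ Cx))) ⟩
          ∑ (λ i → β i ∧ (Z x i ∧ c (φ x) (φ i))) xor ∑ (λ i → not (β i) ∧ (Z x i ∧ c (φ x) (φ i)))
        ≡⟨ ∑-xor n _ _ ⟨
          ∑ (λ i → (β i ∧ (Z x i ∧ c (φ x) (φ i))) xor (not (β i) ∧ (Z x i ∧ c (φ x) (φ i))))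
        ≡⟨ ∑-cong n (λ i → either (β i) (Z x i ∧ c (φ x) (φ i))) ⟩
          ∑ (λ i → Z x i ∧ c (φ x) (φ i))
        ≡⟨ ∑-all x ⟩
          false ∎
        where
        open ≡-Reasoning
        either : ∀ b q → (b ∧ q) xor (not b ∧ q) ≡ q
        either true  q = xor-identityʳ q
        either false q = refl

      -- Off C a vertex over a live fibre is not attached to any component inside C.
      cycle-even : ∀ x → ∑ (cycle c x) ≡ false
      cycle-even x with bool-split (C∩β x) | search (c (φ x)) (allFin N)
      ... | inj₁ p | _ = cycle-even-inside (∧-trueˡ p) (∧-trueʳ {C x} p)
      ... | inj₂ _ | inj₂ none = ∑-zero n (cycle-zero {c} (λ u → none (∈-allFin u)))
      ... | inj₂ p | inj₁ (u , _ , cu) = ∑-zero n (λ x′ → cong₂ _xor_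
              (cong (λ b → ((b ∧ C∩β x′) ∧ Z x x′) ∧ c (φ x) (φ x′)) p)
              (∑-zero n (λ r → ¬-not (λ e → piece-zero r x′ (no-att r (∧-trueˡ e)) (∧-trueʳ {rep r} e)))))
        where
        no-att : ∀ r → rep r ≡ true → att r x ≡ false
        no-att r ρ = ¬-not (λ a → let x∈ , i , Ki , ix = att⁻ {r} {x} a in true≢false (∧-true (avoids-closed (K⇒C ρ Ki) ix (cell-live cu)) x∈) p)
        piece-zero : ∀ r x′ → att r x ≡ false → ¬ piece c r x x′ ≡ true
        piece-zero r x′ a e = true≢false e (cong₂ _xor_ (cong₂ _xor_
          (trans (cong (λ b → ((φ x == φ x′) ∧ lead r x′) ∧ ((b ∧ not (lead r x)) ∧ κ c r x)) a) (∧-zeroʳ _))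
          (trans (cong (λ b → ((φ x′ == φ x) ∧ b) ∧ load c r x′) l) (cong (_∧ load c r x′) (∧-zeroʳ (φ x′ == φ x)))))
          (cong (λ b → (b ∧ lead r x′) ∧ (θ r (φ x) (φ x′) ∧ c (φ x) (φ x′))) l))
          where
          l : lead r x ≡ false
          l = ¬-not (λ l → true≢false (lead⇒att l) a)

    -- The sum counts the odd vertices of C over v.
    ∑-link : ∀ {v u} → v ≢ u → Avoids C v → Avoids C u →
      ∑ (λ x → ∑ (λ x′ → ((φ x == v) ∧ (φ x′ == u)) ∧ link x x′)) ≡ true
    ∑-link {v} {u} v≢u avv avu = begin
        ∑ (λ x → ∑ (λ x′ → ((φ x == v) ∧ (φ x′ == u)) ∧ link x x′))
      ≡⟨ ∑-cong n (λ x → trans (∑-cong n (λ x′ → ∧-distribˡ-xor ((φ x == v) ∧ (φ x′ == u)) (coeff x x′) _)) (∑-xor n _ _)) ⟩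
        ∑ (λ x → ∑ (λ x′ → ((φ x == v) ∧ (φ x′ == u)) ∧ coeff x x′) xor
          ∑ (λ x′ → ((φ x == v) ∧ (φ x′ == u)) ∧ ∑ (λ r → rep r ∧ ((lead r x ∧ lead r x′) ∧ θ r (φ x) (φ x′)))))
      ≡⟨ ∑-xor n _ _ ⟩
        ∑ (λ x → ∑ (λ x′ → ((φ x == v) ∧ (φ x′ == u)) ∧ coeff x x′)) xor
        ∑ (λ x → ∑ (λ x′ → ((φ x == v) ∧ (φ x′ == u)) ∧ ∑ (λ r → rep r ∧ ((lead r x ∧ lead r x′) ∧ θ r (φ x) (φ x′)))))
      -- The ties split into the Z-edges from the bag into the components and the odd vertices of
      -- the components.
      ≡⟨ cong (S xor_) (trans ties (trans (∑-cong n (λ r → trans (cong (rep r ∧_) (θ-outer r v≢u)) (∧-distribˡ-xor (rep r) (outer (K r) u v) (oddness (K r) v))))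
           (trans (∑-xor n _ _) (cong₂ _xor_ outers odds)))) ⟩
        S xor (∑ (λ x → ∑ (λ i → (((φ x == v) ∧ (φ i == u)) ∧ (C∩β x ∧ C∖β i)) ∧ Z x i)) xor ∑ (λ i → (C∖β i ∧ (φ i == v)) ∧ y i))
      ≡⟨ xor-assoc S _ _ ⟨
        (S xor ∑ (λ x → ∑ (λ i → (((φ x == v) ∧ (φ i == u)) ∧ (C∩β x ∧ C∖β i)) ∧ Z x i))) xor ∑ (λ i → (C∖β i ∧ (φ i == v)) ∧ y i)
      -- The fibre of u has no neighbours of C, so the Z-edges to it from a bag vertex x of C over v
      -- all end in C, either in the bag or in a component; `Z-deg` turns their number into y x.
      ≡⟨ cong (_xor ∑ (λ i → (C∖β i ∧ (φ i == v)) ∧ y i)) (trans (sym (∑-xor n _ _)) (∑-cong n degrees)) ⟩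
        ∑ (λ x → (C∩β x ∧ (φ x == v)) ∧ y x) xor ∑ (λ i → (C∖β i ∧ (φ i == v)) ∧ y i)
      ≡⟨ trans (sym (∑-xor n _ _)) (∑-cong n (λ i → merge (C i) (β i) (φ i == v) (y i))) ⟩
        oddness C v
      ≡⟨ isOdd v avv ⟩
        true ∎
      where
      open ≡-Reasoning
      S = ∑ (λ x → ∑ (λ x′ → ((φ x == v) ∧ (φ x′ == u)) ∧ coeff x x′))
      merge : ∀ c b d q → (((c ∧ b) ∧ d) ∧ q) xor (((c ∧ not b) ∧ d) ∧ q) ≡ (c ∧ d) ∧ q
      merge false b     d q = refl
      merge true  true  d q = xor-identityʳ _
      merge true  false d q = refl
      ties : ∑ (λ x → ∑ (λ x′ → ((φ x == v) ∧ (φ x′ == u)) ∧ ∑ (λ r → rep r ∧ ((lead r x ∧ lead r x′) ∧ θ r (φ x) (φ x′))))) ≡ ∑ (λ r → rep r ∧ θ r v u)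
      ties = begin
          ∑ (λ x → ∑ (λ x′ → ((φ x == v) ∧ (φ x′ == u)) ∧ ∑ (λ r → rep r ∧ ((lead r x ∧ lead r x′) ∧ θ r (φ x) (φ x′)))))
        ≡⟨ ∑-cong n (λ x → trans (∑-cong n (λ x′ → trans (sym (∑-∧ˡ n ((φ x == v) ∧ (φ x′ == u)) _))
             (∑-cong n (λ r → rearrange x x′ r)))) (∑-swap n n _)) ⟩
          ∑ (λ x → ∑ (λ r → ∑ (λ x′ → (rep r ∧ θ r v u) ∧ (((φ x == v) ∧ lead r x) ∧ ((φ x′ == u) ∧ lead r x′)))))
        ≡⟨ trans (∑-swap n n _) (∑-cong n (λ r → trans (∑-cong n (λ x → trans (∑-∧ˡ n (rep r ∧ θ r v u) _)
             (cong ((rep r ∧ θ r v u) ∧_) (∑-∧ˡ n ((φ x == v) ∧ lead r x) _)))) (trans (∑-∧ˡ n (rep r ∧ θ r v u) _)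
             (cong ((rep r ∧ θ r v u) ∧_) (trans (∑-∧ʳ n _ _) (cong₂ _∧_ (∑-lead r v) (∑-lead r u))))))) ⟩
          ∑ (λ r → (rep r ∧ θ r v u) ∧ (hit r v ∧ hit r u))
        ≡⟨ ∑-cong n (λ r → iff⇒≡ ∧-trueˡ (λ e → ∧-true e (∧-true
             (¬-not (λ h → true≢false (∧-trueʳ {rep r} e) (trans (θ-sym r v u) (θ-zero (∧-trueˡ e) (v≢u ∘ sym) h))))
             (¬-not (λ h → true≢false (∧-trueʳ {rep r} e) (θ-zero (∧-trueˡ e) v≢u h)))))) ⟩
          ∑ (λ r → rep r ∧ θ r v u) ∎
        where
        rearrange : ∀ x x′ r → ((φ x == v) ∧ (φ x′ == u)) ∧ (rep r ∧ ((lead r x ∧ lead r x′) ∧ θ r (φ x) (φ x′))) ≡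
          (rep r ∧ θ r v u) ∧ (((φ x == v) ∧ lead r x) ∧ ((φ x′ == u) ∧ lead r x′))
        rearrange x x′ r = trans (∧-cong-true {(φ x == v) ∧ (φ x′ == u)} (λ e → cong₂ (λ p q → rep r ∧ ((lead r x ∧ lead r x′) ∧ θ r p q))
            (==⇒≡ {i = φ x} (∧-trueˡ e)) (==⇒≡ {i = φ x′} (∧-trueʳ {φ x == v} e))))
          (solve 6 (λ d d′ p l l′ θ → (d :* d′) :* (p :* ((l :* l′) :* θ)) := (p :* θ) :* ((d :* l) :* (d′ :* l′))) refl
            (φ x == v) (φ x′ == u) (rep r) (lead r x) (lead r x′) (θ r v u))
          where open xor-∧-Solver
      odds : ∑ (λ r → rep r ∧ oddness (K r) v) ≡ ∑ (λ i → (C∖β i ∧ (φ i == v)) ∧ y i)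
      odds = begin
          ∑ (λ r → rep r ∧ oddness (K r) v)
        ≡⟨ ∑-cong n (λ r → trans (sym (∑-∧ˡ n (rep r) _)) (∑-cong n (λ i →
             solve 4 (λ p k d y → p :* ((k :* d) :* y) := (p :* k) :* (d :* y)) refl (rep r) (K r i) (φ i == v) (y i)))) ⟩
          ∑ (λ r → ∑ (λ i → (rep r ∧ K r i) ∧ ((φ i == v) ∧ y i)))
        ≡⟨ trans (∑-swap n n _) (∑-cong n (λ i → trans (∑-∧ʳ n _ _)
             (trans (cong (_∧ ((φ i == v) ∧ y i)) (∑-rep i)) (sym (∧-assoc _ (φ i == v) (y i)))))) ⟩
          ∑ (λ i → (C∖β i ∧ (φ i == v)) ∧ y i) ∎
        where open xor-∧-Solver
      outers : ∑ (λ r → rep r ∧ outer (K r) u v) ≡ ∑ (λ x → ∑ (λ i → (((φ x == v) ∧ (φ i == u)) ∧ (C∩β x ∧ C∖β i)) ∧ Z x i))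
      outers = begin
          ∑ (λ r → rep r ∧ outer (K r) u v)
        ≡⟨ ∑-cong n (λ r → trans (sym (∑-∧ˡ n (rep r) _)) (∑-cong n (λ i → trans (sym (∑-∧ˡ n (rep r) _))
             (∑-cong n (λ x → bag-end r i x))))) ⟩
          ∑ (λ r → ∑ (λ i → ∑ (λ x → (rep r ∧ K r i) ∧ (((φ x == v) ∧ (φ i == u)) ∧ (C∩β x ∧ Z x i)))))
        ≡⟨ trans (∑-swap n n _) (∑-cong n (λ i → trans (∑-swap n n _) (∑-cong n (λ x →
             trans (∑-∧ʳ n _ _) (trans (cong (_∧ (((φ x == v) ∧ (φ i == u)) ∧ (C∩β x ∧ Z x i))) (∑-rep i))
               (solve 4 (λ c d b z → c :* (d :* (b :* z)) := (d :* (b :* c)) :* z) refl (C∖β i) ((φ x == v) ∧ (φ i == u)) (C∩β x) (Z x i))))))) ⟩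
          ∑ (λ i → ∑ (λ x → (((φ x == v) ∧ (φ i == u)) ∧ (C∩β x ∧ C∖β i)) ∧ Z x i))
        ≡⟨ ∑-swap n n _ ⟩
          ∑ (λ x → ∑ (λ i → (((φ x == v) ∧ (φ i == u)) ∧ (C∩β x ∧ C∖β i)) ∧ Z x i)) ∎
        where
        open xor-∧-Solver
        bag-end : ∀ r i x → rep r ∧ ((K r ⟨ u ⟩ i ∧ (not (K r x) ∧ (φ x == v))) ∧ Z i x) ≡ (rep r ∧ K r i) ∧ (((φ x == v) ∧ (φ i == u)) ∧ (C∩β x ∧ Z x i))
        bag-end r i x = begin
            rep r ∧ (((K r i ∧ (φ i == u)) ∧ (not (K r x) ∧ (φ x == v))) ∧ Z i x)
          ≡⟨ solve 6 (λ p k d m d′ z → p :* (((k :* d) :* (m :* d′)) :* z) := (p :* k) :* ((d′ :* d) :* (z :* m))) refl (rep r) (K r i) (φ i == u) (not (K r x)) (φ x == v) (Z i x) ⟩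
            (rep r ∧ K r i) ∧ (((φ x == v) ∧ (φ i == u)) ∧ (Z i x ∧ not (K r x)))
          ≡⟨ ∧-cong-true {rep r ∧ K r i} (λ rk → ∧-cong-true {(φ x == v) ∧ (φ i == u)} (λ dd → ∧-cong-true {Z i x} (λ z → iff⇒≡
               (λ ¬Kx → let x∈ = proj₁ (att⁻ {r} {x} (att⁺ (∧-trueʳ {rep r} rk) (Z-adj i x z) (not-true⁻ ¬Kx))) in
                 ∧-true (avoids-closed (K⇒C (∧-trueˡ rk) (∧-trueʳ {rep r} rk)) (Z-adj i x z) (subst (Avoids C) (sym (==⇒≡ {i = φ x} (∧-trueˡ dd))) avv)) x∈)
               (λ cb → not-true (β⇒∉K (∧-trueʳ {C x} cb)))))) ⟩
            (rep r ∧ K r i) ∧ (((φ x == v) ∧ (φ i == u)) ∧ (Z i x ∧ C∩β x))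
          ≡⟨ cong (λ q → (rep r ∧ K r i) ∧ (((φ x == v) ∧ (φ i == u)) ∧ q)) (trans (∧-comm (Z i x) _) (cong (C∩β x ∧_) (Z-sym i x))) ⟩
            (rep r ∧ K r i) ∧ (((φ x == v) ∧ (φ i == u)) ∧ (C∩β x ∧ Z x i)) ∎
      degrees : ∀ x → ∑ (λ x′ → ((φ x == v) ∧ (φ x′ == u)) ∧ coeff x x′) xor ∑ (λ i → (((φ x == v) ∧ (φ i == u)) ∧ (C∩β x ∧ C∖β i)) ∧ Z x i) ≡
        (C∩β x ∧ (φ x == v)) ∧ y x
      degrees x = begin
          ∑ (λ x′ → ((φ x == v) ∧ (φ x′ == u)) ∧ coeff x x′) xor ∑ (λ i → (((φ x == v) ∧ (φ i == u)) ∧ (C∩β x ∧ C∖β i)) ∧ Z x i)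
        ≡⟨ ∑-xor n _ _ ⟨
          ∑ (λ i → (((φ x == v) ∧ (φ i == u)) ∧ coeff x i) xor ((((φ x == v) ∧ (φ i == u)) ∧ (C∩β x ∧ C∖β i)) ∧ Z x i))
        ≡⟨ ∑-cong n (λ i → trans
             (solve 6 (λ d e p q q′ z → ((d :* e) :* ((p :* q) :* z)) :+ (((d :* e) :* (p :* q′)) :* z) := (p :* d) :* ((z :* e) :* (q :+ q′))) refl
               (φ x == v) (φ i == u) (C∩β x) (C∩β i) (C∖β i) (Z x i))
             (∧-cong-true {C∩β x ∧ (φ x == v)} (λ e → trans (∧-cong-true {Z x i ∧ (φ i == u)} (λ zd → trans (either (C i) (β i))
               (avoids-closed (∧-trueˡ {C x} (∧-trueˡ {C∩β x} e)) (Z-adj x i (∧-trueˡ zd)) (subst (Avoids C) (sym (==⇒≡ {i = φ i} (∧-trueʳ {Z x i} zd))) avu)))) (∧-identityʳ _)))) ⟩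
          ∑ (λ i → (C∩β x ∧ (φ x == v)) ∧ (Z x i ∧ (φ i == u)))
        ≡⟨ ∑-∧ˡ n _ _ ⟩
          (C∩β x ∧ (φ x == v)) ∧ ∑ (λ i → Z x i ∧ (φ i == u))
        ≡⟨ ∧-cong-true {C∩β x ∧ (φ x == v)} (λ e → trans (Z-deg x u) (trans (cong (λ b → y x ∧ not b)
             (≢⇒== {i = φ x} (λ φx≡u → v≢u (trans (sym (==⇒≡ {i = φ x} (∧-trueʳ {C∩β x} e))) φx≡u)))) (∧-identityʳ (y x)))) ⟩
          (C∩β x ∧ (φ x == v)) ∧ y x ∎
        where
        open xor-∧-Solver
        either : ∀ c b → (c ∧ b) xor (c ∧ not b) ≡ c
        either false b     = refl
        either true  true  = refl
        either true  false = refl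

-- Disjoint copies of K₃,₃

module Gadget {N : ℕ} (z : Fin 6 → Fin N) (z-injective : ∀ {p q} → z p ≡ z q → p ≡ q) where

  pair : Fin 6 → Fin 6 → Fin N → Bool
  pair p q u = (u == z p) xor (u == z q)

  -- With a pair of rows for ρ and a pair of columns for σ, a 4-cycle of K₃,₃.
  rectangle : (ρ σ : Fin N → Bool) → Fin N → Fin N → Bool
  rectangle ρ σ v u = (ρ v ∧ σ u) xor (σ v ∧ ρ u)

  -- Rows are 0, 1, 2 and columns 3, 4, 5; the edges of K₃,₃ are the cells of the Mermin–Peres magic square, and X₁, Z₁, X₂, Z₂
  -- are the cells whose two-qubit Pauli operator involves X, resp. Z, on the first, resp. second, qubit.
  X₁ Z₁ X₂ Z₂ : Fin N → Fin N → Bool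
  X₁ = rectangle (pair 0F 2F) (pair 3F 5F)
  Z₁ = rectangle (pair 1F 2F) (pair 4F 5F)
  X₂ = rectangle (pair 0F 2F) (pair 4F 5F)
  Z₂ = rectangle (pair 1F 2F) (pair 3F 5F)

  z-== : ∀ p q → (z p == z q) ≡ (p == q)
  z-== p q = iff⇒≡ (λ e → ≡⇒== (z-injective (==⇒≡ e))) (λ e → ≡⇒== (cong z (==⇒≡ e)))

  pair-z : ∀ p q s → pair p q (z s) ≡ (s == p) xor (s == q)
  pair-z p q s = cong₂ _xor_ (z-== s p) (z-== s q)

  pair⁻ : ∀ p q {u} → pair p q u ≡ true → ∃ λ s → u ≡ z s
  pair⁻ p q {u} e with bool-split (u == z p) | bool-split (u == z q)
  ... | inj₁ t | _      = p , ==⇒≡ t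
  ... | inj₂ _ | inj₁ t = q , ==⇒≡ t
  ... | inj₂ f | inj₂ g = ⊥-elim (true≢false e (cong₂ _xor_ f g))

  ∑-pair : ∀ p q → ∑ (pair p q) ≡ false
  ∑-pair p q = trans (∑-xor N _ _) (cong₂ _xor_ (one p) (one q))
    where
    one : ∀ p → ∑ (_== z p) ≡ true
    one p = trans (∑-cong N (λ u → sym (∧-identityʳ (u == z p)))) (∑-pick (z p) (λ _ → true))

  rectangle-z : ∀ {ρ σ v b b′} → ρ v ≡ b → σ v ≡ b′ → ∀ u → rectangle ρ σ v u ≡ (b ∧ σ u) xor (b′ ∧ ρ u)
  rectangle-z refl refl u = refl

  rectangle-sym : ∀ ρ σ v u → rectangle ρ σ v u ≡ rectangle ρ σ u v
  rectangle-sym ρ σ v u = solve 4 (λ a b c d → (a :* b) :+ (c :* d) := (d :* c) :+ (b :* a)) refl (ρ v) (σ u) (σ v) (ρ u)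
    where open xor-∧-Solver

  rectangle-diag : ∀ ρ σ v → rectangle ρ σ v v ≡ false
  rectangle-diag ρ σ v = trans (cong ((ρ v ∧ σ v) xor_) (∧-comm (σ v) (ρ v))) (xor-same (ρ v ∧ σ v))

  rectangle-even : ∀ p q p′ q′ v → ∑ (rectangle (pair p q) (pair p′ q′) v) ≡ false
  rectangle-even p q p′ q′ v = trans (∑-xor N _ _) (cong₂ _xor_
    (trans (∑-∧ˡ N (pair p q v) _) (trans (cong (pair p q v ∧_) (∑-pair p′ q′)) (∧-zeroʳ _)))
    (trans (∑-∧ˡ N (pair p′ q′ v) _) (trans (cong (pair p′ q′ v ∧_) (∑-pair p q)) (∧-zeroʳ _))))

  rectangle-live : ∀ p q p′ q′ {v u} → rectangle (pair p q) (pair p′ q′) v u ≡ true → ∃ λ s → v ≡ z s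
  rectangle-live p q p′ q′ {v} {u} e with bool-split (pair p q v) | bool-split (pair p′ q′ v)
  ... | inj₁ t | _      = pair⁻ p q t
  ... | inj₂ _ | inj₁ t = pair⁻ p′ q′ t
  ... | inj₂ f | inj₂ g = ⊥-elim (true≢false e (cong₂ (λ a b → (a ∧ pair p′ q′ u) xor (b ∧ pair p q u)) f g))

  member : ∀ v → (∃ λ s → v ≡ z s) ⊎ (∀ s → (v == z s) ≡ false)
  member v with search (λ s → v == z s) (allFin 6)
  ... | inj₁ (s , _ , e) = inj₁ (s , ==⇒≡ e)
  ... | inj₂ none = inj₂ (λ s → none (∈-allFin s))

  -- The only edge common to X₁ and Z₁ joins row 2 to column 5.
  columns : ∀ u → pair 3F 5F u ∧ pair 4F 5F u ≡ (u == z 5F)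
  columns u with member u
  ... | inj₁ (s , refl) rewrite z-== s 3F | z-== s 4F | z-== s 5F = check s
    where
    check : ∀ s → ((s == 3F) xor (s == 5F)) ∧ ((s == 4F) xor (s == 5F)) ≡ (s == 5F)
    check 0F = refl
    check 1F = refl
    check 2F = refl
    check 3F = refl
    check 4F = refl
    check 5F = refl
  ... | inj₂ none rewrite none 3F | none 4F | none 5F = refl

-- Crossing cycles over one copy of K₃,₃

module Crossings {F : Graph} {N : ℕ} {r₀ : Fin N} {φ : Fin (size F) → Fin N} (o : Odd F r₀ φ) (D : TreeDecomposition F) {k : ℕ}
  (adhesion : ∀ t t′ → adj (tree D) t t′ ≡ true → ∣ (λ v → bag D t v ∧ bag D t′ v) ∣ₛ ≤ k)
  (P : Descent.OddPart o D adhesion) (even-components : Descent.EvenComponents o D adhesion P)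
  (S : Sub (size F)) where

  open Descent o
  open OddPart P
  open TorsoCycles o D adhesion hiding (β; Cell; cycle; link)

  private
    n = size F
    β = TorsoCycles.β o D adhesion P even-components
    Cell = TorsoCycles.Cell o D adhesion P even-components
    cycle = TorsoCycles.cycle o D adhesion P even-components
    link = TorsoCycles.link o D adhesion P even-components

  surviving : Sub n
  surviving v = β v ∧ not (S v)

  module _ (E : Embedding (torso F β) surviving) where

    open Surface (torso F β) surviving E

    record Crossing (z : Fin 6 → Fin N) : Set where
      field
        {a b}  : Fin n → Fin n → Bool
        {p}    : Flag n → Bool
        a-cycle : Cycle a
        b-cycle : Cycle b
        a-local : ∀ {x x′} → a x x′ ≡ true → ∃ λ s → φ x ≡ z s
        b-local : ∀ {x x′} → b x x′ ≡ true → ∃ λ s → φ x ≡ z s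
        p-pot   : Potential a p
        crosses : ω p b ≡ true

    module _ {z : Fin 6 → Fin N} (z-injective : ∀ {p q} → z p ≡ z q → p ≡ q)
      (z-avoids : ∀ s → Avoids C (z s)) (z-S : ∀ x s → φ x ≡ z s → S x ≡ false) where

      open Gadget z z-injective

      private
        rectangle-cell : ∀ p q p′ q′ → Cell (rectangle (pair p q) (pair p′ q′))
        rectangle-cell p q p′ q′ = record
          { cell-sym = rectangle-sym (pair p q) (pair p′ q′)
          ; cell-diag = rectangle-diag (pair p q) (pair p′ q′)
          ; cell-even = rectangle-even p q p′ q′
          ; cell-live = λ {v} {u} e → let s , v≡ = rectangle-live p q p′ q′ {v} {u} e in subst (Avoids C) (sym v≡) (z-avoids s)
          }

        module Rectangle (p q p′ q′ : Fin 6) where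
          c = rectangle (pair p q) (pair p′ q′)
          cell = rectangle-cell p q p′ q′
          local : ∀ {x x′} → cycle c x x′ ≡ true → ∃ λ s → φ x ≡ z s
          local {x} {x′} e = let u , cu = cycle-live P even-components {c} cell {x} {x′} e in rectangle-live p q p′ q′ {φ x} {u} cu
          sym′ = cycle-sym P even-components {c} cell
          alive : ∀ {x x′} → cycle c x x′ ≡ true → S x ≡ false
          alive {x} {x′} e = let s , φx≡ = local {x} {x′} e in z-S x s φx≡
          isCycle : Cycle (cycle c)
          isCycle = record
            { symm = sym′
            ; supp = λ {x} {x′} e → let βx , βx′ , xx′ = cycle-torso P even-components {c} cell {x} {x′} e in
                ∧-true (∧-true βx (not-true (alive {x} {x′} e))) (∧-true (∧-true βx′ (not-true (alive {x′} {x} (trans (sym′ x′ x) e)))) xx′)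
            ; even = cycle-even P even-components {c} cell
            }
          diag : ∀ x → cycle c x x ≡ false
          diag x = ¬-not (λ e → true≢false (proj₂ (proj₂ (cycle-torso P even-components {c} cell {x} {x} e))) (adj-irrefl (torso F β) x))
          pot = potential isCycle

        module RX₁ = Rectangle 0F 2F 3F 5F
        module RZ₁ = Rectangle 1F 2F 4F 5F
        module RX₂ = Rectangle 0F 2F 4F 5F
        module RZ₂ = Rectangle 1F 2F 3F 5F

        pX₁ = proj₁ RX₁.pot
        pX₂ = proj₁ RX₂.pot

        local : ∀ {c c′ x} → (∀ u → c (φ x) u ≡ c′ (φ x) u) → ∀ x′ → cycle c x x′ ≡ cycle c′ x x′
        local {c} {c′} {x} = cycle-local P even-components {c} {c′} {x}

        zero-at : ∀ {c x} → (∀ u → c (φ x) u ≡ false) → ∀ x′ → cycle c x x′ ≡ false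
        zero-at {c} {x} = cycle-zero P even-components {c} {x}

        ω-zeroʳ : ∀ p {c x} → (∀ u → c (φ x) u ≡ false) → ω-at p (cycle c) x ≡ false
        ω-zeroʳ p {c} {x} e = ∑-zero n (λ w → trans (cong (p (x , w , false) ∧_) (zero-at {c} {x} e w)) (∧-zeroʳ _))

        ω-zeroˡ : ∀ {c p b x} → Potential (cycle c) p → Cycle b → (∀ u → c (φ x) u ≡ false) → ω-at p b x ≡ false
        ω-zeroˡ {c} {x = x} pot cb e = ω-at-invariant cb (potential-zero pot (zero-at {c} {x} e))

        ω-localʳ : ∀ p {c c′ x} → (∀ u → c (φ x) u ≡ c′ (φ x) u) → ω-at p (cycle c) x ≡ ω-at p (cycle c′) x
        ω-localʳ p {c} {c′} {x} e = ∑-cong n (λ w → cong (p (x , w , false) ∧_) (local {c} {c′} {x} e w))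

        shared : Fin n → Bool
        shared x = ∑ (λ x′ → cycle X₁ x x′ ∧ cycle Z₁ x x′)

        at : ∀ {p q s v} → v ≡ z s → pair p q v ≡ (s == p) xor (s == q)
        at {p} {q} {s} refl = pair-z p q s

        row : ∀ {p q p′ q′ s v} → v ≡ z s → ∀ u → rectangle (pair p q) (pair p′ q′) v u ≡
          (((s == p) xor (s == q)) ∧ pair p′ q′ u) xor (((s == p′) xor (s == q′)) ∧ pair p q u)
        row {p} {q} {p′} {q′} {s} {v} e = rectangle-z {pair p q} {pair p′ q′} {v} (at {p} {q} e) (at {p′} {q′} e)

        outside : ∀ {p q p′ q′ v} → (∀ s → (v == z s) ≡ false) → ∀ u → rectangle (pair p q) (pair p′ q′) v u ≡ false
        outside {p} {q} {p′} {q′} {v} none = rectangle-z {pair p q} {pair p′ q′} {v} (cong₂ _xor_ (none p) (none q)) (cong₂ _xor_ (none p′) (none q′))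

        -- Only at row 2, where X₁ = Z₂ and X₂ = Z₁, the two local contributions do not cancel.
        local-crossing : ∀ x → ω-at pX₁ (cycle Z₁) x xor ω-at pX₂ (cycle Z₂) x ≡ (φ x == z 2F) ∧ shared x
        local-crossing x with member (φ x)
        ... | inj₂ none = trans (cong₂ _xor_ (ω-zeroʳ pX₁ {Z₁} {x} (outside {1F} {2F} {4F} {5F} {φ x} none)) (ω-zeroʳ pX₂ {Z₂} {x} (outside {1F} {2F} {3F} {5F} {φ x} none)))
                            (cong (_∧ shared x) (sym (none 2F)))
        ... | inj₁ (s , e) = trans (at-vertex s e) (cong (_∧ shared x) (sym (trans (cong (_== z 2F) e) (z-== s 2F))))
          where
          open ≡-Reasoning
          at-vertex : ∀ s → φ x ≡ z s → ω-at pX₁ (cycle Z₁) x xor ω-at pX₂ (cycle Z₂) x ≡ (s == 2F) ∧ shared x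
          -- At rows 0 and 1 and columns 3 and 4, one cycle of each of the two pairs misses the
          -- vertex.
          at-vertex 0F e = cong₂ _xor_ (ω-zeroʳ pX₁ {Z₁} {x} (row {1F} {2F} {4F} {5F} {0F} e)) (ω-zeroʳ pX₂ {Z₂} {x} (row {1F} {2F} {3F} {5F} {0F} e))
          at-vertex 1F e = cong₂ _xor_ (ω-zeroˡ {X₁} {x = x} (proj₂ RX₁.pot) RZ₁.isCycle (row {0F} {2F} {3F} {5F} {1F} e))
                                       (ω-zeroˡ {X₂} {x = x} (proj₂ RX₂.pot) RZ₂.isCycle (row {0F} {2F} {4F} {5F} {1F} e))
          at-vertex 2F e = begin
              ω-at pX₁ (cycle Z₁) x xor ω-at pX₂ (cycle Z₂) x
            ≡⟨ cong₂ _xor_ (ω-localʳ pX₁ {Z₁} {X₂} {x} (λ u → trans (row {1F} {2F} {4F} {5F} {2F} e u) (sym (row {0F} {2F} {4F} {5F} {2F} e u))))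
                           (ω-localʳ pX₂ {Z₂} {X₁} {x} (λ u → trans (row {1F} {2F} {3F} {5F} {2F} e u) (sym (row {0F} {2F} {3F} {5F} {2F} e u)))) ⟩
              ω-at pX₁ (cycle X₂) x xor ω-at pX₂ (cycle X₁) x
            ≡⟨ ω-at-product x RX₁.isCycle RX₂.isCycle (proj₂ RX₁.pot) (proj₂ RX₂.pot) ⟩
              ∑ (λ x′ → cycle X₁ x x′ ∧ cycle X₂ x x′)
            ≡⟨ ∑-cong n (λ x′ → cong (cycle X₁ x x′ ∧_) (local {X₂} {Z₁} {x} (λ u → trans (row {0F} {2F} {4F} {5F} {2F} e u) (sym (row {1F} {2F} {4F} {5F} {2F} e u))) x′)) ⟩
              shared x ∎
          at-vertex 3F e = cong₂ _xor_ (ω-zeroʳ pX₁ {Z₁} {x} (row {1F} {2F} {4F} {5F} {3F} e))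
                                       (ω-zeroˡ {X₂} {x = x} (proj₂ RX₂.pot) RZ₂.isCycle (row {0F} {2F} {4F} {5F} {3F} e))
          at-vertex 4F e = cong₂ _xor_ (ω-zeroˡ {X₁} {x = x} (proj₂ RX₁.pot) RZ₁.isCycle (row {0F} {2F} {3F} {5F} {4F} e))
                                       (ω-zeroʳ pX₂ {Z₂} {x} (row {1F} {2F} {3F} {5F} {4F} e))
          -- At column 5, X₁ agrees with X₂ and Z₁ with Z₂, so the two potentials differ by a
          -- constant and the contributions cancel.
          at-vertex 5F e = begin
              ω-at pX₁ (cycle Z₁) x xor ω-at pX₂ (cycle Z₂) x
            ≡⟨ cong (ω-at pX₁ (cycle Z₁) x xor_) (ω-localʳ pX₂ {Z₂} {Z₁} {x} (λ u → trans (row {1F} {2F} {3F} {5F} {5F} e u) (sym (row {1F} {2F} {4F} {5F} {5F} e u)))) ⟩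
              ω-at pX₁ (cycle Z₁) x xor ω-at pX₂ (cycle Z₁) x
            ≡⟨ ∑-xor n _ _ ⟨
              ∑ (λ w → (pX₁ (x , w , false) ∧ cycle Z₁ x w) xor (pX₂ (x , w , false) ∧ cycle Z₁ x w))
            ≡⟨ ∑-cong n (λ w → sym (∧-distribʳ-xor (cycle Z₁ x w) (pX₁ (x , w , false)) (pX₂ (x , w , false)))) ⟩
              ω-at (λ y → pX₁ y xor pX₂ y) (cycle Z₁) x
            ≡⟨ ω-at-invariant RZ₁.isCycle (potential-diff (proj₂ RX₁.pot) (proj₂ RX₂.pot)
                 (local {X₁} {X₂} {x} (λ u → trans (row {0F} {2F} {3F} {5F} {5F} e u) (sym (row {0F} {2F} {4F} {5F} {5F} e u))))) ⟩
              false ∎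

        -- The lifts of X₁ and Z₁ share edges inside the fibre of row 2, which are seen from both
        -- ends, and edges to the fibre of column 5, which `∑-link` shows to be odd in number.
        ∑-shared : ∑ (λ x → (φ x == z 2F) ∧ shared x) ≡ true
        ∑-shared = begin
            ∑ (λ x → (φ x == z 2F) ∧ shared x)
          ≡⟨ ∑-cong n (λ x → trans (sym (∑-∧ˡ n (φ x == z 2F) _)) (trans (∑-cong n (λ x′ → split x x′)) (∑-xor n _ _))) ⟩
            ∑ (λ x → ∑ (λ x′ → same x x′) xor ∑ (λ x′ → ((φ x == z 2F) ∧ (φ x′ == z 5F)) ∧ link x x′))
          ≡⟨ ∑-xor n _ _ ⟩
            ∑ (λ x → ∑ (λ x′ → same x x′)) xor ∑ (λ x → ∑ (λ x′ → ((φ x == z 2F) ∧ (φ x′ == z 5F)) ∧ link x x′))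
          ≡⟨ cong₂ _xor_ (⨁-symmetric (allFin n) same same-sym same-diag)
               (∑-link P even-components (λ e → contradiction (z-injective e) λ ()) (z-avoids 2F) (z-avoids 5F)) ⟩
            true ∎
          where
          open ≡-Reasoning
          same : Fin n → Fin n → Bool
          same x x′ = ((φ x == z 2F) ∧ (φ x′ == z 2F)) ∧ (cycle X₁ x x′ ∧ cycle Z₁ x x′)
          same-sym : ∀ x x′ → same x x′ ≡ same x′ x
          same-sym x x′ = cong₂ _∧_ (∧-comm (φ x == z 2F) _) (cong₂ _∧_ (RX₁.sym′ x x′) (RZ₁.sym′ x x′))
          same-diag : ∀ x → same x x ≡ false
          same-diag x = trans (cong (((φ x == z 2F) ∧ (φ x == z 2F)) ∧_) (cong (_∧ cycle Z₁ x x) (RX₁.diag x))) (∧-zeroʳ _)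
          2≢5 : (z 2F == z 5F) ≡ false
          2≢5 = z-== 2F 5F
          split : ∀ x x′ → (φ x == z 2F) ∧ (cycle X₁ x x′ ∧ cycle Z₁ x x′) ≡ same x x′ xor (((φ x == z 2F) ∧ (φ x′ == z 5F)) ∧ link x x′)
          split x x′ with bool-split (φ x == z 2F) | bool-split (φ x′ == z 2F)
          ... | inj₂ p | _ = trans (cong (_∧ (cycle X₁ x x′ ∧ cycle Z₁ x x′)) p)
                  (sym (cong (λ d → ((d ∧ (φ x′ == z 2F)) ∧ (cycle X₁ x x′ ∧ cycle Z₁ x x′)) xor ((d ∧ (φ x′ == z 5F)) ∧ link x x′)) p))
          ... | inj₁ p | inj₁ q = trans (cong (_∧ (cycle X₁ x x′ ∧ cycle Z₁ x x′)) p) (sym (trans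
                  (cong₂ (λ d e → ((d ∧ e) ∧ (cycle X₁ x x′ ∧ cycle Z₁ x x′)) xor ((d ∧ (φ x′ == z 5F)) ∧ link x x′)) p q)
                  (trans (cong (λ e → (cycle X₁ x x′ ∧ cycle Z₁ x x′) xor (e ∧ link x x′)) (trans (cong (_== z 5F) (==⇒≡ {i = φ x′} q)) 2≢5)) (xor-identityʳ _))))
          ... | inj₁ p | inj₂ q = trans (cong (_∧ (cycle X₁ x x′ ∧ cycle Z₁ x x′)) p) (trans main (sym
                  (cong₂ (λ d e → ((d ∧ e) ∧ (cycle X₁ x x′ ∧ cycle Z₁ x x′)) xor ((d ∧ (φ x′ == z 5F)) ∧ link x x′)) p q)))
            where
            φx≡ : φ x ≡ z 2F
            φx≡ = ==⇒≡ p
            value : ∀ {c} (g : Fin N → Bool) → (∀ u → c (φ x) u ≡ g u) → cycle c x x′ ≡ link x x′ ∧ g (φ x′)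
            value {c} g e = trans (cycle-link P even-components {c} {x} {x′} (λ φ≡ → ==⇒≢ q (trans (sym φ≡) φx≡))) (cong (link x x′ ∧_) (e (φ x′)))
            collect : ∀ l p q → (l ∧ p) ∧ (l ∧ q) ≡ (p ∧ q) ∧ l
            collect true  p q = sym (∧-identityʳ _)
            collect false p q = sym (∧-zeroʳ _)
            main : cycle X₁ x x′ ∧ cycle Z₁ x x′ ≡ (φ x′ == z 5F) ∧ link x x′
            main = begin
                  cycle X₁ x x′ ∧ cycle Z₁ x x′
                ≡⟨ cong₂ _∧_ (value {X₁} (λ u → pair 3F 5F u xor false) (row {0F} {2F} {3F} {5F} {2F} φx≡)) (value {Z₁} (λ u → pair 4F 5F u xor false) (row {1F} {2F} {4F} {5F} {2F} φx≡)) ⟩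
                  (link x x′ ∧ (pair 3F 5F (φ x′) xor false)) ∧ (link x x′ ∧ (pair 4F 5F (φ x′) xor false))
                ≡⟨ cong₂ (λ p q → (link x x′ ∧ p) ∧ (link x x′ ∧ q)) (xor-identityʳ _) (xor-identityʳ _) ⟩
                  (link x x′ ∧ pair 3F 5F (φ x′)) ∧ (link x x′ ∧ pair 4F 5F (φ x′))
                ≡⟨ collect (link x x′) (pair 3F 5F (φ x′)) (pair 4F 5F (φ x′)) ⟩
                  (pair 3F 5F (φ x′) ∧ pair 4F 5F (φ x′)) ∧ link x x′
                ≡⟨ cong (_∧ link x x′) (columns (φ x′)) ⟩
                  (φ x′ == z 5F) ∧ link x x′ ∎

        -- The embedding may decide which of the two pairs crosses oddly, but not the sum.
        one-crosses : ω pX₁ (cycle Z₁) xor ω pX₂ (cycle Z₂) ≡ true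
        one-crosses = trans (sym (∑-xor n _ _)) (trans (∑-cong n local-crossing) ∑-shared)

      abstract
        crossing : Crossing z
        crossing with bool-split (ω pX₁ (cycle Z₁))
        ... | inj₁ e = record { a-cycle = RX₁.isCycle ; b-cycle = RZ₁.isCycle
                              ; a-local = λ {x} {x′} → RX₁.local {x} {x′} ; b-local = λ {x} {x′} → RZ₁.local {x} {x′}
                              ; p-pot = proj₂ RX₁.pot ; crosses = e }
        ... | inj₂ e = record { a-cycle = RX₂.isCycle ; b-cycle = RZ₂.isCycle
                              ; a-local = λ {x} {x′} → RX₂.local {x} {x′} ; b-local = λ {x} {x′} → RZ₂.local {x} {x′}
                              ; p-pot = proj₂ RX₂.pot ; crosses = trans (cong (_xor ω pX₂ (cycle Z₂)) (sym e)) one-crosses }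

-- The rank of the intersection form against the genus

lookup-unique : ∀ {A : Set} {xs : List A} → Unique xs → ∀ {i j} → Data.List.lookup xs i ≡ Data.List.lookup xs j → i ≡ j
lookup-unique (x∉ ∷ u) {zero}  {zero}  e = refl
lookup-unique (x∉ ∷ u) {zero}  {suc j} e = ⊥-elim (All.lookup x∉ (∈-lookup j) e)
lookup-unique (x∉ ∷ u) {suc i} {zero}  e = ⊥-elim (All.lookup x∉ (∈-lookup i) (sym e))
lookup-unique (x∉ ∷ u) {suc i} {suc j} e = cong suc (lookup-unique u e)

module _ {F : Graph} {m k : ℕ} {r₀ : Fin (m * 6)} {φ : Fin (size F) → Fin (m * 6)} (o : Odd F r₀ φ) (D : TreeDecomposition F)
  (adhesion : ∀ t t′ → adj (tree D) t t′ ≡ true → ∣ (λ v → bag D t v ∧ bag D t′ v) ∣ₛ ≤ k)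
  (P : Descent.OddPart o D adhesion) (even-components : Descent.EvenComponents o D adhesion P) (large : k + k + k < m) where

  open Descent o
  open OddPart P

  module _ (S : Sub (size F)) (|S|≤k : ∣ S ∣ₛ ≤ k)
    (genus : EulerGenus≤ (torso F (bag D t)) (λ v → bag D t v ∧ not (S v)) k) where

   private
    n = size F
    G = torso F (bag D t)
    Y = λ v → bag D t v ∧ not (S v)
    E = proj₁ genus

    open Crossings o D adhesion P even-components S
    open Surface G Y E
    open Faces G Y E

    z : Fin m → Fin 6 → Fin (m * 6)
    z g s = Fin.combine g s

    gadget : Fin n → Fin m
    gadget x = Fin.quotient {m} 6 (φ x)

    gadget-z : ∀ {x g s} → φ x ≡ z g s → gadget x ≡ g
    gadget-z {g = g} {s} e = trans (cong (Fin.quotient {m} 6) e) (cong proj₁ (Fin.remQuot-combine g s))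

    blocking : Fin n → Bool
    blocking x = neighbours F C x ∨ S x

    dead : Fin m → Bool
    dead g = anyF n (λ x → blocking x ∧ (gadget x == g))

    alive = filterᵇ (not ∘ dead) (allFin m)

    -- Every apex and every neighbour of C lies over a single copy, so it spoils at most one.
    few-dead : length (filterᵇ dead (allFin m)) ≤ k + k
    few-dead = begin
        length (filterᵇ dead (allFin m))
      ≤⟨ unique-⊆-length (unique-filterᵇ dead (Unique.allFin⁺ m)) blocked ⟩
        length (map gadget (filterᵇ (neighbours F C) (allFin n) ++ filterᵇ S (allFin n)))
      ≡⟨ trans (List.length-map gadget (filterᵇ (neighbours F C) (allFin n) ++ filterᵇ S (allFin n))) (List.length-++ (filterᵇ (neighbours F C) (allFin n)) {filterᵇ S (allFin n)}) ⟩
        length (filterᵇ (neighbours F C) (allFin n)) + length (filterᵇ S (allFin n))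
      ≡⟨ cong₂ _+_ (sym (countF≡length n (neighbours F C))) (sym (countF≡length n S)) ⟩
        countF n (neighbours F C) + countF n S
      ≤⟨ ℕ.+-mono-≤ thin |S|≤k ⟩
        k + k ∎
      where
      open ℕ.≤-Reasoning
      blocked : ∀ {g} → g ∈ filterᵇ dead (allFin m) → g ∈ map gadget (filterᵇ (neighbours F C) (allFin n) ++ filterᵇ S (allFin n))
      blocked {g} g∈ with x , e ← anyF-true⁻ n (proj₂ (∈-filterᵇ⁻ dead {allFin m} g∈))
        with refl ← ==⇒≡ {i = gadget x} {g} (∧-trueʳ {blocking x} e)
        with ∨-true⁻ {neighbours F C x} (∧-trueˡ e)
      ... | inj₁ p = ∈-map⁺ gadget (∈-++⁺ˡ (∈-filterᵇ⁺ (neighbours F C) (∈-allFin x) p))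
      ... | inj₂ p = ∈-map⁺ gadget (∈-++⁺ʳ (filterᵇ (neighbours F C) (allFin n)) (∈-filterᵇ⁺ S (∈-allFin x) p))

    many-alive : k < length alive
    many-alive = ℕ.+-cancelˡ-< (k + k) k (length alive) (begin-strict
        k + k + k                                              <⟨ large ⟩
        m                                                      ≡⟨ all-count m ⟨
        countF m (λ _ → true)                                  ≡⟨ countF-split m (λ _ → true) dead ⟨
        countF m dead + countF m (λ g → not (dead g))          ≡⟨ cong₂ _+_ (countF≡length m dead) (countF≡length m (not ∘ dead)) ⟩
        length (filterᵇ dead (allFin m)) + length alive        ≤⟨ ℕ.+-monoˡ-≤ (length alive) few-dead ⟩
        k + k + length alive                                   ∎)
      where
      open ℕ.≤-Reasoning
      all-count : ∀ m → countF m (λ _ → true) ≡ m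
      all-count zero    = refl
      all-count (suc m) = cong suc (all-count m)

    M = length alive

    g : Fin M → Fin m
    g = Data.List.lookup alive

    unblocked : ∀ i {x s} → φ x ≡ z (g i) s → blocking x ≡ false
    unblocked i {x} e = ¬-not (λ b → true≢false (anyF-true x (∧-true b (≡⇒== (gadget-z e))))
      (not-true⁻ (proj₂ (∈-filterᵇ⁻ (not ∘ dead) {allFin m} (∈-lookup i)))))

    crossingAt : ∀ i → Crossing E (z (g i))
    crossingAt i = crossing E (λ e → proj₂ (Fin.combine-injective (g i) _ (g i) _ e))
      (λ s x nx e → true≢false (∨-trueˡ nx) (unblocked i e))
      (λ x s e → ¬-not (λ Sx → true≢false (∨-trueʳ {neighbours F C x} Sx) (unblocked i e)))

    module X i = Crossing (crossingAt i)

    -- Cycles over different copies have no common vertex, so the potential of the one is constant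
    -- around each vertex of the other.
    disjoint : ∀ {i j} → i ≢ j → ω (X.p i) (X.b j) ≡ false
    disjoint {i} {j} i≢j = ∑-zero n at
      where
      at : ∀ x → ω-at (X.p i) (X.b j) x ≡ false
      at x with search (X.b j x) (allFin n)
      ... | inj₂ none = ∑-zero n (λ w → trans (cong (X.p i (x , w , false) ∧_) (none (∈-allFin w))) (∧-zeroʳ _))
      ... | inj₁ (w , _ , e) = ω-at-invariant (X.b-cycle j) (potential-zero (X.p-pot i) (λ w′ → ¬-not (λ e′ →
              i≢j (lookup-unique (unique-filterᵇ (not ∘ dead) (Unique.allFin⁺ m))
                (trans (sym (gadget-z (proj₂ (X.a-local i {x} {w′} e′)))) (gadget-z (proj₂ (X.b-local j {x} {w} e))))))))

    diagonal : ∀ i j → ω (X.p i) (X.b j) ≡ (i == j)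
    diagonal i j with i Fin.≟ j
    ... | yes refl = X.crosses i
    ... | no i≢j = disjoint i≢j

    -- Pairing the combined potential q with the b-cycle at j isolates c j. But q and the face
    -- colouring f are potentials of the same cycle, so they have equal pairings, and that of f is
    -- 0.
    impossible : (Σ (Fin M → Bool) λ c → (∃ λ i → i ∈ allFin M × c i ≡ true) × Σ (Flag n → Bool) λ f →
      (∀ {x} → validFlag G Y x ≡ true → f (r0 x) ≡ f x) × Potential (λ v w → ∑ (λ i → c i ∧ X.a i v w)) f) → ⊥
    impossible (c , (j , _ , cj) , f , f-r0 , f-pot) = true≢false cj (begin
        c j
      ≡⟨ ∑-pick j c ⟨
        ∑ (λ i → (i == j) ∧ c i)
      ≡⟨ ∑-cong M (λ i → trans (∧-comm (i == j) (c i)) (cong (c i ∧_) (sym (diagonal i j)))) ⟩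
        ∑ (λ i → c i ∧ ω (X.p i) (X.b j))
      ≡⟨ linear ⟩
        ω q (X.b j)
      ≡⟨ cong (_xor ω q (X.b j)) (sym (ω-r0-invariant (X.b-cycle j) (λ {x} → f-r0 {x}))) ⟩
        ω f (X.b j) xor ω q (X.b j)
      ≡⟨ ∑-xor n _ _ ⟨
        ∑ (λ x → ω-at f (X.b j) x xor ω-at q (X.b j) x)
      ≡⟨ ∑-zero n (λ x → trans (sym (∑-xor n _ _)) (trans
           (∑-cong n (λ w → sym (∧-distribʳ-xor (X.b j x w) (f (x , w , false)) (q (x , w , false)))))
           (ω-at-invariant (X.b-cycle j) (potential-diff f-pot q-pot (λ _ → refl))))) ⟩
        false ∎)
      where
      open ≡-Reasoning
      q : Flag n → Bool
      q x = ∑ (λ i → c i ∧ X.p i x)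
      q-pot : Potential (λ v w → ∑ (λ i → c i ∧ X.a i v w)) q
      q-pot = record
        { pot-r1 = λ ok → ∑-cong M (λ i → cong (c i ∧_) (Potential.pot-r1 (X.p-pot i) ok))
        ; pot-r2 = λ {v} {w} {s} ok → trans (∑-cong M (λ i → trans (cong (c i ∧_) (Potential.pot-r2 (X.p-pot i) ok))
            (∧-distribˡ-xor (c i) (X.p i (v , w , s)) (X.a i v w)))) (∑-xor M _ _)
        }
      linear : ∑ (λ i → c i ∧ ω (X.p i) (X.b j)) ≡ ω q (X.b j)
      linear = begin
          ∑ (λ i → c i ∧ ω (X.p i) (X.b j))
        ≡⟨ ∑-cong M (λ i → trans (sym (∑-∧ˡ n (c i) _)) (∑-cong n (λ x → trans (sym (∑-∧ˡ n (c i) _))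
             (∑-cong n (λ w → sym (∧-assoc (c i) (X.p i (x , w , false)) (X.b j x w))))))) ⟩
          ∑ (λ i → ∑ (λ x → ∑ (λ w → (c i ∧ X.p i (x , w , false)) ∧ X.b j x w)))
        ≡⟨ trans (∑-swap M n _) (∑-cong n (λ x → trans (∑-swap M n _)
             (∑-cong n (λ w → ∑-∧ʳ M (X.b j x w) _)))) ⟩
          ω q (X.b j) ∎

   bag-genus-large : ⊥
   bag-genus-large = impossible (bounding-combination Fin._≟_ (Unique.allFin⁺ M) X.a (λ {i} _ → X.a-cycle i) (proj₂ genus)
     (subst (k <_) (sym (List.length-tabulate (λ i → i))) many-alive))

no-odd : ∀ {F m k} {r₀ : Fin (m * 6)} {φ : Fin (size F) → Fin (m * 6)} → InSum k k k F → k + k + k < m → ¬ Odd F r₀ φ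
no-odd (D , adhesion , bags) large o =
  let P , even-components = Descent.locate o D adhesion
      S , _ , |S|≤k , genus = bags (Descent.OddPart.t P)
  in bag-genus-large o D adhesion P even-components large S |S|≤k genus

theorem1p2 : (k : ℕ) → Σ Graph λ G → Σ Graph λ H →
    (¬ (G ≅ H)) × ((F : Graph) → VFHadwiger≤ F k → hom F G ≡ hom F H)
theorem1p2 k = cfi false , cfi true , cfi-≇ neighbour , indistinguishable
  where
  -- At most k apices and k attachment vertices spoil copies, so of 3k + 1 copies at least k + 1
  -- survive, one more than genus k allows.
  m = suc (k + k + k)
  open CFI (m * 6) zero
  neighbour : ∀ i → ∃ λ j → adj (Kₙ (m * 6)) i j ≡ true
  neighbour zero    = suc zero , refl
  neighbour (suc i) = zero , refl
  indistinguishable : ∀ F → VFHadwiger≤ F k → hom F (cfi false) ≡ hom F (cfi true)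
  indistinguishable F (k′ , k′≤k , inSum) =
    hom-cfi F (λ φ → no-odd inSum (s≤s (ℕ.+-mono-≤ (ℕ.+-mono-≤ k′≤k k′≤k) k′≤k)))
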